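{- The following identities hold: \begin{align*} \sum_{n\ge0}\overline{S_9}(6n+1)q^n&=2\frac{f_2^6f_3^4}{f_1^8f_6^2},\\ \sum_{n\ge0}\overline{S_9}(6n+3)q^n&=4\frac{f_2^5f_3f_6}{f_1^7},\\ \sum_{n\ge0}\overline{S_9}(6n+5)q^n&=8\frac{f_2^4f_6^4}{f_1^6f_3^2}. \end{align*}
   Context: For $|q|<1$ and a positive integer $k$, write $f_k=\prod_{j\ge1}(1-q^{kj})$. The function $\overline{S_9}(n)$ (number of $9$-Schur overpartitions of $n$) is defined by $\sum_{n\ge0}\overline{S_9}(n)q^n=\prod_{n\ge1}\frac{(1+q^{2n-1})(1-q^{9(2n-1)})}{(1+q^{9(2n-1)})(1-q^{2n-1})}=\frac{f_2^3f_9^2f_{36}}{f_1^2f_4f_{18}^3}$. -}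

module Defs where

open import Data.Nat using (ℕ; zero; suc; _∸_) renaming (_*_ to _*ℕ_; _+_ to _+ℕ_)
open import Data.Nat.Base using (_≡ᵇ_)
open import Data.Bool using (if_then_else_)
open import Data.Integer using (ℤ; 0ℤ; 1ℤ; _+_; _*_; -_; +_)
open import Data.List using (List; []; _∷_; map; foldr; upTo)

-- Formal power series over ℤ in q, represented by their coefficient sequences.
Series : Set
Series = ℕ → ℤ

one : Series
one zero    = 1ℤ
one (suc _) = 0ℤ

mono : ℕ → Series
mono m n = if m ≡ᵇ n then 1ℤ else 0ℤ

_⊖_ : Series → Series → Series
(a ⊖ b) n = a n + - b n

_·_ : ℤ → Series → Series
(c · a) n = c * a n

sumℤ : List ℤ → ℤ
sumℤ = foldr _+_ 0ℤ

_⊛_ : Series → Series → Series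
(a ⊛ b) n = sumℤ (map (λ i → a i * b (n ∸ i)) (upTo (suc n)))

infixl 7 _⊛_
infixl 7 _⊘_
infixr 8 _^_

_^_ : Series → ℕ → Series
a ^ zero  = one
a ^ suc m = a ⊛ (a ^ m)

finprod : ℕ → ℕ → Series
finprod k zero    = one
finprod k (suc m) = finprod k m ⊛ (one ⊖ mono (k *ℕ suc m))

-- f_k = ∏_{j≥1} (1 - q^{k j}).  For k ≥ 1 the coefficient of q^n only
-- depends on the factors with j ≤ n (hence also on those with j ≤ n+1).
f : ℕ → Series
f k n = finprod k (suc n) n

-- Multiplicative inverse of a series with constant term 1:
-- c_0 = 1,  c_n = - Σ_{i=1}^{n} a_i c_{n-i}.
-- invCoeffs a n = [c_n , c_{n-1} , … , c_0].
private
  dot : Series → ℕ → List ℤ → ℤ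
  dot a t []       = 0ℤ
  dot a t (c ∷ cs) = a t * c + dot a (suc t) cs

invCoeffs : Series → ℕ → List ℤ
invCoeffs a zero    = 1ℤ ∷ []
invCoeffs a (suc n) = (- dot a 1 cs) ∷ cs
  where cs = invCoeffs a n

headOr0 : List ℤ → ℤ
headOr0 []      = 0ℤ
headOr0 (c ∷ _) = c

inv : Series → Series
inv a n = headOr0 (invCoeffs a n)

-- quotient a / b  (used only for b with constant term 1)
_⊘_ : Series → Series → Series
a ⊘ b = a ⊛ inv b

S9genfun : Series
S9genfun = (f 2 ^ 3 ⊛ f 9 ^ 2 ⊛ f 36) ⊘ (f 1 ^ 2 ⊛ f 4 ⊛ f 18 ^ 3)

S9bar : ℕ → ℤ
S9bar n = S9genfun n

{-# OPTIONS --safe #-}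

-- With φ(q) = Σ q^(k²), the generating function is φ(q) φ(-q⁹) / (φ(-q²) φ(-q¹⁸)). Splitting k modulo 3
-- gives φ(q) = φ(q⁹) + 2q Ω(q³), and Ω(q³) φ(-q⁹) = f₁₂² + q³ D² with D an even series (rotate the double
-- sum), so the odd part of the generating function is 2q f₁₂² / (φ(-q²) φ(-q¹⁸)). It remains to trisect
-- 1 / φ(-q): writing φ(-q) = A - 2qW with A and W series in q³, the denominator A³ - 8q³W³ is the product of
-- φ(-q) over the substitutions q ↦ ωq with ω³ = 1, and this norm is an eta quotient because φ(-q) = f₁² / f₂.
-- Theta series become products by Jacobi's triple product identity.
module Submission where

open import Defs
open import Algebra.Bundles using (CommutativeRing)
import Algebra.Solver.Ring as RingSolver
open import Algebra.Solver.Ring.AlmostCommutativeRing using (fromCommutativeRing; _-Raw-AlmostCommutative⟶_)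
open import Algebra.Structures using (IsCommutativeRing)
open import Data.Empty using (⊥-elim)
open import Data.Integer as ℤ using (ℤ; +_; -[1+_]; 0ℤ; 1ℤ; -1ℤ; ∣_∣)
import Data.Integer.Properties as ℤP
import Data.Integer.Tactic.RingSolver as ℤSolver
open import Data.List using (List; []; _∷_; applyUpTo)
open import Data.List.Properties using (map-applyUpTo)
open import Data.Maybe using (Maybe; just; nothing)
open import Data.Nat as ℕ using (ℕ; zero; suc; _+_; _*_; _∸_; _≤_; _<_; z≤n; s≤s; z<s; s<s; s≤s⁻¹; s<s⁻¹; _⊔_; NonZero; _%_; _/_)
open import Data.Nat.Divisibility using (divides)
import Data.Nat.DivMod as DivMod
import Data.Nat.Properties as ℕP
import Data.Nat.Tactic.RingSolver as ℕSolver
open import Data.Product using (∃; _×_; _,_; proj₁; proj₂)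
open import Data.Sum using (inj₁; inj₂)
open import Function using (_∘_)
open import Level using (0ℓ)
open import Relation.Binary.Definitions using (tri<; tri≈; tri>)
open import Relation.Binary.PropositionalEquality
  using (_≡_; _≢_; refl; sym; trans; cong; cong₂; subst; module ≡-Reasoning)
import Relation.Binary.Reasoning.Setoid as SetoidReasoning
open import Relation.Nullary using (yes; no)

-- Once the odd part is isolated and q² is read as q, it is 2 f₆² / (φ(-q) φ(-q⁹)), where f₆ and
-- φ(-q⁹) are series in q³. All mixing of residues modulo 3 thus comes from 1 / φ(-q), and clearing
-- its denominator leaves the numerator A² + 2qAW + 4q²W², with exactly one term in each residue
-- class. This is why each answer is a single product, and why the three form a geometric
-- progression of ratio 2W/A, that is 2 f₁f₆³ / (f₂f₃³) after q³ is read as q; the constants 2, 4, 8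
-- come from this ratio. Cube roots of unity do not lie in ℤ[[q]], so the norm is introduced as an
-- explicit cubic form in the three sections of a series. Its multiplicativity becomes a polynomial
-- identity, and it passes to infinite products because it is q-adically continuous; on a single
-- factor 1 - q^e it is computed directly. Convergence is q-adic throughout: limits and infinite
-- sums are statements about finitely many coefficients at a time. Jacobi's identity is obtained
-- from its finite form with Gaussian binomial coefficients.

infix 4 _≈_
-- A record rather than a bare function type, so that the two series stay visible in the type
-- instead of being unfolded to coefficients.
record _≈_ (a b : Series) : Set where
  constructor pointwise
  field at : ∀ n → a n ≡ b n
open _≈_

infixl 6 _⊕_
infixl 7 _∗_
infix 8 ⊝_

-- Opaque, since unification would otherwise unfold the operations to coefficients and get stuck there.
opaque
  _⊕_ : Series → Series → Series
  (a ⊕ b) n = a n ℤ.+ b n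

  ⊝_ : Series → Series
  (⊝ a) n = ℤ.- a n

opaque
  _∗_ : Series → Series → Series
  _∗_ = _⊛_

null : Series
null _ = 0ℤ

tail : Series → Series
tail a n = a (suc n)

-- Peeling off the first term gives the Cauchy product a recursion that shifts only the left factor.
∑ : (ℕ → ℤ) → ℕ → ℤ
∑ g zero    = 0ℤ
∑ g (suc n) = g 0 ℤ.+ ∑ (g ∘ suc) n

sumℤ-applyUpTo : ∀ g n → sumℤ (applyUpTo g n) ≡ ∑ g n
sumℤ-applyUpTo g zero    = refl
sumℤ-applyUpTo g (suc n) = cong (λ x → g 0 ℤ.+ x) (sumℤ-applyUpTo (g ∘ suc) n)

opaque
  unfolding _∗_

  ∗-∑ : ∀ a b n → (a ∗ b) n ≡ ∑ (λ i → a i ℤ.* b (n ∸ i)) (suc n)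
  ∗-∑ a b n = trans
    (cong sumℤ (map-applyUpTo (λ i → i) (λ i → a i ℤ.* b (n ∸ i)) (suc n)))
    (sumℤ-applyUpTo (λ i → a i ℤ.* b (n ∸ i)) (suc n))

  ∗-zero : ∀ a b → (a ∗ b) 0 ≡ a 0 ℤ.* b 0
  ∗-zero a b = ℤP.+-identityʳ _

-- This is a b = a(0) b + q (`tail` a) b. Together with `∗-zero` it yields all ring laws by
-- induction on the degree, without reindexing of sums.
∗-suc : ∀ a b n → (a ∗ b) (suc n) ≡ a 0 ℤ.* b (suc n) ℤ.+ (tail a ∗ b) n
∗-suc a b n = trans (∗-∑ a b (suc n)) (cong (λ x → a 0 ℤ.* b (suc n) ℤ.+ x) (sym (∗-∑ (tail a) b n)))

-- The mirror image of `∗-suc`, peeling off the last summand. Commutativity comes from comparing the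
-- two recursions.
∗-sucʳ : ∀ a b n → (a ∗ b) (suc n) ≡ a (suc n) ℤ.* b 0 ℤ.+ (a ∗ tail b) n
∗-sucʳ a b zero = begin
  (a ∗ b) 1                                ≡⟨ ∗-suc a b 0 ⟩
  a 0 ℤ.* b 1 ℤ.+ (tail a ∗ b) 0           ≡⟨ cong₂ ℤ._+_ (sym (∗-zero a (tail b))) (∗-zero (tail a) b) ⟩
  (a ∗ tail b) 0 ℤ.+ a 1 ℤ.* b 0           ≡⟨ ℤP.+-comm ((a ∗ tail b) 0) _ ⟩
  a 1 ℤ.* b 0 ℤ.+ (a ∗ tail b) 0           ∎
  where open ≡-Reasoning
∗-sucʳ a b (suc n) = begin
  (a ∗ b) (suc (suc n))                                                ≡⟨ ∗-suc a b (suc n) ⟩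
  u ℤ.+ (tail a ∗ b) (suc n)                                           ≡⟨ cong (λ x → u ℤ.+ x) (∗-sucʳ (tail a) b n) ⟩
  u ℤ.+ (v ℤ.+ w)                                                      ≡⟨ sym (ℤP.+-assoc u v w) ⟩
  u ℤ.+ v ℤ.+ w                                                        ≡⟨ cong (λ x → x ℤ.+ w) (ℤP.+-comm u v) ⟩
  v ℤ.+ u ℤ.+ w                                                        ≡⟨ ℤP.+-assoc v u w ⟩
  v ℤ.+ (u ℤ.+ w)                                                      ≡⟨ cong (λ x → v ℤ.+ x) (sym (∗-suc a (tail b) n)) ⟩
  v ℤ.+ (a ∗ tail b) (suc n)                                           ∎
  where
  open ≡-Reasoning
  u = a 0 ℤ.* b (suc (suc n))
  v = a (suc (suc n)) ℤ.* b 0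
  w = (tail a ∗ tail b) n

-- Coefficient n of a product sees only coefficients up to n. This serves both exact equality and
-- congruence modulo a power of q.
∗-cong-upTo : ∀ {a a′ b b′} n → (∀ i → i ≤ n → a i ≡ a′ i) → (∀ i → i ≤ n → b i ≡ b′ i) → (a ∗ b) n ≡ (a′ ∗ b′) n
∗-cong-upTo {a} {a′} {b} {b′} zero p q = begin
  (a ∗ b) 0       ≡⟨ ∗-zero a b ⟩
  a 0 ℤ.* b 0     ≡⟨ cong₂ ℤ._*_ (p 0 z≤n) (q 0 z≤n) ⟩
  a′ 0 ℤ.* b′ 0   ≡⟨ sym (∗-zero a′ b′) ⟩
  (a′ ∗ b′) 0     ∎
  where open ≡-Reasoning
∗-cong-upTo {a} {a′} {b} {b′} (suc n) p q = begin
  (a ∗ b) (suc n)                               ≡⟨ ∗-suc a b n ⟩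
  a 0 ℤ.* b (suc n) ℤ.+ (tail a ∗ b) n          ≡⟨ cong₂ ℤ._+_ (cong₂ ℤ._*_ (p 0 z≤n) (q (suc n) ℕP.≤-refl))
                                                     (∗-cong-upTo n (λ i h → p (suc i) (s≤s h)) (λ i h → q i (ℕP.m≤n⇒m≤1+n h))) ⟩
  a′ 0 ℤ.* b′ (suc n) ℤ.+ (tail a′ ∗ b′) n      ≡⟨ sym (∗-suc a′ b′ n) ⟩
  (a′ ∗ b′) (suc n)                             ∎
  where open ≡-Reasoning

∗-comm-at : ∀ n a b → (a ∗ b) n ≡ (b ∗ a) n
∗-comm-at zero a b = trans (∗-zero a b) (trans (ℤP.*-comm (a 0) (b 0)) (sym (∗-zero b a)))
∗-comm-at (suc n) a b = begin
  (a ∗ b) (suc n)                           ≡⟨ ∗-suc a b n ⟩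
  a 0 ℤ.* b (suc n) ℤ.+ (tail a ∗ b) n      ≡⟨ cong₂ ℤ._+_ (ℤP.*-comm (a 0) (b (suc n))) (∗-comm-at n (tail a) b) ⟩
  b (suc n) ℤ.* a 0 ℤ.+ (b ∗ tail a) n      ≡⟨ sym (∗-sucʳ b a n) ⟩
  (b ∗ a) (suc n)                           ∎
  where open ≡-Reasoning

opaque
  unfolding _⊕_

  ∗-distribʳ-at : ∀ n c a b → ((a ⊕ b) ∗ c) n ≡ (a ∗ c) n ℤ.+ (b ∗ c) n
  ∗-distribʳ-at zero c a b = trans (∗-zero (a ⊕ b) c)
    (trans (ℤP.*-distribʳ-+ (c 0) (a 0) (b 0)) (sym (cong₂ ℤ._+_ (∗-zero a c) (∗-zero b c))))
  ∗-distribʳ-at (suc n) c a b = begin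
    ((a ⊕ b) ∗ c) (suc n)                                           ≡⟨ ∗-suc (a ⊕ b) c n ⟩
    (a 0 ℤ.+ b 0) ℤ.* c (suc n) ℤ.+ ((tail a ⊕ tail b) ∗ c) n       ≡⟨ cong (λ x → (a 0 ℤ.+ b 0) ℤ.* c (suc n) ℤ.+ x) (∗-distribʳ-at n c (tail a) (tail b)) ⟩
    (a 0 ℤ.+ b 0) ℤ.* c (suc n) ℤ.+ (x ℤ.+ y)                       ≡⟨ lemma (a 0) (b 0) (c (suc n)) x y ⟩
    (a 0 ℤ.* c (suc n) ℤ.+ x) ℤ.+ (b 0 ℤ.* c (suc n) ℤ.+ y)         ≡⟨ sym (cong₂ ℤ._+_ (∗-suc a c n) (∗-suc b c n)) ⟩
    (a ∗ c) (suc n) ℤ.+ (b ∗ c) (suc n)                             ∎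
    where
    open ≡-Reasoning
    x y : ℤ
    x = (tail a ∗ c) n
    y = (tail b ∗ c) n
    lemma : ∀ a b c x y → (a ℤ.+ b) ℤ.* c ℤ.+ (x ℤ.+ y) ≡ (a ℤ.* c ℤ.+ x) ℤ.+ (b ℤ.* c ℤ.+ y)
    lemma = ℤSolver.solve-∀

∗-scale-at : ∀ n c a b → ((c · a) ∗ b) n ≡ c ℤ.* (a ∗ b) n
∗-scale-at zero c a b = trans (∗-zero (c · a) b) (trans (ℤP.*-assoc c (a 0) (b 0)) (cong (λ x → c ℤ.* x) (sym (∗-zero a b))))
∗-scale-at (suc n) c a b = begin
  ((c · a) ∗ b) (suc n)                                     ≡⟨ ∗-suc (c · a) b n ⟩
  c ℤ.* a 0 ℤ.* b (suc n) ℤ.+ ((c · tail a) ∗ b) n          ≡⟨ cong₂ ℤ._+_ (ℤP.*-assoc c (a 0) (b (suc n))) (∗-scale-at n c (tail a) b) ⟩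
  c ℤ.* (a 0 ℤ.* b (suc n)) ℤ.+ c ℤ.* (tail a ∗ b) n        ≡⟨ sym (ℤP.*-distribˡ-+ c _ _) ⟩
  c ℤ.* (a 0 ℤ.* b (suc n) ℤ.+ (tail a ∗ b) n)              ≡⟨ cong (λ x → c ℤ.* x) (sym (∗-suc a b n)) ⟩
  c ℤ.* (a ∗ b) (suc n)                                     ∎
  where open ≡-Reasoning

opaque
  unfolding _⊕_

  ∗-assoc-at : ∀ n a b c → ((a ∗ b) ∗ c) n ≡ (a ∗ (b ∗ c)) n
  ∗-assoc-at zero a b c = begin
    ((a ∗ b) ∗ c) 0               ≡⟨ ∗-zero (a ∗ b) c ⟩
    (a ∗ b) 0 ℤ.* c 0             ≡⟨ cong (λ x → x ℤ.* c 0) (∗-zero a b) ⟩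
    a 0 ℤ.* b 0 ℤ.* c 0           ≡⟨ ℤP.*-assoc (a 0) (b 0) (c 0) ⟩
    a 0 ℤ.* (b 0 ℤ.* c 0)         ≡⟨ cong (λ x → a 0 ℤ.* x) (sym (∗-zero b c)) ⟩
    a 0 ℤ.* (b ∗ c) 0             ≡⟨ sym (∗-zero a (b ∗ c)) ⟩
    (a ∗ (b ∗ c)) 0               ∎
    where open ≡-Reasoning
  ∗-assoc-at (suc n) a b c = begin
    ((a ∗ b) ∗ c) (suc n)
      ≡⟨ ∗-suc (a ∗ b) c n ⟩
    (a ∗ b) 0 ℤ.* c (suc n) ℤ.+ (tail (a ∗ b) ∗ c) n
      ≡⟨ cong₂ (λ x y → x ℤ.* c (suc n) ℤ.+ y) (∗-zero a b)
           (∗-cong-upTo {b = c} {b′ = c} n (λ i _ → ∗-suc a b i) (λ _ _ → refl)) ⟩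
    a 0 ℤ.* b 0 ℤ.* c (suc n) ℤ.+ (((a 0 · tail b) ⊕ (tail a ∗ b)) ∗ c) n
      ≡⟨ cong (λ y → a 0 ℤ.* b 0 ℤ.* c (suc n) ℤ.+ y) (∗-distribʳ-at n c (a 0 · tail b) (tail a ∗ b)) ⟩
    a 0 ℤ.* b 0 ℤ.* c (suc n) ℤ.+ (((a 0 · tail b) ∗ c) n ℤ.+ ((tail a ∗ b) ∗ c) n)
      ≡⟨ cong₂ (λ x y → a 0 ℤ.* b 0 ℤ.* c (suc n) ℤ.+ (x ℤ.+ y)) (∗-scale-at n (a 0) (tail b) c) (∗-assoc-at n (tail a) b c) ⟩
    a 0 ℤ.* b 0 ℤ.* c (suc n) ℤ.+ (a 0 ℤ.* (tail b ∗ c) n ℤ.+ (tail a ∗ (b ∗ c)) n)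
      ≡⟨ lemma (a 0) (b 0) (c (suc n)) _ _ ⟩
    a 0 ℤ.* (b 0 ℤ.* c (suc n) ℤ.+ (tail b ∗ c) n) ℤ.+ (tail a ∗ (b ∗ c)) n
      ≡⟨ cong (λ x → a 0 ℤ.* x ℤ.+ (tail a ∗ (b ∗ c)) n) (sym (∗-suc b c n)) ⟩
    a 0 ℤ.* (b ∗ c) (suc n) ℤ.+ (tail a ∗ (b ∗ c)) n
      ≡⟨ sym (∗-suc a (b ∗ c) n) ⟩
    (a ∗ (b ∗ c)) (suc n) ∎
    where
    open ≡-Reasoning
    lemma : ∀ a b c x y → a ℤ.* b ℤ.* c ℤ.+ (a ℤ.* x ℤ.+ y) ≡ a ℤ.* (b ℤ.* c ℤ.+ x) ℤ.+ y
    lemma = ℤSolver.solve-∀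

∗-nullˡ-at : ∀ n a → (null ∗ a) n ≡ 0ℤ
∗-nullˡ-at zero a = trans (∗-zero null a) (ℤP.*-zeroˡ (a 0))
∗-nullˡ-at (suc n) a = trans (∗-suc null a n) (cong₂ ℤ._+_ (ℤP.*-zeroˡ (a (suc n))) (∗-nullˡ-at n a))

∗-identityˡ-at : ∀ n a → (one ∗ a) n ≡ a n
∗-identityˡ-at zero a = trans (∗-zero one a) (ℤP.*-identityˡ (a 0))
∗-identityˡ-at (suc n) a = trans (∗-suc one a n)
  (trans (cong₂ ℤ._+_ (ℤP.*-identityˡ (a (suc n))) (∗-nullˡ-at n a)) (ℤP.+-identityʳ _))

≈-refl : ∀ {a} → a ≈ a
≈-refl = pointwise λ _ → refl

≈-sym : ∀ {a b} → a ≈ b → b ≈ a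
≈-sym (pointwise p) = pointwise λ n → sym (p n)

≈-trans : ∀ {a b c} → a ≈ b → b ≈ c → a ≈ c
≈-trans (pointwise p) (pointwise q) = pointwise λ n → trans (p n) (q n)

opaque
  unfolding _⊕_

  ⊕-cong : ∀ {a a′ b b′} → a ≈ a′ → b ≈ b′ → a ⊕ b ≈ a′ ⊕ b′
  ⊕-cong p q = pointwise λ n → cong₂ ℤ._+_ (at p n) (at q n)

  ⊝-cong : ∀ {a a′} → a ≈ a′ → ⊝ a ≈ ⊝ a′
  ⊝-cong p = pointwise λ n → cong ℤ.-_ (at p n)

∗-cong : ∀ {a a′ b b′} → a ≈ a′ → b ≈ b′ → a ∗ b ≈ a′ ∗ b′
∗-cong {a} {a′} {b} {b′} p q = pointwise λ n → ∗-cong-upTo {a} {a′} {b} {b′} n (λ i _ → at p i) (λ i _ → at q i)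

∗-comm : ∀ a b → a ∗ b ≈ b ∗ a
∗-comm a b = pointwise λ n → ∗-comm-at n a b

∗-identityˡ : ∀ a → one ∗ a ≈ a
∗-identityˡ a = pointwise λ n → ∗-identityˡ-at n a

opaque
  unfolding _⊕_

  ∗-distribʳ : ∀ c a b → (a ⊕ b) ∗ c ≈ (a ∗ c) ⊕ (b ∗ c)
  ∗-distribʳ c a b = pointwise λ n → ∗-distribʳ-at n c a b

opaque
  unfolding _⊕_

  isCommutativeRing : IsCommutativeRing _≈_ _⊕_ _∗_ ⊝_ null one
  isCommutativeRing = record
    { isRing = record
      { +-isAbelianGroup = record
        { isGroup = record
          { isMonoid = record
            { isSemigroup = record
              { isMagma = record
                { isEquivalence = record { refl = ≈-refl ; sym = ≈-sym ; trans = ≈-trans }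
                ; ∙-cong = ⊕-cong }
              ; assoc = λ a b c → pointwise λ n → ℤP.+-assoc (a n) (b n) (c n) }
            ; identity = (λ a → pointwise λ n → ℤP.+-identityˡ (a n)) , (λ a → pointwise λ n → ℤP.+-identityʳ (a n)) }
          ; inverse = (λ a → pointwise λ n → ℤP.+-inverseˡ (a n)) , (λ a → pointwise λ n → ℤP.+-inverseʳ (a n))
          ; ⁻¹-cong = ⊝-cong }
        ; comm = λ a b → pointwise λ n → ℤP.+-comm (a n) (b n) }
      ; *-cong = ∗-cong
      ; *-assoc = λ a b c → pointwise λ n → ∗-assoc-at n a b c
      ; *-identity = ∗-identityˡ , λ a → ≈-trans (∗-comm a one) (∗-identityˡ a)
      ; distrib = (λ c a b → ≈-trans (∗-comm c (a ⊕ b)) (≈-trans (∗-distribʳ c a b) (⊕-cong (∗-comm a c) (∗-comm b c))))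
                , ∗-distribʳ }
    ; *-comm = ∗-comm }

seriesRing : CommutativeRing 0ℓ 0ℓ
seriesRing = record { isCommutativeRing = isCommutativeRing }

module R = CommutativeRing seriesRing

-- The solver is given integer coefficients: constants are then compared with
-- decidable equality, which the series themselves do not have.
constant : ℤ → Series
constant (+ 0) = null
constant (+ 1) = one
constant c     = c · one

-- Hides the case split in `constant`, whose separate clauses for 0 and 1 make `con 0ℤ` and `con 1ℤ`
-- denote `null` and `one` on the nose.
constant-· : ∀ c → constant c ≈ c · one
constant-· (+ 0)           = pointwise λ n → sym (ℤP.*-zeroˡ (one n))
constant-· (+ 1)           = pointwise λ n → sym (ℤP.*-identityˡ (one n))
constant-· (+ suc (suc _)) = R.refl
constant-· -[1+ _ ]        = R.refl

constant-∗ : ∀ c a → constant c ∗ a ≈ c · a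
constant-∗ c a = R.trans (R.*-congʳ (constant-· c))
  (pointwise λ n → trans (∗-scale-at n c one a) (cong (λ x → c ℤ.* x) (∗-identityˡ-at n a)))

opaque
  unfolding _⊕_

  constant-+ : ∀ c d → (c ℤ.+ d) · one ≈ (c · one) ⊕ (d · one)
  constant-+ c d = pointwise λ n → ℤP.*-distribʳ-+ (one n) c d

  constant-- : ∀ c → (ℤ.- c) · one ≈ ⊝ (c · one)
  constant-- c = pointwise λ n → sym (ℤP.neg-distribˡ-* c (one n))

constant-* : ∀ c d → constant (c ℤ.* d) ≈ constant c ∗ constant d
constant-* c d = R.trans (constant-· (c ℤ.* d)) (R.sym (R.trans (constant-∗ c (constant d))
  (pointwise λ n → trans (cong (λ x → c ℤ.* x) (at (constant-· d) n)) (sym (ℤP.*-assoc c d (one n))))))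

constant-morphism : CommutativeRing.rawRing ℤP.+-*-commutativeRing -Raw-AlmostCommutative⟶ fromCommutativeRing seriesRing
constant-morphism = record
  { ⟦_⟧ = constant
  ; +-homo = λ c d → R.trans (constant-· (c ℤ.+ d))
      (R.trans (constant-+ c d) (R.sym (R.+-cong (constant-· c) (constant-· d))))
  ; *-homo = constant-*
  ; -‿homo = λ c → R.trans (constant-· (ℤ.- c))
      (R.trans (constant-- c) (R.sym (R.-‿cong (constant-· c))))
  ; 0-homo = R.refl
  ; 1-homo = R.refl
  }

private
  coefficient≟ : (c d : ℤ) → Maybe (constant c ≈ constant d)
  coefficient≟ c d with c ℤ.≟ d
  ... | yes refl = just ≈-refl
  ... | no _     = nothing

module Solver = RingSolver (CommutativeRing.rawRing ℤP.+-*-commutativeRing) (fromCommutativeRing seriesRing) constant-morphism coefficient≟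
open Solver using (Polynomial; solve; _:=_; _:+_; _:*_; :-_; con)

module ≈-Reasoning = SetoidReasoning R.setoid

-- Congruence modulo q^M

infix 4 _≈[_]_
record _≈[_]_ (a : Series) (M : ℕ) (b : Series) : Set where
  constructor upTo[_]
  field below : ∀ n → n < M → a n ≡ b n
open _≈[_]_

≈⇒≈[] : ∀ {a b M} → a ≈ b → a ≈[ M ] b
≈⇒≈[] p = upTo[ (λ n _ → at p n) ]

≈[]⇒≈ : ∀ {a b} → (∀ M → a ≈[ M ] b) → a ≈ b
≈[]⇒≈ p = pointwise λ n → below (p (suc n)) n ℕP.≤-refl

≈[]-refl : ∀ {a M} → a ≈[ M ] a
≈[]-refl = upTo[ (λ _ _ → refl) ]

≈[]-sym : ∀ {a b M} → a ≈[ M ] b → b ≈[ M ] a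
≈[]-sym p = upTo[ (λ n h → sym (below p n h)) ]

≈[]-trans : ∀ {a b c M} → a ≈[ M ] b → b ≈[ M ] c → a ≈[ M ] c
≈[]-trans p q = upTo[ (λ n h → trans (below p n h) (below q n h)) ]

≈[]-weaken : ∀ {a b M N} → M ≤ N → a ≈[ N ] b → a ≈[ M ] b
≈[]-weaken M≤N p = upTo[ (λ n h → below p n (ℕP.≤-trans h M≤N)) ]

opaque
  unfolding _⊕_

  ⊕-cong[] : ∀ {a a′ b b′ M} → a ≈[ M ] a′ → b ≈[ M ] b′ → a ⊕ b ≈[ M ] a′ ⊕ b′
  ⊕-cong[] p q = upTo[ (λ n h → cong₂ ℤ._+_ (below p n h) (below q n h)) ]

  ⊝-cong[] : ∀ {a a′ M} → a ≈[ M ] a′ → ⊝ a ≈[ M ] ⊝ a′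
  ⊝-cong[] p = upTo[ (λ n h → cong ℤ.-_ (below p n h)) ]

∗-cong[] : ∀ {a a′ b b′ M} → a ≈[ M ] a′ → b ≈[ M ] b′ → a ∗ b ≈[ M ] a′ ∗ b′
∗-cong[] {a} {a′} {b} {b′} p q = upTo[ (λ n h →
  ∗-cong-upTo {a} {a′} {b} {b′} n (λ i i≤n → below p i (ℕP.≤-<-trans i≤n h)) (λ i i≤n → below q i (ℕP.≤-<-trans i≤n h))) ]

-- Monomials

mono-zero : mono 0 ≈ one
mono-zero = pointwise λ { zero → refl ; (suc _) → refl }

mono-∗-suc : ∀ m a n → (mono (suc m) ∗ a) (suc n) ≡ (mono m ∗ a) n
mono-∗-suc m a n = trans (∗-suc (mono (suc m)) a n)
  (trans (cong (λ x → x ℤ.+ (mono m ∗ a) n) (ℤP.*-zeroˡ (a (suc n)))) (ℤP.+-identityˡ _))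

mono-∗-shift : ∀ m a n → (mono m ∗ a) (m + n) ≡ a n
mono-∗-shift zero a n = at (R.trans (R.*-congʳ mono-zero) (R.*-identityˡ a)) n
mono-∗-shift (suc m) a n = trans (mono-∗-suc m a (m + n)) (mono-∗-shift m a n)

mono-∗-below : ∀ m a n → n < m → (mono m ∗ a) n ≡ 0ℤ
mono-∗-below (suc m) a zero h = trans (∗-zero (mono (suc m)) a) (ℤP.*-zeroˡ (a 0))
mono-∗-below (suc m) a (suc n) h = trans (mono-∗-suc m a n) (mono-∗-below m a n (s<s⁻¹ h))

mono-+ : ∀ m n → mono (m + n) ≈ mono m ∗ mono n
mono-+ zero n = R.sym (R.trans (R.*-congʳ mono-zero) (R.*-identityˡ (mono n)))
mono-+ (suc m) n = pointwise λ
  { zero    → sym (mono-∗-below (suc m) (mono n) 0 z<s)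
  ; (suc i) → trans (at (mono-+ m n) i) (sym (mono-∗-suc m (mono n) i)) }

-- Multiplication by q^k gains k orders of precision. This is what drives the induction in
-- `dilate-∗`.
mono-raise : ∀ k {a b M} → a ≈[ M ] b → mono k ∗ a ≈[ k + M ] mono k ∗ b
mono-raise k {a} {b} p = upTo[ go k ]
  where
  go : ∀ k n → n < k + _ → (mono k ∗ a) n ≡ (mono k ∗ b) n
  go zero n h = below (∗-cong[] {mono 0} ≈[]-refl p) n h
  go (suc k) zero h = trans (mono-∗-below (suc k) a 0 z<s) (sym (mono-∗-below (suc k) b 0 z<s))
  go (suc k) (suc n) h = trans (mono-∗-suc k a n) (trans (go k n (s<s⁻¹ h)) (sym (mono-∗-suc k b n)))

mono-small : ∀ {e M} → M ≤ e → mono e ≈[ M ] null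
mono-small {e} M≤e = upTo[ (λ n h → trans (sym (at (R.*-identityʳ (mono e)) n)) (mono-∗-below e one n (ℕP.≤-trans h M≤e))) ]

-- Inverses

Unit : Series → Set
Unit a = a 0 ≡ 1ℤ

private
  dotProduct : Series → ℕ → List ℤ → ℤ
  dotProduct a t []       = 0ℤ
  dotProduct a t (c ∷ cs) = a t ℤ.* c ℤ.+ dotProduct a (suc t) cs

  dotProduct-unique : (d : Series → ℕ → List ℤ → ℤ) → (∀ a t → d a t [] ≡ 0ℤ) →
    (∀ a t c cs → d a t (c ∷ cs) ≡ a t ℤ.* c ℤ.+ d a (suc t) cs) → ∀ a t cs → d a t cs ≡ dotProduct a t cs
  dotProduct-unique d d[] d∷ a t []       = d[] a t
  dotProduct-unique d d[] d∷ a t (c ∷ cs) = trans (d∷ a t c cs) (cong (λ x → a t ℤ.* c ℤ.+ x) (dotProduct-unique d d[] d∷ a (suc t) cs))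

  -- The inner product used by invCoeffs is private to Defs, so it is reached by unification: once its
  -- arguments are abstracted to variables, d a t cs is a pattern and determines d.
  inv-suc-dotProduct : ∀ a n → inv a (suc n) ≡ ℤ.- dotProduct a 1 (invCoeffs a n)
  inv-suc-dotProduct = unfold
    where
    d : Series → ℕ → List ℤ → ℤ
    d = _
    unfold : ∀ a n → inv a (suc n) ≡ ℤ.- dotProduct a 1 (invCoeffs a n)
    unfold a n with 1 | invCoeffs a n
    ... | t | cs = cong ℤ.-_ (dotProduct-unique d (λ _ _ → refl) (λ _ _ _ _ → refl) a t cs)

  -- `invCoeffs` lists coefficients downwards while the inner product reads a upwards from t, so the
  -- result is a Cauchy product. The shifted series s stands in for the offset t, so that the
  -- induction can pass to its tail.
  dotProduct-invCoeffs : ∀ a n t s → (∀ i → s i ≡ a (i + t)) → dotProduct a t (invCoeffs a n) ≡ (s ∗ inv a) n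
  dotProduct-invCoeffs a zero t s h = trans (ℤP.+-identityʳ _) (trans (cong (λ x → x ℤ.* 1ℤ) (sym (h 0))) (sym (∗-zero s (inv a))))
  dotProduct-invCoeffs a (suc n) t s h = trans
    (cong₂ ℤ._+_ (cong (λ x → x ℤ.* inv a (suc n)) (sym (h 0)))
      (dotProduct-invCoeffs a n (suc t) (tail s) (λ i → trans (h (suc i)) (cong a (sym (ℕP.+-suc i t))))))
    (sym (∗-suc s (inv a) n))

inv-suc : ∀ a n → inv a (suc n) ≡ ℤ.- (tail a ∗ inv a) n
inv-suc a n = trans (inv-suc-dotProduct a n) (cong ℤ.-_ (dotProduct-invCoeffs a n 1 (tail a) (λ i → cong a (ℕP.+-comm 1 i))))

inv-inverseʳ : ∀ {a} → Unit a → a ∗ inv a ≈ one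
inv-inverseʳ {a} a₀ = pointwise λ
  { zero → trans (∗-zero a (inv a)) (trans (ℤP.*-identityʳ (a 0)) a₀)
  ; (suc n) → trans (∗-suc a (inv a) n)
      (trans (cong (λ x → x ℤ.+ (tail a ∗ inv a) n) (trans (cong₂ ℤ._*_ a₀ (inv-suc a n)) (ℤP.*-identityˡ _)))
        (ℤP.+-inverseˡ ((tail a ∗ inv a) n))) }

Unit-∗ : ∀ {a b} → Unit a → Unit b → Unit (a ∗ b)
Unit-∗ {a} {b} p q = trans (∗-zero a b) (cong₂ ℤ._*_ p q)

opaque
  unfolding _∗_

  ⊛≈∗ : ∀ a b → a ⊛ b ≈ a ∗ b
  ⊛≈∗ a b = R.refl

∗-cancelˡ : ∀ {a} b c → Unit a → a ∗ b ≈ a ∗ c → b ≈ c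
∗-cancelˡ {a} b c a₀ h = begin
  b                 ≈⟨ R.*-identityˡ b ⟨
  one ∗ b           ≈⟨ R.*-congʳ (inv-inverseʳ {a} a₀) ⟨
  a ∗ inv a ∗ b     ≈⟨ solve 3 (λ a i b → a :* i :* b := i :* (a :* b)) R.refl a (inv a) b ⟩
  inv a ∗ (a ∗ b)   ≈⟨ R.*-congˡ h ⟩
  inv a ∗ (a ∗ c)   ≈⟨ solve 3 (λ a i b → a :* i :* b := i :* (a :* b)) R.refl a (inv a) c ⟨
  a ∗ inv a ∗ c     ≈⟨ R.*-congʳ (inv-inverseʳ {a} a₀) ⟩
  one ∗ c           ≈⟨ R.*-identityˡ c ⟩
  c                 ∎
  where open ≈-Reasoning

∗-inv-unique : ∀ {a b x} → Unit b → x ∗ b ≈ a → x ≈ a ∗ inv b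
∗-inv-unique {a} {b} {x} b₀ h = ∗-cancelˡ {b} x (a ∗ inv b) b₀ (begin
  b ∗ x             ≈⟨ R.*-comm b x ⟩
  x ∗ b             ≈⟨ h ⟩
  a                 ≈⟨ R.*-identityʳ a ⟨
  a ∗ one           ≈⟨ R.*-congˡ (inv-inverseʳ {b} b₀) ⟨
  a ∗ (b ∗ inv b)   ≈⟨ solve 3 (λ a b i → a :* (b :* i) := b :* (a :* i)) R.refl a b (inv b) ⟩
  b ∗ (a ∗ inv b)   ∎)
  where open ≈-Reasoning

-- Limits

-- Convergence in the q-adic topology.
record Lim (s : ℕ → Series) (L : Series) : Set where
  constructor lim
  field
    eventually : ∀ M → ∃ λ B → ∀ N → B ≤ N → s N ≈[ M ] L
open Lim

Lim-unique : ∀ {s L L′} → Lim s L → Lim s L′ → L ≈ L′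
Lim-unique p q = ≈[]⇒≈ λ M → let (B , h) = eventually p M ; (B′ , h′) = eventually q M in
  ≈[]-trans (≈[]-sym (h (B ⊔ B′) (ℕP.m≤m⊔n B B′))) (h′ (B ⊔ B′) (ℕP.m≤n⊔m B B′))

Lim-cong : ∀ {s s′ L L′} → (∀ n → s n ≈ s′ n) → L ≈ L′ → Lim s L → Lim s′ L′
Lim-cong e e′ p = lim λ M → let (B , h) = eventually p M in
  B , λ N B≤N → ≈[]-trans (≈[]-sym (≈⇒≈[] (e N))) (≈[]-trans (h N B≤N) (≈⇒≈[] e′))

Lim-const : ∀ a → Lim (λ _ → a) a
Lim-const a = lim λ M → 0 , λ _ _ → ≈[]-refl

Lim-map₂ : (_∙_ : Series → Series → Series) →
  (∀ {a a′ b b′ M} → a ≈[ M ] a′ → b ≈[ M ] b′ → (a ∙ b) ≈[ M ] (a′ ∙ b′)) →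
  ∀ {s t K L} → Lim s K → Lim t L → Lim (λ n → s n ∙ t n) (K ∙ L)
Lim-map₂ _∙_ ∙-cong p q = lim λ M → let (B , h) = eventually p M ; (B′ , h′) = eventually q M in
  B ⊔ B′ , λ N b → ∙-cong (h N (ℕP.≤-trans (ℕP.m≤m⊔n B B′) b)) (h′ N (ℕP.≤-trans (ℕP.m≤n⊔m B B′) b))

Lim-⊕ : ∀ {s t K L} → Lim s K → Lim t L → Lim (λ n → s n ⊕ t n) (K ⊕ L)
Lim-⊕ = Lim-map₂ _⊕_ ⊕-cong[]

Lim-∗ : ∀ {s t K L} → Lim s K → Lim t L → Lim (λ n → s n ∗ t n) (K ∗ L)
Lim-∗ = Lim-map₂ _∗_ (λ {a} {a′} {b} {b′} → ∗-cong[] {a} {a′} {b} {b′})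

Lim-⊝ : ∀ {s L} → Lim s L → Lim (λ n → ⊝ s n) (⊝ L)
Lim-⊝ p = lim λ M → let (B , h) = eventually p M in B , λ N b → ⊝-cong[] (h N b)

Lim-subsequence : ∀ {s L} (g : ℕ → ℕ) → (∀ n → n ≤ g n) → Lim s L → Lim (λ n → s (g n)) L
Lim-subsequence g g≥ p = lim λ M → let (B , h) = eventually p M in B , λ N b → h (g N) (ℕP.≤-trans b (g≥ N))

-- Infinite products

∏ : (ℕ → Series) → ℕ → Series
∏ g zero    = one
∏ g (suc n) = ∏ g n ∗ g n

-- Follows the recipe of `f`: coefficient n is read off after n + 1 factors. It is the limit of the
-- partial products when factor j is 1 modulo q^(j+1), the hypothesis of `HasProd-∏∞`.
∏∞ : (ℕ → Series) → Series
∏∞ g n = ∏ g (suc n) n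

HasProd : (ℕ → Series) → Series → Set
HasProd g P = Lim (∏ g) P

∏-cong : ∀ {g h} → (∀ j → g j ≈ h j) → ∀ n → ∏ g n ≈ ∏ h n
∏-cong e zero    = R.refl
∏-cong e (suc n) = R.*-cong (∏-cong e n) (e n)

∏-∗ : ∀ g h n → ∏ (λ j → g j ∗ h j) n ≈ ∏ g n ∗ ∏ h n
∏-∗ g h zero    = R.sym (R.*-identityˡ one)
∏-∗ g h (suc n) = R.trans (R.*-congʳ (∏-∗ g h n))
  (solve 4 (λ a b c d → a :* b :* (c :* d) := a :* c :* (b :* d)) R.refl (∏ g n) (∏ h n) (g n) (h n))

∏-+ : ∀ g m n → ∏ g (n + m) ≈ ∏ g m ∗ ∏ (λ i → g (i + m)) n
∏-+ g m zero = R.sym (R.*-identityʳ (∏ g m))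
∏-+ g m (suc n) = R.trans (R.*-congʳ (∏-+ g m n)) (R.*-assoc (∏ g m) (∏ (λ i → g (i + m)) n) (g (n + m)))

∏-blocks : ∀ g k n → ∏ (λ j → ∏ (λ i → g (i + j * k)) k) n ≈ ∏ g (n * k)
∏-blocks g k zero = R.refl
∏-blocks g k (suc n) = R.trans (R.*-congʳ (∏-blocks g k n)) (R.sym (∏-+ g (n * k) k))

HasProd-cong : ∀ {g h P} → (∀ j → g j ≈ h j) → HasProd g P → HasProd h P
HasProd-cong e = Lim-cong (∏-cong e) R.refl

HasProd-∗ : ∀ {g h P Q} → HasProd g P → HasProd h Q → HasProd (λ j → g j ∗ h j) (P ∗ Q)
HasProd-∗ {g} {h} p q = Lim-cong (λ n → R.sym (∏-∗ g h n)) R.refl (Lim-∗ p q)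

-- Grouping consecutive factors brings products of different periods to a common one. An identity
-- between infinite products then reduces to a polynomial identity within one block, combined with
-- `Lim-unique`.
HasProd-blocks : ∀ {g P} k → HasProd g P → HasProd (λ j → ∏ (λ i → g (i + j * suc k)) (suc k)) P
HasProd-blocks {g} k p = Lim-cong (λ n → R.sym (∏-blocks g (suc k) n)) R.refl
  (Lim-subsequence (λ n → n * suc k) (λ n → ℕP.m≤m*n n (suc k)) p)

HasProd-∏∞ : ∀ {g} → (∀ j → g j ≈[ suc j ] one) → HasProd g (∏∞ g)
HasProd-∏∞ {g} g≈1 = lim λ M → M , λ N M≤N → upTo[ (λ n n<M → stable n N (ℕP.≤-trans n<M M≤N)) ]
  where
  step : ∀ n → ∏ g (suc n) ≈[ suc n ] ∏ g n
  step n = ≈[]-trans (∗-cong[] {∏ g n} ≈[]-refl (g≈1 n)) (≈⇒≈[] (R.*-identityʳ (∏ g n)))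
  stable : ∀ n N → n < N → ∏ g N n ≡ ∏ g (suc n) n
  stable n (suc N) h with ℕP.m≤n⇒m<n∨m≡n (s≤s⁻¹ h)
  ... | inj₁ n<N  = trans (below (step N) n h) (stable n N n<N)
  ... | inj₂ refl = refl

HasProd-Unit : ∀ {g P} → (∀ j → Unit (g j)) → HasProd g P → Unit P
HasProd-Unit {g} g₀ p = let (B , h) = eventually p 1 in trans (sym (below (h B ℕP.≤-refl) 0 z<s)) (units B)
  where
  units : ∀ n → Unit (∏ g n)
  units zero = refl
  units (suc n) = Unit-∗ {∏ g n} {g n} (units n) (g₀ n)

infix 9 1-_
1-_ : ℕ → Series
1- e = one ⊕ ⊝ mono e

opaque
  unfolding _⊕_

  Unit-1- : ∀ e → Unit (1- suc e)
  Unit-1- e = refl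

1-≈[] : ∀ {e M} → M ≤ e → 1- e ≈[ M ] one
1-≈[] M≤e = ≈[]-trans (⊕-cong[] {one} ≈[]-refl (⊝-cong[] (mono-small M≤e))) (≈⇒≈[] (solve 0 (con 1ℤ :+ :- con 0ℤ := con 1ℤ) R.refl))

-- Dissections

private
  ifZero : ℕ → ℤ → ℤ
  ifZero zero    x = x
  ifZero (suc _) x = 0ℤ

-- dilate k a is a(qᵏ).
dilate : ∀ k .{{_ : NonZero k}} → Series → Series
dilate k a n = ifZero (n % k) (a (n / k))

section : ℕ → ℕ → Series → Series
section k r a n = a (r + n * k)

module _ (k : ℕ) .{{_ : NonZero k}} where

  ≈-residues : ∀ {a b} → (∀ r m → r < k → a (r + m * k) ≡ b (r + m * k)) → a ≈ b
  ≈-residues {a} {b} h = pointwise λ n →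
    subst (λ i → a i ≡ b i) (sym (DivMod.m≡m%n+[m/n]*n n k)) (h (n % k) (n / k) (DivMod.m%n<n n k))

  private
    dilate-at : ∀ a r m → r < k → dilate k a (r + m * k) ≡ ifZero r (a m)
    dilate-at a r m r<k = cong₂ (λ x y → ifZero x (a y))
      (trans (DivMod.[m+kn]%n≡m%n r m k) (DivMod.m<n⇒m%n≡m r<k))
      (trans (DivMod.+-distrib-/-∣ʳ r (divides m refl))
        (cong₂ _+_ (DivMod.m<n⇒m/n≡0 r<k) (DivMod.m*n/n≡m m k)))
  
    ifZero-cong : ∀ r {x y} → x ≡ y → ifZero r x ≡ ifZero r y
    ifZero-cong r refl = refl

  dilate-cong : ∀ {a b} → a ≈ b → dilate k a ≈ dilate k b
  dilate-cong p = pointwise λ n → ifZero-cong (n % k) (at p (n / k))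

  dilate-cong[] : ∀ {a b M} → a ≈[ M ] b → dilate k a ≈[ M ] dilate k b
  dilate-cong[] p = upTo[ (λ n h → ifZero-cong (n % k) (below p (n / k) (ℕP.≤-<-trans (DivMod.m/n≤m n k) h))) ]

  dilate-null : dilate k null ≈ null
  dilate-null = pointwise λ n → zeros (n % k)
    where
    zeros : ∀ r → ifZero r 0ℤ ≡ 0ℤ
    zeros zero    = refl
    zeros (suc _) = refl

  opaque
    unfolding _⊕_

    dilate-⊕ : ∀ a b → dilate k (a ⊕ b) ≈ dilate k a ⊕ dilate k b
    dilate-⊕ a b = pointwise λ n → split (n % k) (a (n / k)) (b (n / k))
      where
      split : ∀ r x y → ifZero r (x ℤ.+ y) ≡ ifZero r x ℤ.+ ifZero r y
      split zero    x y = refl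
      split (suc _) x y = refl

    dilate-⊝ : ∀ a → dilate k (⊝ a) ≈ ⊝ dilate k a
    dilate-⊝ a = pointwise λ n → split (n % k) (a (n / k))
      where
      split : ∀ r x → ifZero r (ℤ.- x) ≡ ℤ.- ifZero r x
      split zero    x = refl
      split (suc _) x = refl

    -- The decomposition a = a(0) + q (`tail` a) with q^k for q. It replaces quotients and
    -- remainders by a recursion.
    dilate-head : ∀ a → dilate k a ≈ constant (a 0) ⊕ mono k ∗ dilate k (tail a)
    dilate-head a = R.trans (≈-residues go) (R.+-congʳ (R.sym (constant-· (a 0))))
      where
      open ≡-Reasoning
      go : ∀ r m → r < k → dilate k a (r + m * k) ≡ ((a 0 · one) ⊕ mono k ∗ dilate k (tail a)) (r + m * k)
      go zero zero h = begin
        dilate k a 0                                                ≡⟨ dilate-at a 0 0 h ⟩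
        a 0                                                         ≡⟨ sym (ℤP.*-identityʳ (a 0)) ⟩
        a 0 ℤ.* 1ℤ                                                  ≡⟨ sym (ℤP.+-identityʳ _) ⟩
        a 0 ℤ.* 1ℤ ℤ.+ 0ℤ                                           ≡⟨ cong (λ x → a 0 ℤ.* 1ℤ ℤ.+ x) (sym (mono-∗-below k (dilate k (tail a)) 0 h)) ⟩
        a 0 ℤ.* 1ℤ ℤ.+ (mono k ∗ dilate k (tail a)) 0               ∎
      go (suc r) zero h = begin
        dilate k a (suc r + 0)                                      ≡⟨ dilate-at a (suc r) 0 h ⟩
        0ℤ                                                          ≡⟨ sym (cong₂ ℤ._+_ (ℤP.*-zeroʳ (a 0)) (mono-∗-below k (dilate k (tail a)) (suc r + 0) (subst (λ i → i < k) (sym (ℕP.+-identityʳ (suc r))) h))) ⟩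
        a 0 ℤ.* 0ℤ ℤ.+ (mono k ∗ dilate k (tail a)) (suc r + 0)     ∎
      go r (suc m) h = begin
        dilate k a (r + suc m * k)                                  ≡⟨ dilate-at a r (suc m) h ⟩
        ifZero r (tail a m)                                         ≡⟨ sym (dilate-at (tail a) r m h) ⟩
        dilate k (tail a) (r + m * k)                               ≡⟨ sym (mono-∗-shift k (dilate k (tail a)) (r + m * k)) ⟩
        (mono k ∗ dilate k (tail a)) (k + (r + m * k))              ≡⟨ cong (λ i → (mono k ∗ dilate k (tail a)) i) reorder ⟩
        (mono k ∗ dilate k (tail a)) (r + suc m * k)                ≡⟨ sym (ℤP.+-identityˡ _) ⟩
        0ℤ ℤ.+ (mono k ∗ dilate k (tail a)) (r + suc m * k)         ≡⟨ cong (λ x → x ℤ.+ (mono k ∗ dilate k (tail a)) (r + suc m * k)) (sym (trans (cong (λ x → a 0 ℤ.* x) (one-positive (ℕP.≤-trans (ℕ.>-nonZero⁻¹ k) (ℕP.≤-trans (ℕP.m≤m+n k (m * k)) (ℕP.m≤n+m (suc m * k) r))))) (ℤP.*-zeroʳ (a 0)))) ⟩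
        ((a 0 · one) ⊕ mono k ∗ dilate k (tail a)) (r + suc m * k)  ∎
        where
        reorder : k + (r + m * k) ≡ r + suc m * k
        reorder = trans (sym (ℕP.+-assoc k r (m * k))) (trans (cong (λ x → x + m * k) (ℕP.+-comm k r)) (ℕP.+-assoc r k (m * k)))
        one-positive : ∀ {n} → 0 < n → one n ≡ 0ℤ
        one-positive {suc n} _ = refl

  dilate-constant : ∀ c → dilate k (constant c) ≈ constant c
  dilate-constant c = begin
    dilate k (constant c)                                              ≈⟨ dilate-head (constant c) ⟩
    constant (constant c 0) ⊕ mono k ∗ dilate k (tail (constant c))    ≈⟨ R.+-cong (R.reflexive (cong constant (constant-0 c))) (R.*-congˡ (dilate-cong (constant-tail c))) ⟩
    constant c ⊕ mono k ∗ dilate k null                                ≈⟨ R.+-congˡ (R.*-congˡ dilate-null) ⟩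
    constant c ⊕ mono k ∗ null                                         ≈⟨ solve 2 (λ c x → c :+ x :* con 0ℤ := c) R.refl (constant c) (mono k) ⟩
    constant c                                                         ∎
    where
    open ≈-Reasoning
    constant-0 : ∀ c → constant c 0 ≡ c
    constant-0 c = trans (at (constant-· c) 0) (ℤP.*-identityʳ c)
    constant-tail : ∀ c → tail (constant c) ≈ null
    constant-tail c = pointwise λ n → trans (at (constant-· c) (suc n)) (ℤP.*-zeroʳ c)

  dilate-scale : ∀ c a → dilate k (constant c ∗ a) ≈ constant c ∗ dilate k a
  dilate-scale c a = R.trans (dilate-cong (constant-∗ c a)) (R.trans
    (pointwise λ n → scale (n % k) (a (n / k))) (R.sym (constant-∗ c (dilate k a))))
    where
    scale : ∀ r x → ifZero r (c ℤ.* x) ≡ c ℤ.* ifZero r x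
    scale zero    x = refl
    scale (suc _) x = sym (ℤP.*-zeroʳ c)

  -- Induction on the precision M. After expanding by `dilate-head`, the two sides differ only in a
  -- smaller instance of the claim that sits behind q^k, and k ≥ 1 supplies the missing order of
  -- precision.
  dilate-∗ : ∀ a b → dilate k (a ∗ b) ≈ dilate k a ∗ dilate k b
  dilate-∗ a b = ≈[]⇒≈ λ M → go M a b
    where
    go : ∀ M a b → dilate k (a ∗ b) ≈[ M ] dilate k a ∗ dilate k b
    go zero a b = upTo[ (λ _ ()) ]
    go (suc M) a b = ≈[]-trans (≈⇒≈[] lhs) (≈[]-trans (⊕-cong[] ≈[]-refl
        (≈[]-weaken (ℕP.+-monoˡ-≤ M (ℕ.>-nonZero⁻¹ k)) (mono-raise k (⊕-cong[] ≈[]-refl (go M (tail a) b)))))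
        (≈⇒≈[] (R.sym rhs)))
      where
      open ≈-Reasoning
      Q A₀ B₀ A B : Series
      Q = mono k
      A₀ = constant (a 0)
      B₀ = constant (b 0)
      A = dilate k (tail a)
      B = dilate k (tail b)
      tail-∗ : tail (a ∗ b) ≈ A₀ ∗ tail b ⊕ tail a ∗ b
      tail-∗ = R.trans (pointwise-tail) (R.+-congʳ (R.sym (constant-∗ (a 0) (tail b))))
        where
        opaque
          unfolding _⊕_
          pointwise-tail : tail (a ∗ b) ≈ (a 0 · tail b) ⊕ tail a ∗ b
          pointwise-tail = pointwise λ n → ∗-suc a b n
      head-∗ : constant ((a ∗ b) 0) ≈ A₀ ∗ B₀
      head-∗ = R.trans (R.reflexive (cong constant (∗-zero a b))) (constant-* (a 0) (b 0))
      lhs : dilate k (a ∗ b) ≈ A₀ ∗ B₀ ⊕ Q ∗ (A₀ ∗ B ⊕ dilate k (tail a ∗ b))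
      lhs = begin
        dilate k (a ∗ b)                                                     ≈⟨ dilate-head (a ∗ b) ⟩
        constant ((a ∗ b) 0) ⊕ Q ∗ dilate k (tail (a ∗ b))                   ≈⟨ R.+-cong head-∗ (R.*-congˡ (dilate-cong tail-∗)) ⟩
        A₀ ∗ B₀ ⊕ Q ∗ dilate k (A₀ ∗ tail b ⊕ tail a ∗ b)                    ≈⟨ R.+-congˡ (R.*-congˡ (dilate-⊕ (A₀ ∗ tail b) (tail a ∗ b))) ⟩
        A₀ ∗ B₀ ⊕ Q ∗ (dilate k (A₀ ∗ tail b) ⊕ dilate k (tail a ∗ b))       ≈⟨ R.+-congˡ (R.*-congˡ (R.+-congʳ (dilate-scale (a 0) (tail b)))) ⟩
        A₀ ∗ B₀ ⊕ Q ∗ (A₀ ∗ B ⊕ dilate k (tail a ∗ b))                       ∎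
      rhs : dilate k a ∗ dilate k b ≈ A₀ ∗ B₀ ⊕ Q ∗ (A₀ ∗ B ⊕ A ∗ dilate k b)
      rhs = begin
        dilate k a ∗ dilate k b                                      ≈⟨ R.*-congʳ (dilate-head a) ⟩
        (A₀ ⊕ Q ∗ A) ∗ dilate k b                                    ≈⟨ solve 4 (λ x q y b → (x :+ q :* y) :* b := x :* b :+ q :* (y :* b)) R.refl A₀ Q A (dilate k b) ⟩
        A₀ ∗ dilate k b ⊕ Q ∗ (A ∗ dilate k b)                       ≈⟨ R.+-congʳ (R.*-congˡ (dilate-head b)) ⟩
        A₀ ∗ (B₀ ⊕ Q ∗ B) ⊕ Q ∗ (A ∗ dilate k b)                     ≈⟨ solve 5 (λ x y q b z → x :* (y :+ q :* b) :+ q :* z := x :* y :+ q :* (x :* b :+ z)) R.refl A₀ B₀ Q B (A ∗ dilate k b) ⟩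
        A₀ ∗ B₀ ⊕ Q ∗ (A₀ ∗ B ⊕ A ∗ dilate k b)                      ∎

  dilate-mono : ∀ e → dilate k (mono e) ≈ mono (e * k)
  dilate-mono zero = begin
    dilate k (mono 0)   ≈⟨ dilate-cong mono-zero ⟩
    dilate k one        ≈⟨ dilate-constant 1ℤ ⟩
    one                 ≈⟨ mono-zero ⟨
    mono 0              ∎
    where open ≈-Reasoning
  dilate-mono (suc e) = begin
    dilate k (mono (suc e))            ≈⟨ dilate-head (mono (suc e)) ⟩
    null ⊕ mono k ∗ dilate k (mono e)  ≈⟨ R.+-identityˡ _ ⟩
    mono k ∗ dilate k (mono e)         ≈⟨ R.*-congˡ (dilate-mono e) ⟩
    mono k ∗ mono (e * k)              ≈⟨ mono-+ k (e * k) ⟨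
    mono (k + e * k)                   ∎
    where open ≈-Reasoning

  dilate-1- : ∀ e → dilate k (1- e) ≈ 1- (e * k)
  dilate-1- e = R.trans (dilate-⊕ one (⊝ mono e)) (R.+-cong (dilate-constant 1ℤ)
    (R.trans (dilate-⊝ (mono e)) (R.-‿cong (dilate-mono e))))

  dilate-∏ : ∀ g n → dilate k (∏ g n) ≈ ∏ (λ j → dilate k (g j)) n
  dilate-∏ g zero    = dilate-constant 1ℤ
  dilate-∏ g (suc n) = R.trans (dilate-∗ (∏ g n) (g n)) (R.*-congʳ (dilate-∏ g n))

  HasProd-dilate : ∀ {g P} → HasProd g P → HasProd (λ j → dilate k (g j)) (dilate k P)
  HasProd-dilate {g} p = lim λ M → let (B , h) = eventually p M in
    B , λ N b → ≈[]-trans (≈⇒≈[] (R.sym (dilate-∏ g N))) (dilate-cong[] (h N b))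

  section-cong : ∀ {a b} r → a ≈ b → section k r a ≈ section k r b
  section-cong r p = pointwise λ n → at p (r + n * k)

  section-cong[] : ∀ {a b M} r → r < k → a ≈[ M * k ] b → section k r a ≈[ M ] section k r b
  section-cong[] {M = M} r r<k p = upTo[ (λ n h → below p (r + n * k) (ℕP.<-≤-trans (ℕP.+-monoˡ-< (n * k) r<k) (ℕP.*-monoˡ-≤ k h))) ]

  opaque
    unfolding _⊕_

    section-⊕ : ∀ a b r → section k r (a ⊕ b) ≈ section k r a ⊕ section k r b
    section-⊕ a b r = R.refl

  section-dilate : ∀ a r → r < k → section k r (mono r ∗ dilate k a) ≈ a
  section-dilate a r r<k = pointwise λ m → trans (mono-∗-shift r (dilate k a) (m * k)) (dilate-at a 0 m (ℕP.≤-<-trans z≤n r<k))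

  section-dilate-≢ : ∀ a r s → r < k → s < k → r ≢ s → section k r (mono s ∗ dilate k a) ≈ null
  section-dilate-≢ a r s r<k s<k r≢s with ℕP.<-cmp r s
  ... | tri≈ _ r≡s _ = ⊥-elim (r≢s r≡s)
  ... | tri> _ _ s<r = pointwise λ m → trans
    (trans (cong (λ i → (mono s ∗ dilate k a) (i + m * k)) (sym (ℕP.m+[n∸m]≡n (ℕP.<⇒≤ s<r))))
      (trans (cong (λ i → (mono s ∗ dilate k a) i) (ℕP.+-assoc s (r ∸ s) (m * k))) (mono-∗-shift s (dilate k a) (r ∸ s + m * k))))
    (trans (dilate-at a (r ∸ s) m (ℕP.≤-<-trans (ℕP.m∸n≤m r s) r<k)) (ifZero-positive (ℕP.m<n⇒0<n∸m s<r)))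
    where
    ifZero-positive : ∀ {r x} → 0 < r → ifZero r x ≡ 0ℤ
    ifZero-positive {suc _} _ = refl
  -- For r < s the shift borrows one period: r + (m+1)k is s plus k - (s - r) + mk, and the residue
  -- k - (s - r) is positive. At m = 0 the coefficient lies below the shift.
  ... | tri< r<s _ _ = pointwise λ
    { zero → mono-∗-below s (dilate k a) (r + 0) (subst (λ i → i < s) (sym (ℕP.+-identityʳ r)) r<s)
    ; (suc m) → trans (cong (λ i → (mono s ∗ dilate k a) i) (reorder m))
        (trans (mono-∗-shift s (dilate k a) (k ∸ (s ∸ r) + m * k))
          (trans (dilate-at a (k ∸ (s ∸ r)) m (ℕP.∸-monoʳ-< {k} {s ∸ r} {0} (ℕP.m<n⇒0<n∸m r<s) (ℕP.≤-trans (ℕP.m∸n≤m s r) (ℕP.<⇒≤ s<k))))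
            (ifZero-positive (ℕP.m<n⇒0<n∸m (ℕP.≤-<-trans (ℕP.m∸n≤m s r) s<k))))) }
    where
    ifZero-positive : ∀ {r x} → 0 < r → ifZero r x ≡ 0ℤ
    ifZero-positive {suc _} _ = refl
    reorder : ∀ m → r + suc m * k ≡ s + (k ∸ (s ∸ r) + m * k)
    reorder m = begin
      r + (k + m * k)                          ≡⟨ cong (λ x → r + (x + m * k)) (sym (ℕP.m+[n∸m]≡n (ℕP.≤-trans (ℕP.m∸n≤m s r) (ℕP.<⇒≤ s<k)))) ⟩
      r + (s ∸ r + (k ∸ (s ∸ r)) + m * k)      ≡⟨ lemma r (s ∸ r) (k ∸ (s ∸ r)) (m * k) ⟩
      r + (s ∸ r) + (k ∸ (s ∸ r) + m * k)      ≡⟨ cong (λ x → x + (k ∸ (s ∸ r) + m * k)) (ℕP.m+[n∸m]≡n (ℕP.<⇒≤ r<s)) ⟩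
      s + (k ∸ (s ∸ r) + m * k)                ∎
      where
      open ≡-Reasoning
      lemma : ∀ a b c d → a + (b + c + d) ≡ a + b + (c + d)
      lemma = ℕSolver.solve-∀

Lim-section : ∀ k .{{_ : NonZero k}} r → r < k → ∀ {s L} → Lim s L → Lim (λ n → section k r (s n)) (section k r L)
Lim-section k r r<k p = lim λ M → let (B , h) = eventually p (M * k) in B , λ N b → section-cong[] k r r<k (h N b)

opaque
  unfolding _∗_ _⊕_

  finprod≈∏ : ∀ k n → finprod k n ≈ ∏ (λ j → 1- (k * suc j)) n
  finprod≈∏ k zero    = R.refl
  finprod≈∏ k (suc n) = R.*-congʳ (finprod≈∏ k n)

HasProd-f : ∀ k .{{_ : NonZero k}} → HasProd (λ j → 1- (k * suc j)) (f k)
HasProd-f k = Lim-cong (λ _ → R.refl) (pointwise λ n → sym (at (finprod≈∏ k (suc n)) n))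
  (HasProd-∏∞ (λ j → 1-≈[] (ℕP.m≤n*m (suc j) k)))

Unit-f : ∀ k .{{_ : NonZero k}} → Unit (f k)
Unit-f k@(suc _) = HasProd-Unit (λ j → Unit-1- _) (HasProd-f k)

-- The norm from ℤ[[q]] to ℤ[[q³]]

trisect : (a₀ a₁ a₂ : Series) → Series
trisect a₀ a₁ a₂ = dilate 3 a₀ ⊕ mono 1 ∗ dilate 3 a₁ ⊕ mono 2 ∗ dilate 3 a₂

private
  mono0∗ : ∀ a → mono 0 ∗ a ≈ a
  mono0∗ a = R.trans (R.*-congʳ mono-zero) (R.*-identityˡ a)

  0<3 : 0 < 3
  0<3 = z<s
  1<3 : 1 < 3
  1<3 = s<s z<s
  2<3 : 2 < 3
  2<3 = s<s (s<s z<s)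

section-trisect : ∀ r a₀ a₁ a₂ → section 3 r (trisect a₀ a₁ a₂)
  ≈ section 3 r (mono 0 ∗ dilate 3 a₀) ⊕ section 3 r (mono 1 ∗ dilate 3 a₁) ⊕ section 3 r (mono 2 ∗ dilate 3 a₂)
section-trisect r a₀ a₁ a₂ = R.trans (section-⊕ 3 _ _ r)
  (R.+-congʳ (R.trans (section-⊕ 3 _ _ r) (R.+-congʳ (section-cong 3 r (R.sym (mono0∗ (dilate 3 a₀)))))))

section-trisect₀ : ∀ a₀ a₁ a₂ → section 3 0 (trisect a₀ a₁ a₂) ≈ a₀
section-trisect₀ a₀ a₁ a₂ = R.trans (section-trisect 0 a₀ a₁ a₂) (R.trans
  (R.+-cong (R.+-cong (section-dilate 3 a₀ 0 0<3) (section-dilate-≢ 3 a₁ 0 1 0<3 1<3 λ ())) (section-dilate-≢ 3 a₂ 0 2 0<3 2<3 λ ()))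
  (solve 1 (λ a → a :+ con 0ℤ :+ con 0ℤ := a) R.refl a₀))

section-trisect₁ : ∀ a₀ a₁ a₂ → section 3 1 (trisect a₀ a₁ a₂) ≈ a₁
section-trisect₁ a₀ a₁ a₂ = R.trans (section-trisect 1 a₀ a₁ a₂) (R.trans
  (R.+-cong (R.+-cong (section-dilate-≢ 3 a₀ 1 0 1<3 0<3 λ ()) (section-dilate 3 a₁ 1 1<3)) (section-dilate-≢ 3 a₂ 1 2 1<3 2<3 λ ()))
  (solve 1 (λ a → con 0ℤ :+ a :+ con 0ℤ := a) R.refl a₁))

section-trisect₂ : ∀ a₀ a₁ a₂ → section 3 2 (trisect a₀ a₁ a₂) ≈ a₂
section-trisect₂ a₀ a₁ a₂ = R.trans (section-trisect 2 a₀ a₁ a₂) (R.trans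
  (R.+-cong (R.+-cong (section-dilate-≢ 3 a₀ 2 0 2<3 0<3 λ ()) (section-dilate-≢ 3 a₁ 2 1 2<3 1<3 λ ())) (section-dilate 3 a₂ 2 2<3))
  (solve 1 (λ a → con 0ℤ :+ con 0ℤ :+ a := a) R.refl a₂))

trisect-section : ∀ a → a ≈ trisect (section 3 0 a) (section 3 1 a) (section 3 2 a)
trisect-section a = ≈-residues 3 λ
  { 0 m _ → sym (at (section-trisect₀ (section 3 0 a) (section 3 1 a) (section 3 2 a)) m)
  ; 1 m _ → sym (at (section-trisect₁ (section 3 0 a) (section 3 1 a) (section 3 2 a)) m)
  ; 2 m _ → sym (at (section-trisect₂ (section 3 0 a) (section 3 1 a) (section 3 2 a)) m)
  ; (suc (suc (suc _))) m (s≤s (s≤s (s≤s ()))) }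

-- Multiplication in the basis 1, q, q² over the series in q³. Products of degree 3 and 4 wrap
-- round, and the resulting q³ is `mono 1` inside the dilation.
trisect-∗ : ∀ a₀ a₁ a₂ b₀ b₁ b₂ → trisect a₀ a₁ a₂ ∗ trisect b₀ b₁ b₂ ≈
  trisect (a₀ ∗ b₀ ⊕ mono 1 ∗ (a₁ ∗ b₂ ⊕ a₂ ∗ b₁)) (a₀ ∗ b₁ ⊕ a₁ ∗ b₀ ⊕ mono 1 ∗ (a₂ ∗ b₂)) (a₀ ∗ b₂ ⊕ a₁ ∗ b₁ ⊕ a₂ ∗ b₀)
trisect-∗ a₀ a₁ a₂ b₀ b₁ b₂ = begin
  trisect a₀ a₁ a₂ ∗ trisect b₀ b₁ b₂
    ≈⟨ R.*-cong (R.+-congˡ (R.*-congʳ q²)) (R.+-congˡ (R.*-congʳ q²)) ⟩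
  (D a₀ ⊕ q ∗ D a₁ ⊕ q ∗ q ∗ D a₂) ∗ (D b₀ ⊕ q ∗ D b₁ ⊕ q ∗ q ∗ D b₂)
    ≈⟨ solve 7 (λ q a b c x y z → (a :+ q :* b :+ q :* q :* c) :* (x :+ q :* y :+ q :* q :* z) :=
         (a :* x :+ q :* q :* q :* (b :* z :+ c :* y)) :+ q :* (a :* y :+ b :* x :+ q :* q :* q :* (c :* z))
           :+ q :* q :* (a :* z :+ b :* y :+ c :* x)) R.refl q (D a₀) (D a₁) (D a₂) (D b₀) (D b₁) (D b₂) ⟩
  (D a₀ ∗ D b₀ ⊕ q ∗ q ∗ q ∗ (D a₁ ∗ D b₂ ⊕ D a₂ ∗ D b₁)) ⊕ q ∗ (D a₀ ∗ D b₁ ⊕ D a₁ ∗ D b₀ ⊕ q ∗ q ∗ q ∗ (D a₂ ∗ D b₂))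
    ⊕ q ∗ q ∗ (D a₀ ∗ D b₂ ⊕ D a₁ ∗ D b₁ ⊕ D a₂ ∗ D b₀)
    ≈⟨ R.+-cong (R.+-cong
         (⊕D (∗D a₀ b₀) (q∗D (⊕D (∗D a₁ b₂) (∗D a₂ b₁))))
         (R.*-congˡ (⊕D (⊕D (∗D a₀ b₁) (∗D a₁ b₀)) (q∗D (∗D a₂ b₂)))))
         (R.*-cong (R.sym q²) (⊕D (⊕D (∗D a₀ b₂) (∗D a₁ b₁)) (∗D a₂ b₀))) ⟩
  trisect (a₀ ∗ b₀ ⊕ mono 1 ∗ (a₁ ∗ b₂ ⊕ a₂ ∗ b₁)) (a₀ ∗ b₁ ⊕ a₁ ∗ b₀ ⊕ mono 1 ∗ (a₂ ∗ b₂)) (a₀ ∗ b₂ ⊕ a₁ ∗ b₁ ⊕ a₂ ∗ b₀) ∎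
  where
  open ≈-Reasoning
  D : Series → Series
  D = dilate 3
  q : Series
  q = mono 1
  q² : mono 2 ≈ q ∗ q
  q² = mono-+ 1 1
  ∗D : ∀ x y → D x ∗ D y ≈ D (x ∗ y)
  ∗D x y = R.sym (dilate-∗ 3 x y)
  ⊕D : ∀ {x y a b} → x ≈ D a → y ≈ D b → x ⊕ y ≈ D (a ⊕ b)
  ⊕D {a = a} {b} p r = R.trans (R.+-cong p r) (R.sym (dilate-⊕ 3 a b))
  q∗D : ∀ {x a} → x ≈ D a → q ∗ q ∗ q ∗ x ≈ D (q ∗ a)
  q∗D {x} {a} p = R.trans (R.*-cong (R.trans (R.*-congʳ (R.sym (mono-+ 1 1))) (R.trans (R.sym (mono-+ 2 1)) (R.sym (dilate-mono 3 1)))) p)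
    (∗D q a)

-- The norm of a₀ + a₁x + a₂x² for x³ = q, that is, the determinant of multiplication by this
-- element in the basis 1, x, x².
normForm : (q a₀ a₁ a₂ : Series) → Series
normForm q a₀ a₁ a₂ = a₀ ∗ a₀ ∗ a₀ ⊕ q ∗ (a₁ ∗ a₁ ∗ a₁) ⊕ q ∗ q ∗ (a₂ ∗ a₂ ∗ a₂) ⊕ ⊝ (constant (+ 3) ∗ q ∗ (a₀ ∗ a₁ ∗ a₂))

normForm-∗ : ∀ b₀ b₁ b₂ a₀ a₁ a₂ q →
  normForm q (a₀ ∗ b₀ ⊕ q ∗ (a₁ ∗ b₂ ⊕ a₂ ∗ b₁)) (a₀ ∗ b₁ ⊕ a₁ ∗ b₀ ⊕ q ∗ (a₂ ∗ b₂)) (a₀ ∗ b₂ ⊕ a₁ ∗ b₁ ⊕ a₂ ∗ b₀)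
   ≈ normForm q a₀ a₁ a₂ ∗ normForm q b₀ b₁ b₂
normForm-∗ = solve 7 (λ b₀ b₁ b₂ a₀ a₁ a₂ q →
  let N = λ a₀ a₁ a₂ → a₀ :* a₀ :* a₀ :+ q :* (a₁ :* a₁ :* a₁) :+ q :* q :* (a₂ :* a₂ :* a₂) :+ :- (con (+ 3) :* q :* (a₀ :* a₁ :* a₂)) in
  N (a₀ :* b₀ :+ q :* (a₁ :* b₂ :+ a₂ :* b₁)) (a₀ :* b₁ :+ a₁ :* b₀ :+ q :* (a₂ :* b₂)) (a₀ :* b₂ :+ a₁ :* b₁ :+ a₂ :* b₀)
   := N a₀ a₁ a₂ :* N b₀ b₁ b₂) R.refl

normForm-cong : ∀ {q a₀ a₁ a₂ b₀ b₁ b₂} → a₀ ≈ b₀ → a₁ ≈ b₁ → a₂ ≈ b₂ → normForm q a₀ a₁ a₂ ≈ normForm q b₀ b₁ b₂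
normForm-cong p₀ p₁ p₂ = R.+-cong (R.+-cong (R.+-cong (R.*-cong (R.*-cong p₀ p₀) p₀) (R.*-congˡ (R.*-cong (R.*-cong p₁ p₁) p₁)))
  (R.*-congˡ (R.*-cong (R.*-cong p₂ p₂) p₂))) (R.-‿cong (R.*-congˡ (R.*-cong (R.*-cong p₀ p₁) p₂)))

-- norm a is the product of a(q), a(ωq), a(ω²q) for ω³ = 1, as a series in q³.
norm : Series → Series
norm a = normForm (mono 1) (section 3 0 a) (section 3 1 a) (section 3 2 a)

norm-cong : ∀ {a b} → a ≈ b → norm a ≈ norm b
norm-cong p = normForm-cong (section-cong 3 0 p) (section-cong 3 1 p) (section-cong 3 2 p)

norm-trisect : ∀ a₀ a₁ a₂ → norm (trisect a₀ a₁ a₂) ≈ normForm (mono 1) a₀ a₁ a₂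
norm-trisect a₀ a₁ a₂ = normForm-cong (section-trisect₀ a₀ a₁ a₂) (section-trisect₁ a₀ a₁ a₂) (section-trisect₂ a₀ a₁ a₂)

norm-∗ : ∀ a b → norm (a ∗ b) ≈ norm a ∗ norm b
norm-∗ a b = R.trans (norm-cong (R.trans (R.*-cong (trisect-section a) (trisect-section b)) (trisect-∗ a₀ a₁ a₂ b₀ b₁ b₂)))
  (R.trans (norm-trisect _ _ _) (normForm-∗ b₀ b₁ b₂ a₀ a₁ a₂ (mono 1)))
  where
  a₀ a₁ a₂ b₀ b₁ b₂ : Series
  a₀ = section 3 0 a
  a₁ = section 3 1 a
  a₂ = section 3 2 a
  b₀ = section 3 0 b
  b₁ = section 3 1 b
  b₂ = section 3 2 b

Lim-norm : ∀ {s L} → Lim s L → Lim (λ n → norm (s n)) (norm L)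
Lim-norm {s} {L} p = Lim-⊕ (Lim-⊕ (Lim-⊕ (cube p₀) (Lim-∗ (Lim-const (mono 1)) (cube p₁)))
    (Lim-∗ (Lim-const (mono 1 ∗ mono 1)) (cube p₂)))
    (Lim-⊝ (Lim-∗ (Lim-const (constant (+ 3) ∗ mono 1)) (Lim-∗ (Lim-∗ p₀ p₁) p₂)))
  where
  cube : ∀ {s L} → Lim s L → Lim (λ n → s n ∗ s n ∗ s n) (L ∗ L ∗ L)
  cube p = Lim-∗ (Lim-∗ p p) p
  p₀ : Lim (λ n → section 3 0 (s n)) (section 3 0 L)
  p₀ = Lim-section 3 0 0<3 p
  p₁ : Lim (λ n → section 3 1 (s n)) (section 3 1 L)
  p₁ = Lim-section 3 1 1<3 p
  p₂ : Lim (λ n → section 3 2 (s n)) (section 3 2 L)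
  p₂ = Lim-section 3 2 2<3 p

norm-one : norm one ≈ one
norm-one = R.trans (norm-cong one-trisect) (R.trans (norm-trisect one null null)
  (solve 1 (λ q → con 1ℤ :* con 1ℤ :* con 1ℤ :+ q :* (con 0ℤ :* con 0ℤ :* con 0ℤ) :+ q :* q :* (con 0ℤ :* con 0ℤ :* con 0ℤ)
     :+ :- (con (+ 3) :* q :* (con 1ℤ :* con 0ℤ :* con 0ℤ)) := con 1ℤ) R.refl (mono 1)))
  where
  one-trisect : one ≈ trisect one null null
  one-trisect = R.sym (R.trans (R.+-cong (R.+-cong (dilate-constant 3 1ℤ) (R.*-congˡ (dilate-null 3))) (R.*-congˡ (dilate-null 3)))
    (solve 2 (λ x y → con 1ℤ :+ x :* con 0ℤ :+ y :* con 0ℤ := con 1ℤ) R.refl (mono 1) (mono 2)))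

-- The norm is multiplicative and, as a polynomial in the three sections, continuous; so it may be
-- taken factor by factor.
HasProd-norm : ∀ {g P} → HasProd g P → HasProd (λ j → norm (g j)) (norm P)
HasProd-norm {g} p = Lim-cong norm-∏ R.refl (Lim-norm p)
  where
  norm-∏ : ∀ n → norm (∏ g n) ≈ ∏ (λ j → norm (g j)) n
  norm-∏ zero = norm-one
  norm-∏ (suc n) = R.trans (norm-∗ (∏ g n) (g n)) (R.*-congʳ (norm-∏ n))

mono-triple : ∀ m → mono (m * 3) ≈ mono m ∗ mono m ∗ mono m
mono-triple m = R.trans (R.reflexive (cong mono (lemma m))) (R.trans (mono-+ (m + m) m) (R.*-congʳ (mono-+ m m)))
  where
  lemma : ∀ m → m * 3 ≡ m + m + m
  lemma = ℕSolver.solve-∀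

mono-residue : ∀ r m → mono (r + m * 3) ≈ mono r ∗ dilate 3 (mono m)
mono-residue r m = R.trans (mono-+ r (m * 3)) (R.*-congˡ (R.sym (dilate-mono 3 m)))

-- The conjugates 1 - ω^j q^e coincide if 3 divides e, and otherwise multiply to 1 - q^(3e), which
-- is 1 - q^e once q³ is read as q. The three residues of e modulo 3 are treated separately, each by
-- exhibiting the sections.
norm-1-₀ : ∀ m → norm (1- (m * 3)) ≈ 1- m ∗ 1- m ∗ 1- m
norm-1-₀ m = R.trans (norm-cong shape) (R.trans (norm-trisect (1- m) null null)
  (solve 2 (λ q x → x :* x :* x :+ q :* (con 0ℤ :* con 0ℤ :* con 0ℤ) :+ q :* q :* (con 0ℤ :* con 0ℤ :* con 0ℤ)
     :+ :- (con (+ 3) :* q :* (x :* con 0ℤ :* con 0ℤ)) := x :* x :* x) R.refl (mono 1) (1- m)))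
  where
  shape : 1- (m * 3) ≈ trisect (1- m) null null
  shape = R.sym (R.trans (R.+-cong (R.+-cong (dilate-1- 3 m) (R.*-congˡ (dilate-null 3))) (R.*-congˡ (dilate-null 3)))
    (solve 3 (λ a x y → a :+ x :* con 0ℤ :+ y :* con 0ℤ := a) R.refl (1- (m * 3)) (mono 1) (mono 2)))

norm-1-₁ : ∀ m → norm (1- (1 + m * 3)) ≈ 1- (1 + m * 3)
norm-1-₁ m = R.trans (norm-cong shape) (R.trans (norm-trisect one (⊝ mono m) null) (R.trans
  (solve 2 (λ q x → con 1ℤ :* con 1ℤ :* con 1ℤ :+ q :* (:- x :* :- x :* :- x) :+ q :* q :* (con 0ℤ :* con 0ℤ :* con 0ℤ)
     :+ :- (con (+ 3) :* q :* (con 1ℤ :* :- x :* con 0ℤ)) := con 1ℤ :+ :- (q :* (x :* x :* x))) R.refl (mono 1) (mono m))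
  (R.+-congˡ (R.-‿cong (R.sym (R.trans (mono-+ 1 (m * 3)) (R.*-congˡ (mono-triple m))))))))
  where
  shape : 1- (1 + m * 3) ≈ trisect one (⊝ mono m) null
  shape = R.sym (R.trans (R.+-cong (R.+-cong (dilate-constant 3 1ℤ) (R.*-congˡ (dilate-⊝ 3 (mono m)))) (R.*-congˡ (dilate-null 3)))
    (R.trans (solve 3 (λ q a y → con 1ℤ :+ q :* :- a :+ y :* con 0ℤ := con 1ℤ :+ :- (q :* a)) R.refl (mono 1) (dilate 3 (mono m)) (mono 2))
      (R.+-congˡ (R.-‿cong (R.sym (mono-residue 1 m))))))

norm-1-₂ : ∀ m → norm (1- (2 + m * 3)) ≈ 1- (2 + m * 3)
norm-1-₂ m = R.trans (norm-cong shape) (R.trans (norm-trisect one null (⊝ mono m)) (R.trans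
  (solve 2 (λ q x → con 1ℤ :* con 1ℤ :* con 1ℤ :+ q :* (con 0ℤ :* con 0ℤ :* con 0ℤ) :+ q :* q :* (:- x :* :- x :* :- x)
     :+ :- (con (+ 3) :* q :* (con 1ℤ :* con 0ℤ :* :- x)) := con 1ℤ :+ :- (q :* q :* (x :* x :* x))) R.refl (mono 1) (mono m))
  (R.+-congˡ (R.-‿cong (R.sym (R.trans (mono-+ 2 (m * 3)) (R.*-cong (mono-+ 1 1) (mono-triple m))))))))
  where
  shape : 1- (2 + m * 3) ≈ trisect one null (⊝ mono m)
  shape = R.sym (R.trans (R.+-cong (R.+-cong (dilate-constant 3 1ℤ) (R.*-congˡ (dilate-null 3))) (R.*-congˡ (dilate-⊝ 3 (mono m))))
    (R.trans (solve 3 (λ q a y → con 1ℤ :+ q :* con 0ℤ :+ y :* :- a := con 1ℤ :+ :- (y :* a)) R.refl (mono 1) (dilate 3 (mono m)) (mono 2))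
      (R.+-congˡ (R.-‿cong (R.sym (mono-residue 2 m))))))

1-cong : ∀ {m n} → m ≡ n → 1- m ≈ 1- n
1-cong refl = R.refl

module _ (c : ℕ) .{{_ : NonZero c}} where

  -- The two hypotheses express that 3 does not divide c. The factors of index prime to 3 then keep
  -- their form and give f_c / f_(3c), while those of index divisible by 3 turn into cubes and give
  -- f_c³.
  norm-f : (∀ j → norm (1- (c * suc (0 + j * 3))) ≈ 1- (c * suc (0 + j * 3))) →
           (∀ j → norm (1- (c * suc (1 + j * 3))) ≈ 1- (c * suc (1 + j * 3))) →
           norm (f c) ∗ f (c * 3) ≈ f c ∗ (f c ∗ f c ∗ f c)
  norm-f h₀ h₁ = Lim-unique
    (HasProd-cong factor (HasProd-∗ (HasProd-norm (HasProd-blocks 2 (HasProd-f c))) (HasProd-f (c * 3) {{ℕP.m*n≢0 c 3}})))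
    (HasProd-∗ (HasProd-blocks 2 (HasProd-f c)) (HasProd-∗ (HasProd-∗ (HasProd-f c) (HasProd-f c)) (HasProd-f c)))
    where
    factor : ∀ j → norm (∏ (λ i → 1- (c * suc (i + j * 3))) 3) ∗ 1- (c * 3 * suc j)
      ≈ ∏ (λ i → 1- (c * suc (i + j * 3))) 3 ∗ (1- (c * suc j) ∗ 1- (c * suc j) ∗ 1- (c * suc j))
    factor j = begin
      norm (one ∗ x ∗ y ∗ z) ∗ w                   ≈⟨ R.*-congʳ (R.trans (norm-cong (R.*-congʳ (R.*-congʳ (R.*-identityˡ x)))) (R.trans (norm-∗ (x ∗ y) z) (R.*-congʳ (norm-∗ x y)))) ⟩
      norm x ∗ norm y ∗ norm z ∗ w                 ≈⟨ R.*-cong (R.*-cong (R.*-cong (h₀ j) (h₁ j)) (R.trans (norm-cong (1-cong (third c j))) (norm-1-₀ (c * suc j)))) (1-cong (fourth c j)) ⟩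
      x ∗ y ∗ (v ∗ v ∗ v) ∗ z                      ≈⟨ solve 4 (λ x y z v → x :* y :* v :* z := con 1ℤ :* x :* y :* z :* v) R.refl x y z (v ∗ v ∗ v) ⟩
      one ∗ x ∗ y ∗ z ∗ (v ∗ v ∗ v)                ∎
      where
      open ≈-Reasoning
      x y z w v : Series
      x = 1- (c * suc (0 + j * 3))
      y = 1- (c * suc (1 + j * 3))
      z = 1- (c * suc (2 + j * 3))
      w = 1- (c * 3 * suc j)
      v = 1- (c * suc j)
      third : ∀ c j → c * suc (2 + j * 3) ≡ c * suc j * 3
      third = ℕSolver.solve-∀
      fourth : ∀ c j → c * 3 * suc j ≡ c * suc (2 + j * 3)
      fourth = ℕSolver.solve-∀

norm-f₁ : norm (f 1) ∗ f 3 ≈ f 1 ∗ (f 1 ∗ f 1 ∗ f 1)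
norm-f₁ = norm-f 1
  (λ j → R.trans (norm-cong (1-cong (e₀ j))) (R.trans (norm-1-₁ j) (1-cong (sym (e₀ j)))))
  (λ j → R.trans (norm-cong (1-cong (e₁ j))) (R.trans (norm-1-₂ j) (1-cong (sym (e₁ j)))))
  where
  e₀ : ∀ j → 1 * suc (0 + j * 3) ≡ 1 + j * 3
  e₀ = ℕSolver.solve-∀
  e₁ : ∀ j → 1 * suc (1 + j * 3) ≡ 2 + j * 3
  e₁ = ℕSolver.solve-∀

norm-f₂ : norm (f 2) ∗ f 6 ≈ f 2 ∗ (f 2 ∗ f 2 ∗ f 2)
norm-f₂ = norm-f 2
  (λ j → R.trans (norm-cong (1-cong (e₀ j))) (R.trans (norm-1-₂ (j + j)) (1-cong (sym (e₀ j)))))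
  (λ j → R.trans (norm-cong (1-cong (e₁ j))) (R.trans (norm-1-₁ (1 + (j + j))) (1-cong (sym (e₁ j)))))
  where
  e₀ : ∀ j → 2 * suc (0 + j * 3) ≡ 2 + (j + j) * 3
  e₀ = ℕSolver.solve-∀
  e₁ : ∀ j → 2 * suc (1 + j * 3) ≡ 1 + (1 + (j + j)) * 3
  e₁ = ℕSolver.solve-∀

-- Sums over ℤ

-- The sum over -n ≤ k < n. This half-open interval is stable under k ↦ -1 - k, and its residue
-- classes modulo 2 or 3 are parametrised by smaller intervals of the same kind when n is a multiple
-- of 2 or 3.
window : (ℤ → Series) → ℕ → Series
window F zero    = null
window F (suc n) = window F n ⊕ (F (+ n) ⊕ F -[1+ n ])

Vanishing : (ℤ → Series) → Set
Vanishing F = ∀ M → ∃ λ B → ∀ k → B ≤ ∣ k ∣ → F k ≈[ M ] null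

-- Convergence of the windows alone would not survive a shift of the index, since terms at opposite
-- ends may cancel. Hence the decay of the terms is recorded as well.
record HasSum (F : ℤ → Series) (s : Series) : Set where
  constructor hasSum
  field
    windows   : Lim (window F) s
    vanishing : Vanishing F
open HasSum

window-cong : ∀ {F G} → (∀ k → F k ≈ G k) → ∀ n → window F n ≈ window G n
window-cong e zero    = R.refl
window-cong e (suc n) = R.+-cong (window-cong e n) (R.+-cong (e (+ n)) (e -[1+ n ]))

window-⊕ : ∀ F G n → window (λ k → F k ⊕ G k) n ≈ window F n ⊕ window G n
window-⊕ F G zero    = R.sym (R.+-identityˡ null)
window-⊕ F G (suc n) = R.trans (R.+-congʳ (window-⊕ F G n))
  (solve 6 (λ a b x y z w → a :+ b :+ (x :+ y :+ (z :+ w)) := a :+ (x :+ z) :+ (b :+ (y :+ w))) R.refl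
    (window F n) (window G n) (F (+ n)) (G (+ n)) (F -[1+ n ]) (G -[1+ n ]))

window-∗ : ∀ c F n → window (λ k → c ∗ F k) n ≈ c ∗ window F n
window-∗ c F zero    = R.sym (R.zeroʳ c)
window-∗ c F (suc n) = R.trans (R.+-congʳ (window-∗ c F n))
  (solve 4 (λ c w x y → c :* w :+ (c :* x :+ c :* y) := c :* (w :+ (x :+ y))) R.refl c (window F n) (F (+ n)) (F -[1+ n ]))

HasSum-unique : ∀ {F s t} → HasSum F s → HasSum F t → s ≈ t
HasSum-unique p q = Lim-unique (windows p) (windows q)

HasSum-cong : ∀ {F G s t} → (∀ k → F k ≈ G k) → s ≈ t → HasSum F s → HasSum G t
HasSum-cong e e′ p = hasSum (Lim-cong (window-cong e) e′ (windows p)) λ M →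
  let (B , h) = vanishing p M in B , λ k b → ≈[]-trans (≈⇒≈[] (R.sym (e k))) (h k b)

Vanishing-⊕ : ∀ {F G} → Vanishing F → Vanishing G → Vanishing (λ k → F k ⊕ G k)
Vanishing-⊕ v w M = let (B , h) = v M ; (B′ , h′) = w M in
  B ⊔ B′ , λ k b → ≈[]-trans (⊕-cong[] (h k (ℕP.≤-trans (ℕP.m≤m⊔n B B′) b)) (h′ k (ℕP.≤-trans (ℕP.m≤n⊔m B B′) b)))
    (≈⇒≈[] (R.+-identityˡ null))

HasSum-⊕ : ∀ {F G s t} → HasSum F s → HasSum G t → HasSum (λ k → F k ⊕ G k) (s ⊕ t)
HasSum-⊕ {F} {G} p q = hasSum (Lim-cong (λ n → R.sym (window-⊕ F G n)) R.refl (Lim-⊕ (windows p) (windows q)))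
  (Vanishing-⊕ (vanishing p) (vanishing q))

Vanishing-∗ : ∀ {F} (c : ℤ → Series) → Vanishing F → Vanishing (λ k → c k ∗ F k)
Vanishing-∗ c v M = let (B , h) = v M in B , λ k b → ≈[]-trans (∗-cong[] {c k} ≈[]-refl (h k b)) (≈⇒≈[] (R.zeroʳ (c k)))

HasSum-∗ : ∀ {F s} c → HasSum F s → HasSum (λ k → c ∗ F k) (c ∗ s)
HasSum-∗ {F} c p = hasSum (Lim-cong (λ n → R.sym (window-∗ c F n)) R.refl (Lim-∗ (Lim-const c) (windows p)))
  (Vanishing-∗ (λ _ → c) (vanishing p))

Vanishing-∘ : ∀ {F} (g : ℤ → ℤ) c → (∀ k → ∣ k ∣ ≤ ∣ g k ∣ + c) → Vanishing F → Vanishing (λ k → F (g k))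
Vanishing-∘ g c g≥ v M = let (B , h) = v M in B + c , λ k b → h (g k) (ℕP.+-cancelʳ-≤ c B ∣ g k ∣ (ℕP.≤-trans b (g≥ k)))

Vanishing-Lim : ∀ {F} (g : ℕ → ℤ) → (∀ n → n ≤ ∣ g n ∣) → Vanishing F → Lim (λ n → F (g n)) null
Vanishing-Lim g g≥ v = lim λ M → let (B , h) = v M in B , λ n b → h (g n) (ℕP.≤-trans b (g≥ n))

-- The involution k ↦ -1 - k, which preserves every window. Negation is this followed by a shift.
reflect : ℤ → ℤ
reflect (+ n)    = -[1+ n ]
reflect -[1+ n ] = + n

HasSum-reflect : ∀ {F s} → HasSum F s → HasSum (λ k → F (reflect k)) s
HasSum-reflect {F} p = hasSum (Lim-cong swap R.refl (windows p)) (Vanishing-∘ reflect 1 bound (vanishing p))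
  where
  swap : ∀ n → window F n ≈ window (λ k → F (reflect k)) n
  swap zero    = R.refl
  swap (suc n) = R.+-cong (swap n) (R.+-comm (F (+ n)) (F -[1+ n ]))
  bound : ∀ k → ∣ k ∣ ≤ ∣ reflect k ∣ + 1
  bound (+ n)    = ℕP.≤-trans (ℕP.n≤1+n n) (ℕP.m≤m+n (suc n) 1)
  bound -[1+ n ] = ℕP.≤-reflexive (ℕP.+-comm 1 n)

suc-negative : ∀ n → ℤ.suc -[1+ n ] ≡ ℤ.- (+ n)
suc-negative zero    = refl
suc-negative (suc n) = refl

-- Shifting the window by one step adds F(n) and removes F(-n); both tend to 0.
HasSum-suc : ∀ {F s} → HasSum F s → HasSum (λ k → F (ℤ.suc k)) s
HasSum-suc {F} {s} p = hasSum
  (Lim-cong (λ n → R.sym (shifted n)) (solve 1 (λ s → s :+ (con 0ℤ :+ :- con 0ℤ) := s) R.refl s)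
    (Lim-⊕ (windows p) (Lim-⊕ (Vanishing-Lim (λ n → + n) (λ n → ℕP.≤-refl) (vanishing p))
      (Lim-⊝ (Vanishing-Lim (λ n → ℤ.- (+ n)) (λ n → ℕP.≤-reflexive (sym (ℤP.∣-i∣≡∣i∣ (+ n)))) (vanishing p))))))
  (Vanishing-∘ ℤ.suc 1 bound (vanishing p))
  where
  shifted : ∀ n → window (λ k → F (ℤ.suc k)) n ≈ window F n ⊕ (F (+ n) ⊕ ⊝ F (ℤ.- (+ n)))
  shifted zero = solve 1 (λ x → con 0ℤ := con 0ℤ :+ (x :+ :- x)) R.refl (F (+ 0))
  shifted (suc n) = R.trans (R.+-cong (shifted n) (R.+-congˡ (R.reflexive (cong F (suc-negative n)))))
    (solve 5 (λ w x y z v → w :+ (x :+ :- y) :+ (z :+ y) := w :+ (x :+ v) :+ (z :+ :- v)) R.refl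
      (window F n) (F (+ n)) (F (ℤ.- (+ n))) (F (+ suc n)) (F -[1+ n ]))
  bound : ∀ k → ∣ k ∣ ≤ ∣ ℤ.suc k ∣ + 1
  bound (+ n)          = ℕP.≤-trans (ℕP.n≤1+n n) (ℕP.m≤m+n (suc n) 1)
  bound -[1+ zero ]    = ℕP.≤-refl
  bound -[1+ suc n ]   = ℕP.≤-reflexive (ℕP.+-comm 1 (suc n))

HasSum-neg : ∀ {F s} → HasSum F s → HasSum (λ k → F (ℤ.- k)) s
HasSum-neg {F} p = HasSum-cong (λ k → R.reflexive (cong F (neg k))) R.refl (HasSum-reflect (HasSum-suc p))
  where
  neg : ∀ k → ℤ.suc (reflect k) ≡ ℤ.- k
  neg (+ n)    = suc-negative n
  neg -[1+ n ] = refl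

private
  HasSum-translate⁺ : ∀ {F s} n → HasSum F s → HasSum (λ k → F (+ n ℤ.+ k)) s
  HasSum-translate⁺ {F} zero p = HasSum-cong (λ k → R.reflexive (cong F (sym (ℤP.+-identityˡ k)))) R.refl p
  HasSum-translate⁺ {F} (suc n) p = HasSum-cong (λ k → R.reflexive (cong F (sym (ℤP.+-assoc 1ℤ (+ n) k)))) R.refl
    (HasSum-translate⁺ n (HasSum-suc p))

HasSum-translate : ∀ {F s} c → HasSum F s → HasSum (λ k → F (c ℤ.+ k)) s
HasSum-translate {F} (+ n) p = HasSum-translate⁺ n p
HasSum-translate {F} -[1+ n ] p = HasSum-cong (λ k → R.reflexive (cong F (conjugate k))) R.refl
  (HasSum-neg (HasSum-translate⁺ (suc n) (HasSum-neg p)))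
  where
  conjugate : ∀ k → ℤ.- (+ suc n ℤ.+ ℤ.- k) ≡ -[1+ n ] ℤ.+ k
  conjugate k = trans (ℤP.neg-distrib-+ (+ suc n) (ℤ.- k)) (cong (λ x → -[1+ n ] ℤ.+ x) (ℤP.neg-involutive k))

HasSum-pairs : ∀ {F s} → HasSum F s → HasSum (λ k → F (k ℤ.+ k) ⊕ F (1ℤ ℤ.+ (k ℤ.+ k))) s
HasSum-pairs {F} p = hasSum
  (Lim-cong pairs R.refl (Lim-subsequence (λ n → n + n) (λ n → ℕP.m≤m+n n n) (windows p)))
  (Vanishing-⊕ (Vanishing-∘ (λ k → k ℤ.+ k) 0 even (vanishing p))
    (Vanishing-∘ (λ k → 1ℤ ℤ.+ (k ℤ.+ k)) 0 odd (vanishing p)))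
  where
  pairs : ∀ n → window F (n + n) ≈ window (λ k → F (k ℤ.+ k) ⊕ F (1ℤ ℤ.+ (k ℤ.+ k))) n
  pairs zero = R.refl
  pairs (suc n) = R.trans (R.reflexive (cong (window F) (ℕP.+-suc (suc n) n)))
    (R.trans (R.+-congʳ (R.+-congʳ (pairs n)))
    (solve 5 (λ w x y z v → w :+ (x :+ y) :+ (z :+ v) := w :+ (x :+ z :+ (v :+ y))) R.refl
      _ (F (+ (n + n))) (F -[1+ n + n ]) (F (+ suc (n + n))) (F -[1+ suc (n + n) ])))
  even : ∀ k → ∣ k ∣ ≤ ∣ k ℤ.+ k ∣ + 0
  even (+ n)    = ℕP.≤-trans (ℕP.m≤m+n n n) (ℕP.≤-reflexive (sym (ℕP.+-identityʳ _)))
  even -[1+ n ] = s≤s (ℕP.≤-trans (ℕP.m≤n⇒m≤1+n (ℕP.m≤m+n n n)) (ℕP.≤-reflexive (sym (ℕP.+-identityʳ _))))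
  odd : ∀ k → ∣ k ∣ ≤ ∣ 1ℤ ℤ.+ (k ℤ.+ k) ∣ + 0
  odd (+ n)    = ℕP.≤-trans (ℕP.m≤n⇒m≤1+n (ℕP.m≤m+n n n)) (ℕP.≤-reflexive (sym (ℕP.+-identityʳ _)))
  odd -[1+ n ] = s≤s (ℕP.≤-trans (ℕP.m≤m+n n n) (ℕP.≤-reflexive (sym (ℕP.+-identityʳ _))))

Lim-triples : ∀ {F s} → Lim (window F) s →
  Lim (window (λ k → F (k ℤ.+ k ℤ.+ k) ⊕ F (1ℤ ℤ.+ (k ℤ.+ k ℤ.+ k)) ⊕ F (+ 2 ℤ.+ (k ℤ.+ k ℤ.+ k)))) s
Lim-triples {F} p = Lim-cong triples R.refl (Lim-subsequence (λ n → n + n + n) (λ n → ℕP.≤-trans (ℕP.m≤m+n n n) (ℕP.m≤m+n (n + n) n)) p)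
  where
  step : ∀ n → suc n + suc n + suc n ≡ suc (suc (suc (n + n + n)))
  step = ℕSolver.solve-∀
  triples : ∀ n → window F (n + n + n) ≈ window (λ k → F (k ℤ.+ k ℤ.+ k) ⊕ F (1ℤ ℤ.+ (k ℤ.+ k ℤ.+ k)) ⊕ F (+ 2 ℤ.+ (k ℤ.+ k ℤ.+ k))) n
  triples zero = R.refl
  triples (suc n) = R.trans (R.reflexive (cong (window F) (step n)))
    (R.trans (R.+-congʳ (R.+-congʳ (R.+-congʳ (triples n))))
    (solve 7 (λ w a b c x y z → w :+ (a :+ x) :+ (b :+ y) :+ (c :+ z) := w :+ (a :+ b :+ c :+ (z :+ y :+ x))) R.refl
      _ (F (+ (n + n + n))) (F (+ suc (n + n + n))) (F (+ suc (suc (n + n + n))))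
        (F -[1+ n + n + n ]) (F -[1+ suc (n + n + n) ]) (F -[1+ suc (suc (n + n + n)) ])))

-- Tannery's theorem. Modulo q^M the tails vanish beyond a bound B common to all n, so from B on a
-- window already equals the full sum, and the limit in n is taken inside a finite sum.
tannery : ∀ {F : ℕ → ℤ → Series} {U G s} →
  (∀ n → Lim (window (F n)) (U n)) → Lim U s → (∀ k → Lim (λ n → F n k) (G k)) →
  (∀ M → ∃ λ B → ∀ n k → B ≤ ∣ k ∣ → F n k ≈[ M ] null) → HasSum G s
tannery {F} {U} {G} {s} sums U→s F→G uniform = hasSum
  (lim λ M → let (B , h) = uniform M in B , λ N B≤N → limit-≈[] (windows→ N) U→s (λ n → stable M (h n) N B≤N (sums n)))
  (λ M → let (B , h) = uniform M in B , λ k b → limit-≈[] (F→G k) (Lim-const null) (λ n → h n k b))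
  where
  limit-≈[] : ∀ {s t S T M} → Lim s S → Lim t T → (∀ n → s n ≈[ M ] t n) → S ≈[ M ] T
  limit-≈[] {M = M} p q h = let (B , e) = eventually p M ; (B′ , e′) = eventually q M in
    ≈[]-trans (≈[]-sym (e (B ⊔ B′) (ℕP.m≤m⊔n B B′))) (≈[]-trans (h (B ⊔ B′)) (e′ (B ⊔ B′) (ℕP.m≤n⊔m B B′)))
  windows→ : ∀ N → Lim (λ n → window (F n) N) (window G N)
  windows→ zero    = Lim-const null
  windows→ (suc N) = Lim-⊕ (windows→ N) (Lim-⊕ (F→G (+ N)) (F→G -[1+ N ]))
  stable : ∀ {H S B} M → (∀ k → B ≤ ∣ k ∣ → H k ≈[ M ] null) → ∀ N → B ≤ N → Lim (window H) S → window H N ≈[ M ] S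
  stable {H} {S} {B} M h N B≤N p = let (B′ , e) = eventually p M in
    ≈[]-trans (≈[]-sym (extend B′)) (e (B′ + N) (ℕP.m≤m+n B′ N))
    where
    extend : ∀ j → window H (j + N) ≈[ M ] window H N
    extend zero    = ≈[]-refl
    extend (suc j) = ≈[]-trans (⊕-cong[] (extend j) (⊕-cong[]
        (h (+ (j + N)) (ℕP.≤-trans B≤N (ℕP.m≤n+m N j))) (h -[1+ j + N ] (ℕP.≤-trans B≤N (ℕP.m≤n⇒m≤1+n (ℕP.m≤n+m N j))))))
      (≈⇒≈[] (solve 1 (λ w → w :+ (con 0ℤ :+ con 0ℤ) := w) R.refl (window H N)))

-- Tannery's theorem applied to the rows cut off at N. Their sum over m is a finite sum of columns,
-- and the decay in m is uniform in N because it is uniform in the second index.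
fubini : ∀ {F : ℤ → ℤ → Series} {rows columns s} →
  (∀ m → Lim (window (F m)) (rows m)) → (∀ n → Lim (window (λ m → F m n)) (columns n)) → Lim (window columns) s →
  (∀ M → ∃ λ B → ∀ m n → B ≤ ∣ m ∣ → F m n ≈[ M ] null) → HasSum rows s
fubini {F} {rows} {columns} rowSums columnSums total uniform = tannery partial total rowSums λ M →
    let (B , h) = uniform M in B , λ N m b → windowNull N (λ n → h m n b)
  where
  partial : ∀ N → Lim (window (λ m → window (F m) N)) (window columns N)
  partial zero = Lim-cong (λ n → R.sym (zeros n)) R.refl (Lim-const null)
    where
    zeros : ∀ n → window (λ _ → null) n ≈ null
    zeros zero    = R.refl
    zeros (suc n) = R.trans (R.+-congʳ (zeros n)) (solve 0 (con 0ℤ :+ (con 0ℤ :+ con 0ℤ) := con 0ℤ) R.refl)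
  partial (suc N) = Lim-cong
    (λ n → R.sym (R.trans (window-⊕ _ _ n) (R.+-congˡ (window-⊕ _ _ n)))) R.refl
    (Lim-⊕ (partial N) (Lim-⊕ (columnSums (+ N)) (columnSums -[1+ N ])))
  windowNull : ∀ {H M} N → (∀ k → H k ≈[ M ] null) → window H N ≈[ M ] null
  windowNull zero    h = ≈[]-refl
  windowNull (suc N) h = ≈[]-trans (⊕-cong[] (windowNull N h) (⊕-cong[] (h (+ N)) (h -[1+ N ])))
    (≈⇒≈[] (solve 0 (con 0ℤ :+ (con 0ℤ :+ con 0ℤ) := con 0ℤ) R.refl))

-- Theta functions and Jacobi's triple product

term : ℤ → ℕ → Series
term c e = constant c ∗ mono e

term-∗ : ∀ c e c′ e′ → term c e ∗ term c′ e′ ≈ term (c ℤ.* c′) (e + e′)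
term-∗ c e c′ e′ = R.trans
  (solve 4 (λ a b x y → a :* x :* (b :* y) := a :* b :* (x :* y)) R.refl (constant c) (constant c′) (mono e) (mono e′))
  (R.*-cong (R.sym (constant-* c c′)) (R.sym (mono-+ e e′)))

term-cong : ∀ {c e c′ e′} → c ≡ c′ → e ≡ e′ → term c e ≈ term c′ e′
term-cong refl refl = R.refl

mono≈term : ∀ e → mono e ≈ term 1ℤ e
mono≈term e = R.sym (R.*-identityˡ (mono e))

triangular : ℕ → ℕ
triangular zero    = 0
triangular (suc n) = suc n + triangular n

-- tri k = k (k + 1) / 2
tri : ℤ → ℕ
tri (+ n)    = triangular n
tri -[1+ n ] = triangular n

2*triangular : ∀ n → 2 * triangular n ≡ n * suc n
2*triangular zero    = refl
2*triangular (suc n) = trans (ℕP.*-distribˡ-+ 2 (suc n) (triangular n)) (trans (cong (λ x → 2 * suc n + x) (2*triangular n)) (lemma n))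
  where
  lemma : ∀ n → 2 * suc n + n * suc n ≡ suc n * suc (suc n)
  lemma = ℕSolver.solve-∀

2*tri : ∀ k → + 2 ℤ.* + tri k ≡ k ℤ.* (1ℤ ℤ.+ k)
2*tri (+ n) = trans (sym (ℤP.pos-* 2 (triangular n))) (trans (cong +_ (2*triangular n)) (ℤP.pos-* n (suc n)))
2*tri -[1+ n ] = begin
  + 2 ℤ.* + triangular n                ≡⟨ 2*tri (+ n) ⟩
  + n ℤ.* + suc n                       ≡⟨ lemma (+ n) (+ suc n) ⟩
  ℤ.- (+ suc n) ℤ.* (ℤ.- (+ n))         ≡⟨ cong (λ x → -[1+ n ] ℤ.* x) (sym (suc-negative n)) ⟩
  -[1+ n ] ℤ.* (1ℤ ℤ.+ -[1+ n ])        ∎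
  where
  open ≡-Reasoning
  lemma : ∀ a b → a ℤ.* b ≡ (ℤ.- b) ℤ.* (ℤ.- a)
  lemma = ℤSolver.solve-∀

-- Since `tri (ℤ.- k)` is k(k-1)/2, both triangular numbers are natural for every integer k, and no
-- subtraction enters the exponents.
exponent : ℕ → ℕ → ℤ → ℕ
exponent i j k = i * tri k + j * tri (ℤ.- k)

pos-+* : ∀ a b c d → + (a * b + c * d) ≡ + a ℤ.* + b ℤ.+ + c ℤ.* + d
pos-+* a b c d = trans (ℤP.pos-+ (a * b) (c * d)) (cong₂ ℤ._+_ (ℤP.pos-* a b) (ℤP.pos-* c d))

2*exponent : ∀ i j k → + 2 ℤ.* + exponent i j k ≡ + i ℤ.* (k ℤ.* (1ℤ ℤ.+ k)) ℤ.+ + j ℤ.* (k ℤ.* (k ℤ.- 1ℤ))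
2*exponent i j k = begin
  + 2 ℤ.* + exponent i j k                                              ≡⟨ cong (λ x → + 2 ℤ.* x) (pos-+* i (tri k) j (tri (ℤ.- k))) ⟩
  + 2 ℤ.* (+ i ℤ.* + tri k ℤ.+ + j ℤ.* + tri (ℤ.- k))                   ≡⟨ lemma (+ i) (+ j) (+ tri k) (+ tri (ℤ.- k)) ⟩
  + i ℤ.* (+ 2 ℤ.* + tri k) ℤ.+ + j ℤ.* (+ 2 ℤ.* + tri (ℤ.- k))         ≡⟨ cong₂ (λ x y → + i ℤ.* x ℤ.+ + j ℤ.* y) (2*tri k) (2*tri (ℤ.- k)) ⟩
  + i ℤ.* (k ℤ.* (1ℤ ℤ.+ k)) ℤ.+ + j ℤ.* (ℤ.- k ℤ.* (1ℤ ℤ.+ ℤ.- k))    ≡⟨ negate (+ i) (+ j) k ⟩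
  + i ℤ.* (k ℤ.* (1ℤ ℤ.+ k)) ℤ.+ + j ℤ.* (k ℤ.* (k ℤ.- 1ℤ))             ∎
  where
  open ≡-Reasoning
  lemma : ∀ i j x y → + 2 ℤ.* (i ℤ.* x ℤ.+ j ℤ.* y) ≡ i ℤ.* (+ 2 ℤ.* x) ℤ.+ j ℤ.* (+ 2 ℤ.* y)
  lemma = ℤSolver.solve-∀
  negate : ∀ i j k → i ℤ.* (k ℤ.* (1ℤ ℤ.+ k)) ℤ.+ j ℤ.* (ℤ.- k ℤ.* (1ℤ ℤ.+ ℤ.- k)) ≡ i ℤ.* (k ℤ.* (1ℤ ℤ.+ k)) ℤ.+ j ℤ.* (k ℤ.* (k ℤ.- 1ℤ))
  negate = ℤSolver.solve-∀

-- Equalities between exponents are checked over ℤ after doubling.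
halve : ∀ x y {X Y} → + 2 ℤ.* + x ≡ X → + 2 ℤ.* + y ≡ Y → X ≡ Y → x ≡ y
halve x y p q r = ℤP.+-injective (ℤP.*-cancelˡ-≡ (+ 2) _ _ (trans p (trans r (sym q))))

2*-+ : ∀ x y {X Y} → + 2 ℤ.* + x ≡ X → + 2 ℤ.* + y ≡ Y → + 2 ℤ.* + (x + y) ≡ X ℤ.+ Y
2*-+ x y p q = trans (cong (λ z → + 2 ℤ.* z) (ℤP.pos-+ x y)) (trans (ℤP.*-distribˡ-+ (+ 2) (+ x) (+ y)) (cong₂ ℤ._+_ p q))

triangular≥ : ∀ n → n ≤ triangular n
triangular≥ zero    = z≤n
triangular≥ (suc n) = ℕP.m≤m+n (suc n) (triangular n)

-- The triangular number belonging to the sign of k is already at least |k|; hence theta series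
-- converge.
exponent≥ : ∀ i j .{{_ : NonZero i}} .{{_ : NonZero j}} k → ∣ k ∣ ≤ exponent i j k
exponent≥ i j (+ n) = ℕP.≤-trans (triangular≥ n) (ℕP.≤-trans (ℕP.m≤n*m (triangular n) i) (ℕP.m≤m+n (i * triangular n) _))
exponent≥ i j -[1+ n ] = ℕP.≤-trans (triangular≥ (suc n)) (ℕP.≤-trans (ℕP.m≤n*m (triangular (suc n)) j) (ℕP.m≤n+m (j * triangular (suc n)) (i * triangular n)))

-- The summand εᵏ q^(i k(k+1)/2 + j k(k-1)/2) of Ramanujan's f(a, b) for a = ε qⁱ and b = ε qʲ.
θTerm : ℤ → ℕ → ℕ → ℤ → Series
θTerm ε i j k = term (ε ℤ.^ ∣ k ∣) (exponent i j k)

θFactor : ℤ → ℕ → ℕ → ℕ → Series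
θFactor ε d i l = one ⊕ term ε (i + d * l)

-- The product side (-a; ab)(-b; ab)(ab; ab) of Jacobi's identity, where ab = q^(i+j) because ε² =
-- 1. With this as the definition, product formulas only need factors to be matched, and the series
-- expansion is the theorem `HasSum-θ`.
θ : ℤ → ℕ → ℕ → Series
θ ε i j = f (i + j) ∗ (∏∞ (θFactor ε (i + j) i) ∗ ∏∞ (θFactor ε (i + j) j))

HasProd-θFactor : ∀ ε d i .{{_ : NonZero d}} .{{_ : NonZero i}} → HasProd (θFactor ε d i) (∏∞ (θFactor ε d i))
HasProd-θFactor ε d i = HasProd-∏∞ λ l → ≈[]-trans
  (⊕-cong[] {one} ≈[]-refl (∗-cong[] {constant ε} ≈[]-refl
    (mono-small (ℕP.+-mono-≤ (ℕ.>-nonZero⁻¹ i) (ℕP.m≤n*m l d)))))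
  (≈⇒≈[] (solve 1 (λ c → con 1ℤ :+ c :* con 0ℤ := con 1ℤ) R.refl (constant ε)))

inv-cong[] : ∀ {a b M} → Unit a → Unit b → a ≈[ M ] b → inv a ≈[ M ] inv b
inv-cong[] {a} {b} a₀ b₀ p = ≈[]-trans (≈⇒≈[] (R.sym (left b₀))) (≈[]-trans
  (∗-cong[] {inv a} ≈[]-refl (∗-cong[] (≈[]-sym p) ≈[]-refl))
  (≈⇒≈[] (R.trans (solve 3 (λ x a y → x :* (a :* y) := y :* (a :* x)) R.refl (inv a) a (inv b)) (left a₀))))
  where
  left : ∀ {x y} → Unit x → y ∗ (x ∗ inv x) ≈ y
  left {x} {y} x₀ = R.trans (R.*-congˡ (inv-inverseʳ {x} x₀)) (R.*-identityʳ y)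

inv-unique : ∀ {a x} → Unit a → x ∗ a ≈ one → x ≈ inv a
inv-unique {a} {x} a₀ h = R.trans (∗-inv-unique {one} {a} {x} a₀ h) (R.*-identityˡ (inv a))

Lim-inv : ∀ {s L} → (∀ n → Unit (s n)) → Unit L → Lim s L → Lim (λ n → inv (s n)) (inv L)
Lim-inv s₀ L₀ p = lim λ M → let (B , h) = eventually p M in B , λ N b → inv-cong[] (s₀ N) L₀ (h N b)

Lim-offset : ∀ {s L} c → Lim (λ n → s (c + n)) L → Lim s L
Lim-offset {s} {L} c p = lim λ M → let (B , h) = eventually p M in c + B , λ N b →
  subst (λ i → s i ≈[ M ] L) (ℕP.m+[n∸m]≡n (ℕP.≤-trans (ℕP.m≤m+n c B) b))
    (h (N ∸ c) (ℕP.≤-trans (ℕP.≤-reflexive (sym (ℕP.m+n∸m≡n c B))) (ℕP.∸-monoˡ-≤ c b)))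

-- The finite form of Jacobi's triple product

private module Pochhammer (d : ℕ) .{{_ : NonZero d}} where

  P : ℕ → Series
  P = ∏ (λ l → 1- (d * suc l))

  factor-unit : ∀ l → Unit (1- (d * suc l))
  factor-unit l with d * suc l | ℕP.m*n≢0 d (suc l)
  ... | suc e | _ = Unit-1- e

  P-unit : ∀ n → Unit (P n)
  P-unit zero    = refl
  P-unit (suc n) = Unit-∗ {P n} {1- (d * suc n)} (P-unit n) (factor-unit n)

  -- 1 / (p;p)ₖ with p = qᵈ, which vanishes for k < 0
  g : ℤ → Series
  g (+ n)    = inv (P n)
  g -[1+ _ ] = null

  -- The value 0 at negative indices makes this hold without exception: at v = 0 the factor 1 - p⁰
  -- vanishes.
  g-pred : ∀ v → g (ℤ.pred (+ v)) ≈ 1- (d * v) ∗ g (+ v)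
  g-pred zero = R.sym (R.trans (R.*-congʳ (R.trans (R.+-congˡ (R.-‿cong (R.trans (R.reflexive (cong mono (ℕP.*-zeroʳ d))) mono-zero))) (R.-‿inverseʳ one)))
    (R.zeroˡ (g (+ 0))))
  g-pred (suc v) = R.sym (inv-unique (P-unit v) (begin
    w ∗ inv (P v ∗ w) ∗ P v        ≈⟨ solve 3 (λ w i p → w :* i :* p := p :* w :* i) R.refl w (inv (P v ∗ w)) (P v) ⟩
    P v ∗ w ∗ inv (P v ∗ w)        ≈⟨ inv-inverseʳ {P v ∗ w} (P-unit (suc v)) ⟩
    one                            ∎))
    where
    open ≈-Reasoning
    w : Series
    w = 1- (d * suc v)

  Lim-g : ∀ k → Lim (λ n → g (+ n ℤ.+ k)) (inv (f d))
  Lim-g (+ c) = Lim-subsequence (λ n → n + c) (λ n → ℕP.m≤m+n n c) (Lim-inv P-unit (Unit-f d) (HasProd-f d))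
  Lim-g -[1+ c ] = Lim-offset (suc c) (Lim-cong (λ n → R.reflexive (cong g (sym (cancel n)))) R.refl (Lim-g (+ 0)))
    where
    cancel : ∀ n → + (suc c + n) ℤ.+ -[1+ c ] ≡ + n ℤ.+ + 0
    cancel n = trans (cong (λ x → x ℤ.+ -[1+ c ]) (ℤP.pos-+ (suc c) n)) (lemma (+ suc c) (+ n))
      where
      lemma : ∀ a b → (a ℤ.+ b) ℤ.+ (ℤ.- a) ≡ b ℤ.+ + 0
      lemma = ℤSolver.solve-∀

  -- The recursion for Gaussian binomial coefficients [N + 1; x] = [N; x] + p^y [N; x - 1], x + y = N + 1.
  pascal : ∀ N x y T T′ Y → (∀ u v → x ≡ + u → y ≡ + v → (u + v ≡ suc N) × (Y ∗ T′ ≈ mono (d * v) ∗ T)) →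
    P N ∗ (g x ∗ g (ℤ.pred y)) ∗ T ⊕ Y ∗ (P N ∗ (g (ℤ.pred x) ∗ g y) ∗ T′) ≈ P (suc N) ∗ (g x ∗ g y) ∗ T
  pascal N -[1+ x ] y T T′ Y h = solve 7 (λ P P′ a b Y T T′ → P :* (con 0ℤ :* a) :* T :+ Y :* (P :* (con 0ℤ :* b) :* T′) := P′ :* (con 0ℤ :* b) :* T)
    R.refl (P N) (P (suc N)) (g (ℤ.pred y)) (g y) Y T T′
  pascal N (+ u) -[1+ y ] T T′ Y h = solve 7 (λ P P′ a b Y T T′ → P :* (a :* con 0ℤ) :* T :+ Y :* (P :* (b :* con 0ℤ) :* T′) := P′ :* (a :* con 0ℤ) :* T)
    R.refl (P N) (P (suc N)) (g (+ u)) (g (ℤ.pred (+ u))) Y T T′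
  pascal N (+ u) (+ v) T T′ Y h = begin
    P N ∗ (X ∗ g (ℤ.pred (+ v))) ∗ T ⊕ Y ∗ (P N ∗ (g (ℤ.pred (+ u)) ∗ Z) ∗ T′)
      ≈⟨ R.+-cong (R.*-congʳ (R.*-congˡ (R.*-congˡ (g-pred v)))) (R.*-congˡ (R.*-congʳ (R.*-congˡ (R.*-congʳ (g-pred u))))) ⟩
    P N ∗ (X ∗ (1- (d * v) ∗ Z)) ∗ T ⊕ Y ∗ (P N ∗ (1- (d * u) ∗ X ∗ Z) ∗ T′)
      ≈⟨ solve 8 (λ P X Z T T′ Y a b → P :* (X :* ((con 1ℤ :+ :- a) :* Z)) :* T :+ Y :* (P :* ((con 1ℤ :+ :- b) :* X :* Z) :* T′)
            := P :* (X :* Z) :* ((con 1ℤ :+ :- a) :* T :+ (con 1ℤ :+ :- b) :* (Y :* T′)))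
          R.refl (P N) X Z T T′ Y (mono (d * v)) (mono (d * u)) ⟩
    P N ∗ (X ∗ Z) ∗ (1- (d * v) ∗ T ⊕ 1- (d * u) ∗ (Y ∗ T′))
      ≈⟨ R.*-congˡ (R.+-congˡ (R.*-congˡ (proj₂ (h u v refl refl)))) ⟩
    P N ∗ (X ∗ Z) ∗ (1- (d * v) ∗ T ⊕ 1- (d * u) ∗ (mono (d * v) ∗ T))
      -- The Pascal rule itself: (1 - p^v) + p^v (1 - p^u) = 1 - p^(u+v).
      ≈⟨ solve 6 (λ P X Z T a b → P :* (X :* Z) :* ((con 1ℤ :+ :- a) :* T :+ (con 1ℤ :+ :- b) :* (a :* T)) := P :* (con 1ℤ :+ :- (b :* a)) :* (X :* Z) :* T)
          R.refl (P N) X Z T (mono (d * v)) (mono (d * u)) ⟩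
    P N ∗ (one ⊕ ⊝ (mono (d * u) ∗ mono (d * v))) ∗ (X ∗ Z) ∗ T
      ≈⟨ R.*-congʳ (R.*-congʳ (R.*-congˡ (R.+-congˡ (R.-‿cong (R.trans (R.sym (mono-+ (d * u) (d * v)))
           (R.reflexive (cong mono (trans (sym (ℕP.*-distribˡ-+ d u v)) (cong (λ x → d * x) (proj₁ (h u v refl refl))))))))))) ⟩
    P (suc N) ∗ (X ∗ Z) ∗ T ∎
    where
    open ≈-Reasoning
    X Z : Series
    X = g (+ u)
    Z = g (+ v)

module _ (ε : ℤ) (ε² : ε ℤ.* ε ≡ 1ℤ) (i j : ℕ) .{{_ : NonZero i}} .{{_ : NonZero j}} where

  -- As ε² = 1, ε^|k| is ε^k, and a step in k multiplies it by ε on the negative side too.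
  sign-suc : ∀ k → ε ℤ.^ ∣ ℤ.suc k ∣ ≡ ε ℤ.* ε ℤ.^ ∣ k ∣
  sign-suc (+ n)        = refl
  sign-suc -[1+ zero ]  = sym (trans (cong (λ x → ε ℤ.* x) (ℤP.*-identityʳ ε)) ε²)
  sign-suc -[1+ suc n ] = sym (trans (sym (ℤP.*-assoc ε ε _)) (trans (cong (λ x → x ℤ.* ε ℤ.^ suc n) ε²) (ℤP.*-identityˡ _)))

  sign-pred : ∀ k → ε ℤ.* ε ℤ.^ ∣ ℤ.pred k ∣ ≡ ε ℤ.^ ∣ k ∣
  sign-pred k = trans (sym (sign-suc (ℤ.pred k))) (cong (λ x → ε ℤ.^ ∣ x ∣) (ℤP.suc-pred k))

  private
    d : ℕ
    d = i + j

    instance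
      d≢0 : NonZero d
      d≢0 = ℕ.>-nonZero (ℕP.≤-trans (ℕ.>-nonZero⁻¹ i) (ℕP.m≤m+n i j))

    open Pochhammer d

    t : ℤ → Series
    t = θTerm ε i j

    t-small : ∀ M k → M ≤ ∣ k ∣ → t k ≈[ M ] null
    t-small M k h = ≈[]-trans (∗-cong[] {constant (ε ℤ.^ ∣ k ∣)} ≈[]-refl (mono-small (ℕP.≤-trans h (exponent≥ i j k))))
      (≈⇒≈[] (R.zeroʳ _))

    2*linear : ∀ a m → + 2 ℤ.* + (a + d * m) ≡ + 2 ℤ.* (+ a ℤ.+ (+ i ℤ.+ + j) ℤ.* + m)
    2*linear a m = cong (λ x → + 2 ℤ.* x) (trans (ℤP.pos-+ a (d * m)) (cong (λ x → + a ℤ.+ x) (trans (ℤP.pos-* d m) (cong (λ x → x ℤ.* + m) (ℤP.pos-+ i j)))))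

    -- With e for the exponent, e(k) - e(k-1) = ik + j(k-1) = dk - j, so i + dm + e(k-1) = d(m+1-k)
    -- + e(k). This is the relation between consecutive terms that `pascal` asks for.
    t-pred : ∀ m k v → + suc m ℤ.- k ≡ + v → term ε (i + d * m) ∗ t (ℤ.pred k) ≈ mono (d * v) ∗ t k
    t-pred m k v h = begin
      term ε (i + d * m) ∗ t (ℤ.pred k)                             ≈⟨ term-∗ ε (i + d * m) _ (exponent i j (ℤ.pred k)) ⟩
      term (ε ℤ.* ε ℤ.^ ∣ ℤ.pred k ∣) (i + d * m + exponent i j (ℤ.pred k))
                                                                    ≈⟨ term-cong (trans (sign-pred k) (sym (ℤP.*-identityˡ _))) exponents ⟩
      term (1ℤ ℤ.* ε ℤ.^ ∣ k ∣) (d * v + exponent i j k)            ≈⟨ term-∗ 1ℤ (d * v) (ε ℤ.^ ∣ k ∣) (exponent i j k) ⟨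
      term 1ℤ (d * v) ∗ t k                                         ≈⟨ R.*-congʳ (mono≈term (d * v)) ⟨
      mono (d * v) ∗ t k                                            ∎
      where
      open ≈-Reasoning
      lemma : ∀ I J m k → + 2 ℤ.* (I ℤ.+ (I ℤ.+ J) ℤ.* m) ℤ.+ (I ℤ.* ((-[1+ 0 ] ℤ.+ k) ℤ.* (1ℤ ℤ.+ (-[1+ 0 ] ℤ.+ k))) ℤ.+ J ℤ.* ((-[1+ 0 ] ℤ.+ k) ℤ.* (-[1+ 0 ] ℤ.+ k ℤ.- 1ℤ)))
        ≡ + 2 ℤ.* (0ℤ ℤ.+ (I ℤ.+ J) ℤ.* (1ℤ ℤ.+ m ℤ.- k)) ℤ.+ (I ℤ.* (k ℤ.* (1ℤ ℤ.+ k)) ℤ.+ J ℤ.* (k ℤ.* (k ℤ.- 1ℤ)))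
      lemma = ℤSolver.solve-∀
      exponents : i + d * m + exponent i j (ℤ.pred k) ≡ d * v + exponent i j k
      exponents = halve (i + d * m + exponent i j (ℤ.pred k)) (d * v + exponent i j k) (2*-+ (i + d * m) (exponent i j (ℤ.pred k)) (2*linear i m) (2*exponent i j (ℤ.pred k)))
        (2*-+ (d * v) (exponent i j k) (trans (2*linear 0 v) (cong (λ x → + 2 ℤ.* (0ℤ ℤ.+ (+ i ℤ.+ + j) ℤ.* x)) (sym h))) (2*exponent i j k))
        (lemma (+ i) (+ j) (+ m) k)

    t-suc : ∀ n k u → + suc n ℤ.+ k ≡ + u → term ε (j + d * n) ∗ t (ℤ.suc k) ≈ mono (d * u) ∗ t k
    t-suc n k u h = begin
      term ε (j + d * n) ∗ t (ℤ.suc k)                              ≈⟨ term-∗ ε (j + d * n) _ (exponent i j (ℤ.suc k)) ⟩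
      term (ε ℤ.* ε ℤ.^ ∣ ℤ.suc k ∣) (j + d * n + exponent i j (ℤ.suc k))
                                                                    ≈⟨ term-cong signs exponents ⟩
      term (1ℤ ℤ.* ε ℤ.^ ∣ k ∣) (d * u + exponent i j k)            ≈⟨ term-∗ 1ℤ (d * u) (ε ℤ.^ ∣ k ∣) (exponent i j k) ⟨
      term 1ℤ (d * u) ∗ t k                                         ≈⟨ R.*-congʳ (mono≈term (d * u)) ⟨
      mono (d * u) ∗ t k                                            ∎
      where
      open ≈-Reasoning
      signs : ε ℤ.* ε ℤ.^ ∣ ℤ.suc k ∣ ≡ 1ℤ ℤ.* ε ℤ.^ ∣ k ∣
      signs = trans (cong (λ x → ε ℤ.* x) (sign-suc k)) (trans (sym (ℤP.*-assoc ε ε _)) (cong (λ x → x ℤ.* ε ℤ.^ ∣ k ∣) ε²))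
      lemma : ∀ I J n k → + 2 ℤ.* (J ℤ.+ (I ℤ.+ J) ℤ.* n) ℤ.+ (I ℤ.* ((1ℤ ℤ.+ k) ℤ.* (1ℤ ℤ.+ (1ℤ ℤ.+ k))) ℤ.+ J ℤ.* ((1ℤ ℤ.+ k) ℤ.* (1ℤ ℤ.+ k ℤ.- 1ℤ)))
        ≡ + 2 ℤ.* (0ℤ ℤ.+ (I ℤ.+ J) ℤ.* (1ℤ ℤ.+ n ℤ.+ k)) ℤ.+ (I ℤ.* (k ℤ.* (1ℤ ℤ.+ k)) ℤ.+ J ℤ.* (k ℤ.* (k ℤ.- 1ℤ)))
      lemma = ℤSolver.solve-∀
      exponents : j + d * n + exponent i j (ℤ.suc k) ≡ d * u + exponent i j k
      exponents = halve (j + d * n + exponent i j (ℤ.suc k)) (d * u + exponent i j k) (2*-+ (j + d * n) (exponent i j (ℤ.suc k)) (2*linear j n) (2*exponent i j (ℤ.suc k)))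
        (2*-+ (d * u) (exponent i j k) (trans (2*linear 0 u) (cong (λ x → + 2 ℤ.* (0ℤ ℤ.+ (+ i ℤ.+ + j) ℤ.* x)) (sym h))) (2*exponent i j k))
        (lemma (+ i) (+ j) (+ n) k)

    -- The summand [m + n; n + k] t(k) of the finite triple product, with Gaussian binomials in p =
    -- q^d. The two numbers of factors are independent so that one factor can be added at a time.
    F : ℕ → ℕ → ℤ → Series
    F m n k = P (m + n) ∗ (g (+ n ℤ.+ k) ∗ g (+ m ℤ.- k)) ∗ t k

    U : ℕ → ℕ → Series
    U m n = ∏ (θFactor ε d i) m ∗ ∏ (θFactor ε d j) n

    base : HasSum (F 0 0) (U 0 0)
    base = hasSum (Lim-cong (λ _ → R.refl) (R.sym (R.*-identityˡ one)) (lim λ M → 1 , λ { (suc n) _ → ≈⇒≈[] (windows≈ n) }))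
      λ M → 1 , λ { (+ suc n) _ → ≈⇒≈[] (positive n) ; -[1+ n ] _ → ≈⇒≈[] (negative n) }
      where
      positive : ∀ n → F 0 0 (+ suc n) ≈ null
      positive n = solve 3 (λ p x t → p :* (x :* con 0ℤ) :* t := con 0ℤ) R.refl (P 0) (g (+ suc n)) (t (+ suc n))
      negative : ∀ n → F 0 0 -[1+ n ] ≈ null
      negative n = solve 3 (λ p x t → p :* (con 0ℤ :* x) :* t := con 0ℤ) R.refl (P 0) (g (+ 0 ℤ.- -[1+ n ])) (t -[1+ n ])
      central : F 0 0 (+ 0) ≈ one
      central = R.trans (R.*-cong (R.*-congˡ (R.*-cong inv-one inv-one)) (R.*-congˡ (R.trans (R.reflexive (cong mono (cong₂ _+_ (ℕP.*-zeroʳ i) (ℕP.*-zeroʳ j)))) mono-zero)))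
        (solve 0 (con 1ℤ :* (con 1ℤ :* con 1ℤ) :* (con 1ℤ :* con 1ℤ) := con 1ℤ) R.refl)
        where
        inv-one : inv one ≈ one
        inv-one = R.sym (inv-unique refl (R.*-identityˡ one))
      windows≈ : ∀ n → window (F 0 0) (suc n) ≈ one
      windows≈ zero = R.trans (R.+-congˡ (R.+-cong central (negative 0))) (solve 0 (con 0ℤ :+ (con 1ℤ :+ con 0ℤ) := con 1ℤ) R.refl)
      windows≈ (suc n) = R.trans (R.+-cong (windows≈ n) (R.+-cong (positive n) (negative (suc n)))) (solve 0 (con 1ℤ :+ (con 0ℤ :+ con 0ℤ) := con 1ℤ) R.refl)

    -- Multiplying by the new factor 1 + y adds y times the same sum, reindexed by k - 1, and
    -- `pascal` combines the coefficients. For the other family of factors the shift is to k + 1 and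
    -- the two denominators change roles.
    step₁ : ∀ m n → HasSum (F m n) (U m n) → HasSum (F (suc m) n) (U (suc m) n)
    step₁ m n p = HasSum-cong recursion
      (solve 3 (λ x y z → x :* y :+ z :* (x :* y) := x :* (con 1ℤ :+ z) :* y) R.refl (∏ (θFactor ε d i) m) (∏ (θFactor ε d j) n) y)
      (HasSum-⊕ p (HasSum-∗ y (HasSum-translate -[1+ 0 ] p)))
      where
      open ≈-Reasoning
      y : Series
      y = term ε (i + d * m)
      e₁ : ∀ m k → m ℤ.- k ≡ -[1+ 0 ] ℤ.+ (1ℤ ℤ.+ m ℤ.- k)
      e₁ = ℤSolver.solve-∀
      e₂ : ∀ n k → n ℤ.+ (-[1+ 0 ] ℤ.+ k) ≡ -[1+ 0 ] ℤ.+ (n ℤ.+ k)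
      e₂ = ℤSolver.solve-∀
      e₃ : ∀ m k → m ℤ.- (-[1+ 0 ] ℤ.+ k) ≡ 1ℤ ℤ.+ m ℤ.- k
      e₃ = ℤSolver.solve-∀
      e₄ : ∀ m n k → (n ℤ.+ k) ℤ.+ (1ℤ ℤ.+ m ℤ.- k) ≡ 1ℤ ℤ.+ (m ℤ.+ n)
      e₄ = ℤSolver.solve-∀
      recursion : ∀ k → F m n k ⊕ y ∗ F m n (-[1+ 0 ] ℤ.+ k) ≈ F (suc m) n k
      recursion k = begin
        F m n k ⊕ y ∗ F m n (ℤ.pred k)
          ≈⟨ R.+-cong (R.*-congʳ (R.*-congˡ (R.*-congˡ (R.reflexive (cong g (e₁ (+ m) k))))))
               (R.*-congˡ (R.*-congʳ (R.*-congˡ (R.*-cong (R.reflexive (cong g (e₂ (+ n) k))) (R.reflexive (cong g (e₃ (+ m) k))))))) ⟩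
        P (m + n) ∗ (g (+ n ℤ.+ k) ∗ g (ℤ.pred (+ suc m ℤ.- k))) ∗ t k
          ⊕ y ∗ (P (m + n) ∗ (g (ℤ.pred (+ n ℤ.+ k)) ∗ g (+ suc m ℤ.- k)) ∗ t (ℤ.pred k))
          ≈⟨ pascal (m + n) (+ n ℤ.+ k) (+ suc m ℤ.- k) (t k) (t (ℤ.pred k)) y (λ u v p q →
               ℤP.+-injective (trans (ℤP.pos-+ u v) (trans (sym (cong₂ ℤ._+_ p q)) (trans (e₄ (+ m) (+ n) k) (cong (λ x → 1ℤ ℤ.+ x) (sym (ℤP.pos-+ m n)))))) , t-pred m k v q) ⟩
        F (suc m) n k ∎

    step₂ : ∀ m n → HasSum (F m n) (U m n) → HasSum (F m (suc n)) (U m (suc n))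
    step₂ m n p = HasSum-cong recursion
      (solve 3 (λ x y z → x :* y :+ z :* (x :* y) := x :* (y :* (con 1ℤ :+ z))) R.refl (∏ (θFactor ε d i) m) (∏ (θFactor ε d j) n) y)
      (HasSum-⊕ p (HasSum-∗ y (HasSum-translate 1ℤ p)))
      where
      open ≈-Reasoning
      y : Series
      y = term ε (j + d * n)
      e₁ : ∀ n k → n ℤ.+ k ≡ -[1+ 0 ] ℤ.+ (1ℤ ℤ.+ n ℤ.+ k)
      e₁ = ℤSolver.solve-∀
      e₂ : ∀ n k → n ℤ.+ (1ℤ ℤ.+ k) ≡ 1ℤ ℤ.+ n ℤ.+ k
      e₂ = ℤSolver.solve-∀
      e₃ : ∀ m k → m ℤ.- (1ℤ ℤ.+ k) ≡ -[1+ 0 ] ℤ.+ (m ℤ.- k)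
      e₃ = ℤSolver.solve-∀
      e₄ : ∀ m n k → (m ℤ.- k) ℤ.+ (1ℤ ℤ.+ n ℤ.+ k) ≡ 1ℤ ℤ.+ (m ℤ.+ n)
      e₄ = ℤSolver.solve-∀
      recursion : ∀ k → F m n k ⊕ y ∗ F m n (1ℤ ℤ.+ k) ≈ F m (suc n) k
      recursion k = begin
        F m n k ⊕ y ∗ F m n (ℤ.suc k)
          ≈⟨ R.+-cong (R.*-congʳ (R.*-congˡ (R.trans (R.*-congʳ (R.reflexive (cong g (e₁ (+ n) k)))) (R.*-comm (g (ℤ.pred (+ suc n ℤ.+ k))) (g (+ m ℤ.- k))))))
               (R.*-congˡ (R.*-congʳ (R.*-congˡ (R.trans (R.*-cong (R.reflexive (cong g (e₂ (+ n) k))) (R.reflexive (cong g (e₃ (+ m) k)))) (R.*-comm (g (+ suc n ℤ.+ k)) (g (ℤ.pred (+ m ℤ.- k)))))))) ⟩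
        P (m + n) ∗ (g (+ m ℤ.- k) ∗ g (ℤ.pred (+ suc n ℤ.+ k))) ∗ t k
          ⊕ y ∗ (P (m + n) ∗ (g (ℤ.pred (+ m ℤ.- k)) ∗ g (+ suc n ℤ.+ k)) ∗ t (ℤ.suc k))
          ≈⟨ pascal (m + n) (+ m ℤ.- k) (+ suc n ℤ.+ k) (t k) (t (ℤ.suc k)) y (λ u v p q →
               ℤP.+-injective (trans (ℤP.pos-+ u v) (trans (sym (cong₂ ℤ._+_ p q)) (trans (e₄ (+ m) (+ n) k) (cong (λ x → 1ℤ ℤ.+ x) (sym (ℤP.pos-+ m n)))))) , t-suc n k v q) ⟩
        P (suc (m + n)) ∗ (g (+ m ℤ.- k) ∗ g (+ suc n ℤ.+ k)) ∗ t k
          ≈⟨ R.*-congʳ (R.*-cong (R.reflexive (cong P (sym (ℕP.+-suc m n)))) (R.*-comm (g (+ m ℤ.- k)) (g (+ suc n ℤ.+ k)))) ⟩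
        F m (suc n) k ∎

    finite : ∀ n → HasSum (F n n) (U n n)
    finite zero    = base
    finite (suc n) = step₁ n (suc n) (step₂ n n (finite n))

  -- Let m = n grow in the finite form. Every binomial tends to 1 / f_d, and the factor t(k) makes
  -- the terms small uniformly in n, as Tannery's theorem requires.
  HasSum-θ : HasSum (θTerm ε i j) (θ ε i j)
  HasSum-θ = HasSum-cong normalise R.refl (HasSum-∗ (f d) (tannery (λ n → windows (finite n))
      (Lim-∗ (HasProd-θFactor ε d i) (HasProd-θFactor ε d j))
      (λ k → Lim-∗ (Lim-∗ (Lim-subsequence (λ n → n + n) (λ n → ℕP.m≤m+n n n) (HasProd-f d)) (Lim-∗ (Lim-g k) (Lim-g (ℤ.- k)))) (Lim-const (t k)))
      (λ M → M , λ n k h → ≈[]-trans (∗-cong[] {P (n + n) ∗ (g (+ n ℤ.+ k) ∗ g (+ n ℤ.- k))} ≈[]-refl (t-small M k h)) (≈⇒≈[] (R.zeroʳ _)))))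
    where
    normalise : ∀ k → f d ∗ (f d ∗ (inv (f d) ∗ inv (f d)) ∗ t k) ≈ t k
    normalise k = R.trans (solve 3 (λ a b t → a :* (a :* (b :* b) :* t) := a :* b :* (a :* b) :* t) R.refl (f d) (inv (f d)) (t k))
      (R.trans (R.*-congʳ (R.*-cong (inv-inverseʳ {f d} (Unit-f d)) (inv-inverseʳ {f d} (Unit-f d))))
      (solve 1 (λ t → con 1ℤ :* con 1ℤ :* t := t) R.refl (t k)))

  HasProd-θ : HasProd (λ l → 1- (d * suc l) ∗ (θFactor ε d i l ∗ θFactor ε d j l)) (θ ε i j)
  HasProd-θ = HasProd-∗ (HasProd-f d) (HasProd-∗ (HasProd-θFactor ε d i) (HasProd-θFactor ε d j))

-- Dissections of theta functions

module _ (ε : ℤ) (ε² : ε ℤ.* ε ≡ 1ℤ) where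

  private
    s : ℤ → ℤ
    s k = ε ℤ.^ ∣ k ∣

  sign-neg : ∀ k → s (ℤ.- k) ≡ s k
  sign-neg k = cong (λ n → ε ℤ.^ n) (ℤP.∣-i∣≡∣i∣ k)

  private
    sign-+⁺ : ∀ n k → s (+ n ℤ.+ k) ≡ s (+ n) ℤ.* s k
    sign-+⁺ zero    k = trans (cong s (ℤP.+-identityˡ k)) (sym (ℤP.*-identityˡ (s k)))
    sign-+⁺ (suc n) k = trans (cong s (ℤP.+-assoc 1ℤ (+ n) k)) (trans (sign-suc ε ε² 1 1 (+ n ℤ.+ k))
      (trans (cong (λ x → ε ℤ.* x) (sign-+⁺ n k)) (sym (ℤP.*-assoc ε (s (+ n)) (s k)))))

  sign-+ : ∀ j k → s (j ℤ.+ k) ≡ s j ℤ.* s k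
  sign-+ (+ n)    k = sign-+⁺ n k
  sign-+ -[1+ n ] k = begin
    s (-[1+ n ] ℤ.+ k)                  ≡⟨ sym (sign-neg (-[1+ n ] ℤ.+ k)) ⟩
    s (ℤ.- (-[1+ n ] ℤ.+ k))            ≡⟨ cong s (ℤP.neg-distrib-+ -[1+ n ] k) ⟩
    s (+ suc n ℤ.+ ℤ.- k)               ≡⟨ sign-+⁺ (suc n) (ℤ.- k) ⟩
    s (+ suc n) ℤ.* s (ℤ.- k)           ≡⟨ cong (λ x → s (+ suc n) ℤ.* x) (sign-neg k) ⟩
    s -[1+ n ] ℤ.* s k                  ∎
    where open ≡-Reasoning

  sign-square : ∀ k → s k ℤ.* s k ≡ 1ℤ
  sign-square k = go ∣ k ∣
    where
    swap : ∀ a b c d → a ℤ.* b ℤ.* (c ℤ.* d) ≡ a ℤ.* c ℤ.* (b ℤ.* d)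
    swap = ℤSolver.solve-∀
    go : ∀ n → ε ℤ.^ n ℤ.* ε ℤ.^ n ≡ 1ℤ
    go zero    = refl
    go (suc n) = trans (swap ε (ε ℤ.^ n) ε (ε ℤ.^ n)) (cong₂ ℤ._*_ ε² (go n))

  sign-triple : ∀ k → s (k ℤ.+ k ℤ.+ k) ≡ s k
  sign-triple k = trans (sign-+ (k ℤ.+ k) k) (trans (cong (λ x → x ℤ.* s k) (trans (sign-+ k k) (sign-square k))) (ℤP.*-identityˡ (s k)))

  -- On the three residue classes of the index modulo 3 its square is 9k², 1 + (9k² + 6k) and 1 +
  -- (9(k+1)² - 6(k+1)). The last form explains the shift by `HasSum-suc` in the third sum.
  θ-trisection : θ ε 1 1 ≈ θ ε 9 9 ⊕ term ε 1 ∗ θ ε 15 3 ⊕ term ε 1 ∗ θ ε 3 15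
  θ-trisection = Lim-unique (Lim-triples (windows (HasSum-θ ε ε² 1 1)))
    (windows (HasSum-cong (λ k → R.sym (R.+-cong (R.+-cong (residue₀ k) (residue₁ k)) (residue₂ k))) R.refl
      (HasSum-⊕ (HasSum-⊕ (HasSum-θ ε ε² 9 9) (HasSum-∗ (term ε 1) (HasSum-θ ε ε² 15 3)))
        (HasSum-∗ (term ε 1) (HasSum-suc (HasSum-θ ε ε² 3 15))))))
    where
    residue₀ : ∀ k → θTerm ε 1 1 (k ℤ.+ k ℤ.+ k) ≈ θTerm ε 9 9 k
    residue₀ k = term-cong (sign-triple k) (halve (exponent 1 1 (k ℤ.+ k ℤ.+ k)) (exponent 9 9 k) (2*exponent 1 1 (k ℤ.+ k ℤ.+ k)) (2*exponent 9 9 k) (lemma k))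
      where
      lemma : ∀ k → + 1 ℤ.* ((k ℤ.+ k ℤ.+ k) ℤ.* (1ℤ ℤ.+ (k ℤ.+ k ℤ.+ k))) ℤ.+ + 1 ℤ.* ((k ℤ.+ k ℤ.+ k) ℤ.* ((k ℤ.+ k ℤ.+ k) ℤ.- 1ℤ))
        ≡ + 9 ℤ.* (k ℤ.* (1ℤ ℤ.+ k)) ℤ.+ + 9 ℤ.* (k ℤ.* (k ℤ.- 1ℤ))
      lemma = ℤSolver.solve-∀
    residue₁ : ∀ k → θTerm ε 1 1 (1ℤ ℤ.+ (k ℤ.+ k ℤ.+ k)) ≈ term ε 1 ∗ θTerm ε 15 3 k
    residue₁ k = R.trans (term-cong
        (trans (sign-suc ε ε² 1 1 (k ℤ.+ k ℤ.+ k)) (cong (λ x → ε ℤ.* x) (sign-triple k)))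
        (halve (exponent 1 1 (1ℤ ℤ.+ (k ℤ.+ k ℤ.+ k))) (1 + exponent 15 3 k) (2*exponent 1 1 (1ℤ ℤ.+ (k ℤ.+ k ℤ.+ k))) (2*-+ 1 (exponent 15 3 k) refl (2*exponent 15 3 k)) (lemma k)))
      (R.sym (term-∗ ε 1 (s k) (exponent 15 3 k)))
      where
      lemma : ∀ k → + 1 ℤ.* ((1ℤ ℤ.+ (k ℤ.+ k ℤ.+ k)) ℤ.* (1ℤ ℤ.+ (1ℤ ℤ.+ (k ℤ.+ k ℤ.+ k)))) ℤ.+ + 1 ℤ.* ((1ℤ ℤ.+ (k ℤ.+ k ℤ.+ k)) ℤ.* ((1ℤ ℤ.+ (k ℤ.+ k ℤ.+ k)) ℤ.- 1ℤ))
        ≡ + 2 ℤ.+ (+ 15 ℤ.* (k ℤ.* (1ℤ ℤ.+ k)) ℤ.+ + 3 ℤ.* (k ℤ.* (k ℤ.- 1ℤ)))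
      lemma = ℤSolver.solve-∀
    residue₂ : ∀ k → θTerm ε 1 1 (+ 2 ℤ.+ (k ℤ.+ k ℤ.+ k)) ≈ term ε 1 ∗ θTerm ε 3 15 (ℤ.suc k)
    residue₂ k = R.trans (term-cong signs
        (halve (exponent 1 1 (+ 2 ℤ.+ (k ℤ.+ k ℤ.+ k))) (1 + exponent 3 15 (ℤ.suc k)) (2*exponent 1 1 (+ 2 ℤ.+ (k ℤ.+ k ℤ.+ k))) (2*-+ 1 (exponent 3 15 (ℤ.suc k)) refl (2*exponent 3 15 (ℤ.suc k))) (lemma k)))
      (R.sym (term-∗ ε 1 (s (ℤ.suc k)) (exponent 3 15 (ℤ.suc k))))
      where
      signs : s (+ 2 ℤ.+ (k ℤ.+ k ℤ.+ k)) ≡ ε ℤ.* s (ℤ.suc k)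
      signs = trans (cong s (ℤP.+-assoc 1ℤ 1ℤ (k ℤ.+ k ℤ.+ k))) (trans (sign-suc ε ε² 1 1 (ℤ.suc (k ℤ.+ k ℤ.+ k)))
        (cong (λ x → ε ℤ.* x) (trans (sign-suc ε ε² 1 1 (k ℤ.+ k ℤ.+ k)) (trans (cong (λ x → ε ℤ.* x) (sign-triple k)) (sym (sign-suc ε ε² 1 1 k))))))
      lemma : ∀ k → + 1 ℤ.* ((+ 2 ℤ.+ (k ℤ.+ k ℤ.+ k)) ℤ.* (1ℤ ℤ.+ (+ 2 ℤ.+ (k ℤ.+ k ℤ.+ k)))) ℤ.+ + 1 ℤ.* ((+ 2 ℤ.+ (k ℤ.+ k ℤ.+ k)) ℤ.* ((+ 2 ℤ.+ (k ℤ.+ k ℤ.+ k)) ℤ.- 1ℤ))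
        ≡ + 2 ℤ.+ (+ 3 ℤ.* ((1ℤ ℤ.+ k) ℤ.* (1ℤ ℤ.+ (1ℤ ℤ.+ k))) ℤ.+ + 15 ℤ.* ((1ℤ ℤ.+ k) ℤ.* ((1ℤ ℤ.+ k) ℤ.- 1ℤ)))
      lemma = ℤSolver.solve-∀

θ-swap : ∀ ε → θ ε 15 3 ≈ θ ε 3 15
θ-swap ε = R.*-congˡ (R.*-comm (∏∞ (θFactor ε 18 15)) (∏∞ (θFactor ε 18 3)))

-- In the double sum the indices m and n are replaced by α + β (+ 1) and α - β, according to the parity of m - n.
θ-product : θ 1ℤ 3 15 ∗ θ -1ℤ 9 9 ≈ θ -1ℤ 12 24 ∗ θ -1ℤ 12 24 ⊕ mono 3 ∗ (θ -1ℤ 30 6 ∗ θ -1ℤ 30 6)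
θ-product = HasSum-unique
  (HasSum-cong (λ m → R.*-comm b (A m)) (R.*-comm b a) (HasSum-∗ b (HasSum-θ 1ℤ refl 3 15)))
  (fubini (λ m → windows (rows m)) (λ β → windows (columns β)) (windows total) uniform)
  where
  A B C D : ℤ → Series
  A = θTerm 1ℤ 3 15
  B = θTerm -1ℤ 9 9
  C = θTerm -1ℤ 12 24
  D = θTerm -1ℤ 30 6
  a b c d : Series
  a = θ 1ℤ 3 15
  b = θ -1ℤ 9 9
  c = θ -1ℤ 12 24
  d = θ -1ℤ 30 6
  s : ℤ → ℤ
  s k = -1ℤ ℤ.^ ∣ k ∣
  s₁ : ∀ k → 1ℤ ℤ.^ ∣ k ∣ ≡ 1ℤ
  s₁ k = ℤP.^-zeroˡ ∣ k ∣
  -- For fixed m, the indices m - 2β and m - 2β - 1 run through all integers as β varies; for fixed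
  -- β, both summands split into theta terms in β and in a translate of m - β.
  F : ℤ → ℤ → Series
  F m β = A m ∗ (B (m ℤ.- (β ℤ.+ β)) ⊕ B (m ℤ.- (1ℤ ℤ.+ (β ℤ.+ β))))
  rows : ∀ m → HasSum (F m) (A m ∗ b)
  rows m = HasSum-∗ (A m) (HasSum-pairs (HasSum-cong (λ k → R.reflexive (cong B (lemma m k))) R.refl
    (HasSum-translate (ℤ.- m) (HasSum-neg (HasSum-θ -1ℤ refl 9 9)))))
    where
    lemma : ∀ m k → ℤ.- (ℤ.- m ℤ.+ k) ≡ m ℤ.- k
    lemma = ℤSolver.solve-∀
  -- With n the index of `B`, m = α + β and n = α - β turn 9m² - 6m + 9n² into (18α² - 6α) + (18β² -
  -- 6β), and (-1)^n into (-1)^α (-1)^β.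
  even : ∀ m β → C β ∗ C (ℤ.- β ℤ.+ m) ≈ A m ∗ B (m ℤ.- (β ℤ.+ β))
  even m β = begin
    C β ∗ C (ℤ.- β ℤ.+ m)
      ≈⟨ term-∗ (s β) (exponent 12 24 β) (s (ℤ.- β ℤ.+ m)) (exponent 12 24 (ℤ.- β ℤ.+ m)) ⟩
    term (s β ℤ.* s (ℤ.- β ℤ.+ m)) (exponent 12 24 β + exponent 12 24 (ℤ.- β ℤ.+ m))
      ≈⟨ term-cong signs (halve (exponent 12 24 β + exponent 12 24 (ℤ.- β ℤ.+ m)) (exponent 3 15 m + exponent 9 9 (m ℤ.- (β ℤ.+ β)))
           (2*-+ (exponent 12 24 β) (exponent 12 24 (ℤ.- β ℤ.+ m)) (2*exponent 12 24 β) (2*exponent 12 24 (ℤ.- β ℤ.+ m)))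
           (2*-+ (exponent 3 15 m) (exponent 9 9 (m ℤ.- (β ℤ.+ β))) (2*exponent 3 15 m) (2*exponent 9 9 (m ℤ.- (β ℤ.+ β)))) (lemma m β)) ⟩
    term (1ℤ ℤ.^ ∣ m ∣ ℤ.* s (m ℤ.- (β ℤ.+ β))) (exponent 3 15 m + exponent 9 9 (m ℤ.- (β ℤ.+ β)))
      ≈⟨ term-∗ (1ℤ ℤ.^ ∣ m ∣) (exponent 3 15 m) (s (m ℤ.- (β ℤ.+ β))) (exponent 9 9 (m ℤ.- (β ℤ.+ β))) ⟨
    A m ∗ B (m ℤ.- (β ℤ.+ β)) ∎
    where
    open ≈-Reasoning
    index : ∀ m β → β ℤ.+ (ℤ.- β ℤ.+ m) ≡ (β ℤ.+ β) ℤ.+ (m ℤ.- (β ℤ.+ β))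
    index = ℤSolver.solve-∀
    signs : s β ℤ.* s (ℤ.- β ℤ.+ m) ≡ 1ℤ ℤ.^ ∣ m ∣ ℤ.* s (m ℤ.- (β ℤ.+ β))
    signs = trans (sym (sign-+ -1ℤ refl β (ℤ.- β ℤ.+ m))) (trans (cong s (index m β)) (trans (sign-+ -1ℤ refl (β ℤ.+ β) (m ℤ.- (β ℤ.+ β)))
      (cong (λ x → x ℤ.* s (m ℤ.- (β ℤ.+ β))) (trans (trans (sign-+ -1ℤ refl β β) (sign-square -1ℤ refl β)) (sym (s₁ m))))))
    lemma : ∀ m β → (+ 12 ℤ.* (β ℤ.* (1ℤ ℤ.+ β)) ℤ.+ + 24 ℤ.* (β ℤ.* (β ℤ.- 1ℤ)))
        ℤ.+ (+ 12 ℤ.* ((ℤ.- β ℤ.+ m) ℤ.* (1ℤ ℤ.+ (ℤ.- β ℤ.+ m))) ℤ.+ + 24 ℤ.* ((ℤ.- β ℤ.+ m) ℤ.* ((ℤ.- β ℤ.+ m) ℤ.- 1ℤ)))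
      ≡ (+ 3 ℤ.* (m ℤ.* (1ℤ ℤ.+ m)) ℤ.+ + 15 ℤ.* (m ℤ.* (m ℤ.- 1ℤ)))
        ℤ.+ (+ 9 ℤ.* ((m ℤ.- (β ℤ.+ β)) ℤ.* (1ℤ ℤ.+ (m ℤ.- (β ℤ.+ β)))) ℤ.+ + 9 ℤ.* ((m ℤ.- (β ℤ.+ β)) ℤ.* ((m ℤ.- (β ℤ.+ β)) ℤ.- 1ℤ)))
    lemma = ℤSolver.solve-∀
  -- Here m = α + β + 1 and n = α - β give 3 + (18α² + 12α) + (18β² + 12β), which is the origin of
  -- the factor q³.
  odd : ∀ m β → mono 3 ∗ (D β ∗ D ((ℤ.- β ℤ.+ -1ℤ) ℤ.+ m)) ≈ A m ∗ B (m ℤ.- (1ℤ ℤ.+ (β ℤ.+ β)))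
  odd m β = begin
    mono 3 ∗ (D β ∗ D α)
      ≈⟨ R.*-cong (mono≈term 3) (term-∗ (s β) (exponent 30 6 β) (s α) (exponent 30 6 α)) ⟩
    term 1ℤ 3 ∗ term (s β ℤ.* s α) (exponent 30 6 β + exponent 30 6 α)
      ≈⟨ term-∗ 1ℤ 3 (s β ℤ.* s α) (exponent 30 6 β + exponent 30 6 α) ⟩
    term (1ℤ ℤ.* (s β ℤ.* s α)) (3 + (exponent 30 6 β + exponent 30 6 α))
      ≈⟨ term-cong signs (halve (3 + (exponent 30 6 β + exponent 30 6 α)) (exponent 3 15 m + exponent 9 9 n)
           (2*-+ 3 (exponent 30 6 β + exponent 30 6 α) refl (2*-+ (exponent 30 6 β) (exponent 30 6 α) (2*exponent 30 6 β) (2*exponent 30 6 α)))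
           (2*-+ (exponent 3 15 m) (exponent 9 9 n) (2*exponent 3 15 m) (2*exponent 9 9 n)) (lemma m β)) ⟩
    term (1ℤ ℤ.^ ∣ m ∣ ℤ.* s n) (exponent 3 15 m + exponent 9 9 n)
      ≈⟨ term-∗ (1ℤ ℤ.^ ∣ m ∣) (exponent 3 15 m) (s n) (exponent 9 9 n) ⟨
    A m ∗ B n ∎
    where
    open ≈-Reasoning
    α n : ℤ
    α = (ℤ.- β ℤ.+ -1ℤ) ℤ.+ m
    n = m ℤ.- (1ℤ ℤ.+ (β ℤ.+ β))
    index : ∀ m β → β ℤ.+ ((ℤ.- β ℤ.+ -1ℤ) ℤ.+ m) ≡ (β ℤ.+ β) ℤ.+ (m ℤ.- (1ℤ ℤ.+ (β ℤ.+ β)))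
    index = ℤSolver.solve-∀
    signs : 1ℤ ℤ.* (s β ℤ.* s α) ≡ 1ℤ ℤ.^ ∣ m ∣ ℤ.* s n
    signs = cong₂ ℤ._*_ (sym (s₁ m)) (trans (sym (sign-+ -1ℤ refl β α)) (trans (cong s (index m β)) (trans (sign-+ -1ℤ refl (β ℤ.+ β) n)
      (trans (cong (λ x → x ℤ.* s n) (trans (sign-+ -1ℤ refl β β) (sign-square -1ℤ refl β))) (ℤP.*-identityˡ (s n))))))
    lemma : ∀ m β → + 6 ℤ.+ ((+ 30 ℤ.* (β ℤ.* (1ℤ ℤ.+ β)) ℤ.+ + 6 ℤ.* (β ℤ.* (β ℤ.- 1ℤ)))
        ℤ.+ (+ 30 ℤ.* (((ℤ.- β ℤ.+ -[1+ 0 ]) ℤ.+ m) ℤ.* (1ℤ ℤ.+ ((ℤ.- β ℤ.+ -[1+ 0 ]) ℤ.+ m))) ℤ.+ + 6 ℤ.* (((ℤ.- β ℤ.+ -[1+ 0 ]) ℤ.+ m) ℤ.* (((ℤ.- β ℤ.+ -[1+ 0 ]) ℤ.+ m) ℤ.- 1ℤ))))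
      ≡ (+ 3 ℤ.* (m ℤ.* (1ℤ ℤ.+ m)) ℤ.+ + 15 ℤ.* (m ℤ.* (m ℤ.- 1ℤ)))
        ℤ.+ (+ 9 ℤ.* ((m ℤ.- (1ℤ ℤ.+ (β ℤ.+ β))) ℤ.* (1ℤ ℤ.+ (m ℤ.- (1ℤ ℤ.+ (β ℤ.+ β))))) ℤ.+ + 9 ℤ.* ((m ℤ.- (1ℤ ℤ.+ (β ℤ.+ β))) ℤ.* ((m ℤ.- (1ℤ ℤ.+ (β ℤ.+ β))) ℤ.- 1ℤ)))
    lemma = ℤSolver.solve-∀
  columns : ∀ β → HasSum (λ m → F m β) (C β ∗ c ⊕ mono 3 ∗ (D β ∗ d))
  columns β = HasSum-cong (λ m → R.trans (R.+-cong (even m β) (odd m β)) (R.sym (R.distribˡ (A m) _ _))) R.refl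
    (HasSum-⊕ (HasSum-∗ (C β) (HasSum-translate (ℤ.- β) (HasSum-θ -1ℤ refl 12 24)))
      (HasSum-∗ (mono 3) (HasSum-∗ (D β) (HasSum-translate (ℤ.- β ℤ.+ -1ℤ) (HasSum-θ -1ℤ refl 30 6)))))
  total : HasSum (λ β → C β ∗ c ⊕ mono 3 ∗ (D β ∗ d)) (c ∗ c ⊕ mono 3 ∗ (d ∗ d))
  total = HasSum-⊕ (HasSum-cong (λ β → R.*-comm c (C β)) R.refl (HasSum-∗ c (HasSum-θ -1ℤ refl 12 24)))
    (HasSum-∗ (mono 3) (HasSum-cong (λ β → R.*-comm d (D β)) R.refl (HasSum-∗ d (HasSum-θ -1ℤ refl 30 6))))
  uniform : ∀ M → ∃ λ B′ → ∀ m β → B′ ≤ ∣ m ∣ → F m β ≈[ M ] null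
  uniform M = let (B′ , h) = vanishing (HasSum-θ 1ℤ refl 3 15) M in
    B′ , λ m β b → ≈[]-trans (∗-cong[] {b = B (m ℤ.- (β ℤ.+ β)) ⊕ B (m ℤ.- (1ℤ ℤ.+ (β ℤ.+ β)))} (h m b) ≈[]-refl) (≈⇒≈[] (R.zeroˡ _))

-- Product formulas

θFactor₋ : ∀ d i l → θFactor -1ℤ d i l ≈ 1- (i + d * l)
θFactor₋ d i l = solve 1 (λ x → con 1ℤ :+ con -1ℤ :* x := con 1ℤ :+ :- x) R.refl (mono (i + d * l))

θFactor₊ : ∀ d i l → θFactor 1ℤ d i l ≈ one ⊕ mono (i + d * l)
θFactor₊ d i l = R.+-congˡ (R.*-identityˡ (mono (i + d * l)))

module _ (k : ℕ) .{{_ : NonZero k}} where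

  private instance
    2k≢0 : NonZero (k + k)
    2k≢0 = ℕ.>-nonZero (ℕP.≤-trans (ℕ.>-nonZero⁻¹ k) (ℕP.m≤m+n k k))

  -- Gauss's product for φ(-q^k). In the theta product the odd multiples of k occur twice and the
  -- even ones once; `f (k + k)` supplies the second copy.
  φ₋-product : θ -1ℤ k k ∗ f (k + k) ≈ f k ∗ f k
  φ₋-product = Lim-unique (HasProd-cong factor (HasProd-∗ (HasProd-θ -1ℤ refl k k) (HasProd-f (k + k))))
    (HasProd-∗ (HasProd-blocks 1 (HasProd-f k)) (HasProd-blocks 1 (HasProd-f k)))
    where
    e₀ : ∀ k l → k + (k + k) * l ≡ k * suc (0 + l * 2)
    e₀ = ℕSolver.solve-∀
    e₁ : ∀ k l → (k + k) * suc l ≡ k * suc (1 + l * 2)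
    e₁ = ℕSolver.solve-∀
    factor : ∀ l → 1- ((k + k) * suc l) ∗ (θFactor -1ℤ (k + k) k l ∗ θFactor -1ℤ (k + k) k l) ∗ 1- ((k + k) * suc l)
      ≈ ∏ (λ i → 1- (k * suc (i + l * 2))) 2 ∗ ∏ (λ i → 1- (k * suc (i + l * 2))) 2
    factor l = R.trans (R.*-cong (R.*-cong (1-cong (e₁ k l)) (R.*-cong a a)) (1-cong (e₁ k l)))
      (solve 2 (λ x y → y :* (x :* x) :* y := con 1ℤ :* x :* y :* (con 1ℤ :* x :* y)) R.refl (1- (k * suc (0 + l * 2))) (1- (k * suc (1 + l * 2))))
      where
      a : θFactor -1ℤ (k + k) k l ≈ 1- (k * suc (0 + l * 2))
      a = R.trans (θFactor₋ (k + k) k l) (1-cong (e₀ k l))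

  Unit-φ₋ : Unit (θ -1ℤ k k)
  Unit-φ₋ = trans (sym (trans (∗-zero (θ -1ℤ k k) (f (k + k))) (trans (cong (λ x → θ -1ℤ k k 0 ℤ.* x) (Unit-f (k + k))) (ℤP.*-identityʳ _))))
    (trans (at φ₋-product 0) (Unit-∗ {f k} {f k} (Unit-f k) (Unit-f k)))

module _ (k : ℕ) .{{_ : NonZero k}} where

  private instance
    2k≢0 : NonZero (k + k)
    2k≢0 = ℕ.>-nonZero (ℕP.≤-trans (ℕ.>-nonZero⁻¹ k) (ℕP.m≤m+n k k))
    4k≢0 : NonZero (k + k + (k + k))
    4k≢0 = ℕ.>-nonZero (ℕP.≤-trans (ℕ.>-nonZero⁻¹ (k + k)) (ℕP.m≤m+n (k + k) (k + k)))

  -- The factors pair up as (1 + x)(1 - x) = 1 - x². The remaining f_(2k)² is absorbed by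
  -- `φ₋-product` at the price of one f_(4k), which is cancelled.
  φ₊∗φ₋ : θ 1ℤ k k ∗ θ -1ℤ k k ≈ θ -1ℤ (k + k) (k + k) ∗ θ -1ℤ (k + k) (k + k)
  φ₊∗φ₋ = cancel (begin
    f 4k ∗ (θ 1ℤ k k ∗ θ -1ℤ k k)                ≈⟨ Lim-unique
      (HasProd-∗ (HasProd-f 4k) (HasProd-∗ (HasProd-θ 1ℤ refl k k) (HasProd-θ -1ℤ refl k k)))
      (HasProd-cong (λ l → R.sym (factor l)) (HasProd-∗ (HasProd-θ -1ℤ refl (k + k) (k + k)) (HasProd-∗ (HasProd-f (k + k)) (HasProd-f (k + k))))) ⟩
    φ ∗ (f (k + k) ∗ f (k + k))                  ≈⟨ R.*-congˡ (φ₋-product (k + k)) ⟨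
    φ ∗ (φ ∗ f 4k)                               ≈⟨ solve 2 (λ x y → x :* (x :* y) := y :* (x :* x)) R.refl φ (f 4k) ⟩
    f 4k ∗ (φ ∗ φ)                               ∎)
    where
    open ≈-Reasoning
    4k : ℕ
    4k = k + k + (k + k)
    φ : Series
    φ = θ -1ℤ (k + k) (k + k)
    cancel : f 4k ∗ (θ 1ℤ k k ∗ θ -1ℤ k k) ≈ f 4k ∗ (φ ∗ φ) → θ 1ℤ k k ∗ θ -1ℤ k k ≈ φ ∗ φ
    cancel = ∗-cancelˡ {f 4k} (θ 1ℤ k k ∗ θ -1ℤ k k) (φ ∗ φ) (Unit-f 4k)
    factor : ∀ l → 1- (4k * suc l) ∗ ((1- ((k + k) * suc l) ∗ (θFactor 1ℤ (k + k) k l ∗ θFactor 1ℤ (k + k) k l)) ∗ (1- ((k + k) * suc l) ∗ (θFactor -1ℤ (k + k) k l ∗ θFactor -1ℤ (k + k) k l)))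
      ≈ 1- (4k * suc l) ∗ (θFactor -1ℤ 4k (k + k) l ∗ θFactor -1ℤ 4k (k + k) l) ∗ (1- ((k + k) * suc l) ∗ 1- ((k + k) * suc l))
    factor l = begin
      z ∗ ((y ∗ (θFactor 1ℤ (k + k) k l ∗ θFactor 1ℤ (k + k) k l)) ∗ (y ∗ (θFactor -1ℤ (k + k) k l ∗ θFactor -1ℤ (k + k) k l)))
        ≈⟨ R.*-congˡ (R.*-cong (R.*-congˡ (R.*-cong (θFactor₊ (k + k) k l) (θFactor₊ (k + k) k l))) (R.*-congˡ (R.*-cong (θFactor₋ (k + k) k l) (θFactor₋ (k + k) k l)))) ⟩
      z ∗ ((y ∗ ((one ⊕ x) ∗ (one ⊕ x))) ∗ (y ∗ ((one ⊕ ⊝ x) ∗ (one ⊕ ⊝ x))))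
        ≈⟨ solve 3 (λ x y z → z :* ((y :* ((con 1ℤ :+ x) :* (con 1ℤ :+ x))) :* (y :* ((con 1ℤ :+ :- x) :* (con 1ℤ :+ :- x))))
             := z :* ((con 1ℤ :+ :- (x :* x)) :* (con 1ℤ :+ :- (x :* x))) :* (y :* y)) R.refl x y z ⟩
      z ∗ ((one ⊕ ⊝ (x ∗ x)) ∗ (one ⊕ ⊝ (x ∗ x))) ∗ (y ∗ y)
        ≈⟨ R.*-congʳ (R.*-congˡ (R.*-cong c c)) ⟨
      z ∗ (θFactor -1ℤ 4k (k + k) l ∗ θFactor -1ℤ 4k (k + k) l) ∗ (y ∗ y) ∎
      where
      x y z : Series
      x = mono (k + (k + k) * l)
      y = 1- ((k + k) * suc l)
      z = 1- (4k * suc l)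
      e : ∀ k l → k + k + (k + k + (k + k)) * l ≡ (k + (k + k) * l) + (k + (k + k) * l)
      e = ℕSolver.solve-∀
      c : θFactor -1ℤ 4k (k + k) l ≈ one ⊕ ⊝ (x ∗ x)
      c = R.trans (θFactor₋ 4k (k + k) l) (R.+-congˡ (R.-‿cong (R.trans (R.reflexive (cong mono (e k l))) (mono-+ (k + (k + k) * l) (k + (k + k) * l)))))

-- Modulo 6 the theta product carries the exponents 1, 5, 0, `f 2` carries 2, 4, 0 and `f 3` carries
-- 3, 0. Together these are all residues once and two further copies of 0.
θ-1-5 : θ -1ℤ 1 5 ∗ f 2 ∗ f 3 ≈ f 1 ∗ f 6 ∗ f 6
θ-1-5 = Lim-unique
  (HasProd-cong factor (HasProd-∗ (HasProd-∗ (HasProd-θ -1ℤ refl 1 5) (HasProd-blocks 2 (HasProd-f 2))) (HasProd-blocks 1 (HasProd-f 3))))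
  (HasProd-∗ (HasProd-∗ (HasProd-blocks 5 (HasProd-f 1)) (HasProd-f 6)) (HasProd-f 6))
  where
  g : ℕ → ℕ → Series
  g l i = 1- (1 * suc (i + l * 6))
  a₀ : ∀ l → 1 + 6 * l ≡ 1 * suc (0 + l * 6)
  a₀ = ℕSolver.solve-∀
  a₄ : ∀ l → 5 + 6 * l ≡ 1 * suc (4 + l * 6)
  a₄ = ℕSolver.solve-∀
  b₁ : ∀ l → 2 * suc (0 + l * 3) ≡ 1 * suc (1 + l * 6)
  b₁ = ℕSolver.solve-∀
  b₃ : ∀ l → 2 * suc (1 + l * 3) ≡ 1 * suc (3 + l * 6)
  b₃ = ℕSolver.solve-∀
  b₅ : ∀ l → 2 * suc (2 + l * 3) ≡ 6 * suc l
  b₅ = ℕSolver.solve-∀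
  c₂ : ∀ l → 3 * suc (0 + l * 2) ≡ 1 * suc (2 + l * 6)
  c₂ = ℕSolver.solve-∀
  c₅ : ∀ l → 3 * suc (1 + l * 2) ≡ 6 * suc l
  c₅ = ℕSolver.solve-∀
  d₅ : ∀ l → 6 * suc l ≡ 1 * suc (5 + l * 6)
  d₅ = ℕSolver.solve-∀
  factor : ∀ l → 1- (6 * suc l) ∗ (θFactor -1ℤ 6 1 l ∗ θFactor -1ℤ 6 5 l)
      ∗ ∏ (λ i → 1- (2 * suc (i + l * 3))) 3 ∗ ∏ (λ i → 1- (3 * suc (i + l * 2))) 2
    ≈ ∏ (g l) 6 ∗ 1- (6 * suc l) ∗ 1- (6 * suc l)
  factor l = R.trans
    (R.*-cong (R.*-cong (R.*-cong (1-cong (d₅ l)) (R.*-cong (R.trans (θFactor₋ 6 1 l) (1-cong (a₀ l))) (R.trans (θFactor₋ 6 5 l) (1-cong (a₄ l)))))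
        (R.*-cong (R.*-cong (R.*-congˡ (1-cong (b₁ l))) (1-cong (b₃ l))) (1-cong (b₅ l))))
      (R.*-cong (R.*-congˡ (1-cong (c₂ l))) (1-cong (c₅ l))))
    (solve 7 (λ x₀ x₁ x₂ x₃ x₄ x₅ y → x₅ :* (x₀ :* x₄) :* (con 1ℤ :* x₁ :* x₃ :* y) :* (con 1ℤ :* x₂ :* y)
        := con 1ℤ :* x₀ :* x₁ :* x₂ :* x₃ :* x₄ :* x₅ :* y :* y) R.refl
      (g l 0) (g l 1) (g l 2) (g l 3) (g l 4) (g l 5) (1- (6 * suc l)))

-- The classes 12, 24 and 0 modulo 36 make up all multiples of 12; this is the product in Euler's
-- pentagonal number theorem at q¹².
pentagonal : θ -1ℤ 12 24 ≈ f 12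
pentagonal = Lim-unique (HasProd-cong factor (HasProd-θ -1ℤ refl 12 24)) (HasProd-blocks 2 (HasProd-f 12))
  where
  e₀ : ∀ l → 12 + 36 * l ≡ 12 * suc (0 + l * 3)
  e₀ = ℕSolver.solve-∀
  e₁ : ∀ l → 24 + 36 * l ≡ 12 * suc (1 + l * 3)
  e₁ = ℕSolver.solve-∀
  e₂ : ∀ l → 36 * suc l ≡ 12 * suc (2 + l * 3)
  e₂ = ℕSolver.solve-∀
  factor : ∀ l → 1- (36 * suc l) ∗ (θFactor -1ℤ 36 12 l ∗ θFactor -1ℤ 36 24 l) ≈ ∏ (λ i → 1- (12 * suc (i + l * 3))) 3
  factor l = R.trans
    (R.*-cong (1-cong (e₂ l)) (R.*-cong (R.trans (θFactor₋ 36 12 l) (1-cong (e₀ l))) (R.trans (θFactor₋ 36 24 l) (1-cong (e₁ l)))))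
    (solve 3 (λ x y z → z :* (x :* y) := con 1ℤ :* x :* y :* z) R.refl (1- (12 * suc (0 + l * 3))) (1- (12 * suc (1 + l * 3))) (1- (12 * suc (2 + l * 3))))

dilate-f : ∀ k c .{{_ : NonZero k}} .{{_ : NonZero c}} → dilate k (f c) ≈ f (c * k)
dilate-f k c = Lim-unique (HasProd-cong (λ j → R.trans (dilate-1- k (c * suc j)) (1-cong (reorder c j k))) (HasProd-dilate k (HasProd-f c)))
  (HasProd-f (c * k) {{ℕP.m*n≢0 c k}})
  where
  reorder : ∀ c j k → c * suc j * k ≡ c * k * suc j
  reorder = ℕSolver.solve-∀

dilate-θ : ∀ k .{{_ : NonZero k}} i j .{{_ : NonZero i}} .{{_ : NonZero j}} → dilate k (θ -1ℤ i j) ≈ θ -1ℤ (i * k) (j * k)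
dilate-θ k i j = Lim-unique (HasProd-cong factor (HasProd-dilate k (HasProd-θ -1ℤ refl i j)))
  (HasProd-θ -1ℤ refl (i * k) (j * k) {{ℕP.m*n≢0 i k}} {{ℕP.m*n≢0 j k}})
  where
  e : ∀ a i j k l → (a + (i + j) * l) * k ≡ a * k + (i * k + j * k) * l
  e = ℕSolver.solve-∀
  e′ : ∀ i j k l → (i + j) * suc l * k ≡ (i * k + j * k) * suc l
  e′ = ℕSolver.solve-∀
  θFactor-dilate : ∀ a l → dilate k (θFactor -1ℤ (i + j) a l) ≈ θFactor -1ℤ (i * k + j * k) (a * k) l
  θFactor-dilate a l = R.trans (dilate-cong k (θFactor₋ (i + j) a l)) (R.trans (dilate-1- k (a + (i + j) * l))
    (R.trans (1-cong (e a i j k l)) (R.sym (θFactor₋ (i * k + j * k) (a * k) l))))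
  factor : ∀ l → dilate k (1- ((i + j) * suc l) ∗ (θFactor -1ℤ (i + j) i l ∗ θFactor -1ℤ (i + j) j l))
    ≈ 1- ((i * k + j * k) * suc l) ∗ (θFactor -1ℤ (i * k + j * k) (i * k) l ∗ θFactor -1ℤ (i * k + j * k) (j * k) l)
  factor l = R.trans (dilate-∗ k (1- ((i + j) * suc l)) (θFactor -1ℤ (i + j) i l ∗ θFactor -1ℤ (i + j) j l))
    (R.*-cong (R.trans (dilate-1- k ((i + j) * suc l)) (1-cong (e′ i j k l)))
      (R.trans (dilate-∗ k (θFactor -1ℤ (i + j) i l) (θFactor -1ℤ (i + j) j l)) (R.*-cong (θFactor-dilate i l) (θFactor-dilate j l))))

-- The generating function

infixr 8 _^∗_
infixr 9 _:^∗_
-- Powers built on the opaque product. The solver expression `_:^∗_` evaluates to them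
-- definitionally, so exponents can be written inside solver goals.
_^∗_ : Series → ℕ → Series
a ^∗ zero  = one
a ^∗ suc n = a ∗ (a ^∗ n)

_:^∗_ : ∀ {m} → Polynomial m → ℕ → Polynomial m
x :^∗ zero  = con 1ℤ
x :^∗ suc n = x :* (x :^∗ n)

Unit-^∗ : ∀ {a} n → Unit a → Unit (a ^∗ n)
Unit-^∗ zero a₀ = refl
Unit-^∗ {a} (suc n) a₀ = Unit-∗ {a} {a ^∗ n} a₀ (Unit-^∗ {a} n a₀)

⊛-≈∗ : ∀ {a a′ b b′} → a ≈ a′ → b ≈ b′ → a ⊛ b ≈ a′ ∗ b′
⊛-≈∗ {a} {b = b} p q = R.trans (⊛≈∗ a b) (R.*-cong p q)

^≈^∗ : ∀ a n → a ^ n ≈ a ^∗ n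
^≈^∗ a zero    = R.refl
^≈^∗ a (suc n) = ⊛-≈∗ R.refl (^≈^∗ a n)

^⊛^≈ : ∀ a m b n → a ^ m ⊛ b ^ n ≈ a ^∗ m ∗ b ^∗ n
^⊛^≈ a m b n = ⊛-≈∗ (^≈^∗ a m) (^≈^∗ b n)

⊘-unique : ∀ {a a′ b b′ x} → a ≈ a′ → b ≈ b′ → Unit b′ → x ∗ b′ ≈ a′ → x ≈ a ⊘ b
⊘-unique {a} {b = b} {x = x} p q b₀ h = R.trans
  (∗-inv-unique {a} {b} {x} (trans (at q 0) b₀) (R.trans (R.*-congˡ q) (R.trans h (R.sym p))))
  (R.sym (⊛≈∗ a (inv b)))

⊘-∗ : ∀ {a a′ b b′} → a ≈ a′ → b ≈ b′ → Unit b′ → (a ⊘ b) ∗ b′ ≈ a′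
⊘-∗ {a} {a′} {b} {b′} p q b₀ = begin
  (a ⊘ b) ∗ b′        ≈⟨ R.*-cong (⊛≈∗ a (inv b)) (R.sym q) ⟩
  a ∗ inv b ∗ b       ≈⟨ solve 3 (λ a i b → a :* i :* b := a :* (b :* i)) R.refl a (inv b) b ⟩
  a ∗ (b ∗ inv b)     ≈⟨ R.*-congˡ (inv-inverseʳ {b} (trans (at q 0) b₀)) ⟩
  a ∗ one             ≈⟨ R.*-identityʳ a ⟩
  a                   ≈⟨ p ⟩
  a′                  ∎
  where open ≈-Reasoning

private
  -- Here `ω` is Ω(-q) = f(-q, -q⁵), so that W = ω(q³), and `V` at q² is the reciprocal of φ(-q²)
  -- φ(-q¹⁸).
  q φ₁ φ₂ φ₃ φ₉ φ₁₈ ω V n̂ : Series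
  q = mono 1
  φ₁ = θ -1ℤ 1 1
  φ₂ = θ -1ℤ 2 2
  φ₃ = θ -1ℤ 3 3
  φ₉ = θ -1ℤ 9 9
  φ₁₈ = θ -1ℤ 18 18
  ω = θ -1ℤ 1 5
  V = inv (φ₁ ∗ φ₉)
  n̂ = norm φ₁

  φ₁-f : φ₁ ∗ f 2 ≈ f 1 ∗ f 1
  φ₁-f = φ₋-product 1

  φ₃-f : φ₃ ∗ f 6 ≈ f 3 ∗ f 3
  φ₃-f = φ₋-product 3

  V-inverse : V ∗ (φ₁ ∗ φ₉) ≈ one
  V-inverse = R.trans (R.*-comm V (φ₁ ∗ φ₉)) (inv-inverseʳ {φ₁ ∗ φ₉} (Unit-∗ {φ₁} {φ₉} (Unit-φ₋ 1) (Unit-φ₋ 9)))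

  -- The part φ(q⁹) of the trisection meets φ(-q⁹) and gives an even square, and both Ω terms give
  -- the same product; so the only odd contribution is 2q f₁₂².
  φ₊₁∗φ₉ : θ 1ℤ 1 1 ∗ φ₉ ≈ φ₁₈ ∗ φ₁₈ ⊕ constant (+ 2) ∗ q ∗ (f 12 ∗ f 12 ⊕ mono 3 ∗ (θ -1ℤ 30 6 ∗ θ -1ℤ 30 6))
  φ₊₁∗φ₉ = begin
    θ 1ℤ 1 1 ∗ φ₉
      ≈⟨ R.*-congʳ (R.trans (θ-trisection 1ℤ refl) (R.+-congʳ (R.+-congˡ (R.*-congˡ (θ-swap 1ℤ))))) ⟩
    (θ 1ℤ 9 9 ⊕ term 1ℤ 1 ∗ Ω ⊕ term 1ℤ 1 ∗ Ω) ∗ φ₉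
      ≈⟨ solve 4 (λ a x q b → (a :+ con 1ℤ :* q :* x :+ con 1ℤ :* q :* x) :* b := a :* b :+ con (+ 2) :* q :* (x :* b)) R.refl (θ 1ℤ 9 9) Ω q φ₉ ⟩
    θ 1ℤ 9 9 ∗ φ₉ ⊕ constant (+ 2) ∗ q ∗ (Ω ∗ φ₉)
      ≈⟨ R.+-cong (φ₊∗φ₋ 9) (R.*-congˡ (R.trans θ-product (R.+-congʳ (R.*-cong pentagonal pentagonal)))) ⟩
    φ₁₈ ∗ φ₁₈ ⊕ constant (+ 2) ∗ q ∗ (f 12 ∗ f 12 ⊕ mono 3 ∗ (θ -1ℤ 30 6 ∗ θ -1ℤ 30 6)) ∎
    where
    open ≈-Reasoning
    Ω : Series
    Ω = θ 1ℤ 3 15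

  S9-quotient : S9genfun ∗ (f 1 ^∗ 2 ∗ f 4 ∗ f 18 ^∗ 3) ≈ f 2 ^∗ 3 ∗ f 9 ^∗ 2 ∗ f 36
  S9-quotient = ⊘-∗ (⊛-≈∗ (^⊛^≈ (f 2) 3 (f 9) 2) R.refl) (⊛-≈∗ (⊛-≈∗ (^≈^∗ (f 1) 2) R.refl) (^≈^∗ (f 18) 3))
    (Unit-∗ {f 1 ^∗ 2 ∗ f 4} {f 18 ^∗ 3} (Unit-∗ {f 1 ^∗ 2} {f 4} (Unit-^∗ {f 1} 2 (Unit-f 1)) (Unit-f 4)) (Unit-^∗ {f 18} 3 (Unit-f 18)))

  -- The eta quotient regrouped into quotients f_k² / f_(2k) for k = 1, 2, 9, 18; the unit `u`
  -- clears their denominators.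
  S9-φ : S9genfun ∗ φ₁ ∗ φ₁₈ ≈ φ₂ ∗ φ₉
  S9-φ = ∗-cancelˡ {u} (S9genfun ∗ φ₁ ∗ φ₁₈) (φ₂ ∗ φ₉)
    (Unit-∗ {f 2 ∗ f 4 ∗ f 18} {f 36} (Unit-∗ {f 2 ∗ f 4} {f 18} (Unit-∗ {f 2} {f 4} (Unit-f 2) (Unit-f 4)) (Unit-f 18)) (Unit-f 36)) (begin
    f 2 ∗ f 4 ∗ f 18 ∗ f 36 ∗ (S9genfun ∗ φ₁ ∗ φ₁₈)
      ≈⟨ solve 7 (λ a b c d G x y → a :* b :* c :* d :* (G :* x :* y) := G :* ((x :* a) :* b :* (c :* (y :* d)))) R.refl (f 2) (f 4) (f 18) (f 36) S9genfun φ₁ φ₁₈ ⟩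
    S9genfun ∗ ((φ₁ ∗ f 2) ∗ f 4 ∗ (f 18 ∗ (φ₁₈ ∗ f 36)))
      ≈⟨ R.*-congˡ (R.*-cong (R.*-congʳ φ₁-f) (R.*-congˡ (φ₋-product 18))) ⟩
    S9genfun ∗ ((f 1 ∗ f 1) ∗ f 4 ∗ (f 18 ∗ (f 18 ∗ f 18)))
      ≈⟨ solve 4 (λ G a b c → G :* ((a :* a) :* b :* (c :* (c :* c))) := G :* (a :^∗ 2 :* b :* c :^∗ 3)) R.refl S9genfun (f 1) (f 4) (f 18) ⟩
    S9genfun ∗ (f 1 ^∗ 2 ∗ f 4 ∗ f 18 ^∗ 3)
      ≈⟨ S9-quotient ⟩
    f 2 ^∗ 3 ∗ f 9 ^∗ 2 ∗ f 36
      ≈⟨ solve 3 (λ a b c → a :^∗ 3 :* b :^∗ 2 :* c := a :* (a :* a) :* (b :* b) :* c) R.refl (f 2) (f 9) (f 36) ⟩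
    f 2 ∗ (f 2 ∗ f 2) ∗ (f 9 ∗ f 9) ∗ f 36
      ≈⟨ R.*-congʳ (R.*-cong (R.*-congˡ (φ₋-product 2)) (φ₋-product 9)) ⟨
    f 2 ∗ (φ₂ ∗ f 4) ∗ (φ₉ ∗ f 18) ∗ f 36
      ≈⟨ solve 6 (λ a b c d x y → a :* (x :* b) :* (y :* c) :* d := a :* b :* c :* d :* (x :* y)) R.refl (f 2) (f 4) (f 18) (f 36) φ₂ φ₉ ⟩
    f 2 ∗ f 4 ∗ f 18 ∗ f 36 ∗ (φ₂ ∗ φ₉) ∎)
    where
    open ≈-Reasoning
    u : Series
    u = f 2 ∗ f 4 ∗ f 18 ∗ f 36

  -- The relation φ(q) φ(-q) = φ(-q²)² trades the denominator φ(-q) for φ(-q²). The denominator is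
  -- then even, and parity can be read off the numerator.
  S9-theta : S9genfun ∗ (φ₂ ∗ φ₁₈) ≈ θ 1ℤ 1 1 ∗ φ₉
  S9-theta = ∗-cancelˡ {φ₂} (S9genfun ∗ (φ₂ ∗ φ₁₈)) (θ 1ℤ 1 1 ∗ φ₉) (Unit-φ₋ 2) (begin
    φ₂ ∗ (S9genfun ∗ (φ₂ ∗ φ₁₈))                  ≈⟨ solve 3 (λ a G c → a :* (G :* (a :* c)) := G :* (a :* a) :* c) R.refl φ₂ S9genfun φ₁₈ ⟩
    S9genfun ∗ (φ₂ ∗ φ₂) ∗ φ₁₈                    ≈⟨ R.*-congʳ (R.*-congˡ (φ₊∗φ₋ 1)) ⟨
    S9genfun ∗ (θ 1ℤ 1 1 ∗ φ₁) ∗ φ₁₈              ≈⟨ solve 4 (λ G p x y → G :* (p :* x) :* y := G :* x :* y :* p) R.refl S9genfun (θ 1ℤ 1 1) φ₁ φ₁₈ ⟩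
    S9genfun ∗ φ₁ ∗ φ₁₈ ∗ θ 1ℤ 1 1                ≈⟨ R.*-congʳ S9-φ ⟩
    φ₂ ∗ φ₉ ∗ θ 1ℤ 1 1                            ≈⟨ solve 3 (λ a b p → a :* b :* p := a :* (p :* b)) R.refl φ₂ φ₉ (θ 1ℤ 1 1) ⟩
    φ₂ ∗ (θ 1ℤ 1 1 ∗ φ₉)                          ∎)
    where open ≈-Reasoning

  H : Series
  H = constant (+ 2) ∗ (f 6 ∗ f 6) ∗ V

  S9-bisection : S9genfun ≈ dilate 2 (V ∗ (φ₉ ∗ φ₉ ⊕ constant (+ 2) ∗ (mono 2 ∗ (θ -1ℤ 15 3 ∗ θ -1ℤ 15 3)))) ⊕ q ∗ dilate 2 H
  S9-bisection = begin
    S9genfun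
      ≈⟨ R.*-identityʳ S9genfun ⟨
    S9genfun ∗ one
      ≈⟨ R.*-congˡ DV-inverse ⟨
    S9genfun ∗ (D V ∗ (φ₂ ∗ φ₁₈))
      ≈⟨ solve 3 (λ G v x → G :* (v :* x) := v :* (G :* x)) R.refl S9genfun (D V) (φ₂ ∗ φ₁₈) ⟩
    D V ∗ (S9genfun ∗ (φ₂ ∗ φ₁₈))
      ≈⟨ R.*-congˡ (R.trans S9-theta φ₊₁∗φ₉) ⟩
    D V ∗ (φ₁₈ ∗ φ₁₈ ⊕ constant (+ 2) ∗ q ∗ (f 12 ∗ f 12 ⊕ mono 3 ∗ (θ -1ℤ 30 6 ∗ θ -1ℤ 30 6)))
      ≈⟨ solve 7 (λ v a c q b m d → v :* (a :+ c :* q :* (b :+ m :* d)) := v :* (a :+ c :* (q :* m :* d)) :+ q :* (c :* b :* v)) R.refl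
           (D V) (φ₁₈ ∗ φ₁₈) (constant (+ 2)) q (f 12 ∗ f 12) (mono 3) (θ -1ℤ 30 6 ∗ θ -1ℤ 30 6) ⟩
    -- The prefactor q times q³ is q⁴, which moves the square of `θ -1ℤ 30 6` into the even part.
    D V ∗ (φ₁₈ ∗ φ₁₈ ⊕ constant (+ 2) ∗ (q ∗ mono 3 ∗ (θ -1ℤ 30 6 ∗ θ -1ℤ 30 6))) ⊕ q ∗ (constant (+ 2) ∗ (f 12 ∗ f 12) ∗ D V)
      ≈⟨ R.+-cong (∗D R.refl (⊕D (∗D φ₁₈-D φ₁₈-D) (∗D two-D (∗D q⁴-D (∗D Ω-D Ω-D))))) (R.*-congˡ (∗D (∗D two-D (∗D f₁₂-D f₁₂-D)) R.refl)) ⟩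
    D (V ∗ (φ₉ ∗ φ₉ ⊕ constant (+ 2) ∗ (mono 2 ∗ (θ -1ℤ 15 3 ∗ θ -1ℤ 15 3)))) ⊕ q ∗ D H ∎
    where
    open ≈-Reasoning
    D : Series → Series
    D = dilate 2
    ∗D : ∀ {x y a b} → x ≈ D a → y ≈ D b → x ∗ y ≈ D (a ∗ b)
    ∗D {a = a} {b} p r = R.trans (R.*-cong p r) (R.sym (dilate-∗ 2 a b))
    ⊕D : ∀ {x y a b} → x ≈ D a → y ≈ D b → x ⊕ y ≈ D (a ⊕ b)
    ⊕D {a = a} {b} p r = R.trans (R.+-cong p r) (R.sym (dilate-⊕ 2 a b))
    φ₁₈-D : φ₁₈ ≈ D φ₉
    φ₁₈-D = R.sym (dilate-θ 2 9 9)
    Ω-D : θ -1ℤ 30 6 ≈ D (θ -1ℤ 15 3)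
    Ω-D = R.sym (dilate-θ 2 15 3)
    f₁₂-D : f 12 ≈ D (f 6)
    f₁₂-D = R.sym (dilate-f 2 6)
    two-D : constant (+ 2) ≈ D (constant (+ 2))
    two-D = R.sym (dilate-constant 2 (+ 2))
    q⁴-D : q ∗ mono 3 ≈ D (mono 2)
    q⁴-D = R.trans (R.sym (mono-+ 1 3)) (R.sym (dilate-mono 2 2))
    DV-inverse : D V ∗ (φ₂ ∗ φ₁₈) ≈ one
    DV-inverse = R.trans (∗D R.refl (∗D (R.sym (dilate-θ 2 1 1)) φ₁₈-D)) (R.trans (dilate-cong 2 V-inverse) (dilate-constant 2 1ℤ))

  S9-odd : section 2 1 S9genfun ≈ H
  S9-odd = R.trans (section-cong 2 1 S9-bisection) (R.trans (section-⊕ 2 _ _ 1) (R.trans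
    (R.+-cong (R.trans (section-cong 2 1 (R.sym (R.trans (R.*-congʳ mono-zero) (R.*-identityˡ E)))) (section-dilate-≢ 2 E′ 1 0 (s<s z<s) z<s λ ())) (section-dilate 2 H 1 (s<s z<s)))
    (R.+-identityˡ H)))
    where
    E′ E : Series
    E′ = V ∗ (φ₉ ∗ φ₉ ⊕ constant (+ 2) ∗ (mono 2 ∗ (θ -1ℤ 15 3 ∗ θ -1ℤ 15 3)))
    E = dilate 2 E′

  -- Trisection of the odd part

  φ₁-trisect : φ₁ ≈ trisect φ₃ (⊝ (ω ⊕ ω)) null
  φ₁-trisect = R.trans (θ-trisection -1ℤ refl) (R.trans
    (R.+-cong (R.+-cong (R.sym (dilate-θ 3 3 3)) (R.*-congˡ (R.trans (θ-swap -1ℤ) (R.sym (dilate-θ 3 1 5))))) (R.*-congˡ (R.sym (dilate-θ 3 1 5))))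
    (R.trans (solve 4 (λ a q w m → a :+ con -1ℤ :* q :* w :+ con -1ℤ :* q :* w := a :+ q :* :- (w :+ w) :+ m :* con 0ℤ) R.refl (D φ₃) q (D ω) (mono 2))
      (R.+-cong (R.+-congˡ (R.*-congˡ (R.sym (R.trans (dilate-⊝ 3 (ω ⊕ ω)) (R.-‿cong (dilate-⊕ 3 ω ω)))))) (R.*-congˡ (R.sym (dilate-null 3))))))
    where
    D : Series → Series
    D = dilate 3

  -- No square is 2 modulo 3, so the third section of φ(-q) is `null` and the mixed term of the norm
  -- form vanishes; 8 is the cube of the coefficient in -2qω.
  n̂-cubic : n̂ ≈ φ₃ ∗ φ₃ ∗ φ₃ ⊕ ⊝ (constant (+ 8) ∗ q ∗ (ω ∗ ω ∗ ω))
  n̂-cubic = R.trans (norm-cong φ₁-trisect) (R.trans (norm-trisect φ₃ (⊝ (ω ⊕ ω)) null)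
    (solve 3 (λ a w q → a :* a :* a :+ q :* (:- (w :+ w) :* :- (w :+ w) :* :- (w :+ w)) :+ q :* q :* (con 0ℤ :* con 0ℤ :* con 0ℤ) :+ :- (con (+ 3) :* q :* (a :* :- (w :+ w) :* con 0ℤ))
       := a :* a :* a :+ :- (con (+ 8) :* q :* (w :* w :* w))) R.refl φ₃ ω q))

  -- Take norms in φ(-q) f₂ = f₁² and insert the norms f₁⁴ / f₃ of f₁ and f₂⁴ / f₆ of f₂.
  n̂-product : n̂ ∗ (f 2 ^∗ 4 ∗ f 3 ^∗ 2) ≈ f 1 ^∗ 8 ∗ f 6
  n̂-product = begin
    n̂ ∗ (f 2 ^∗ 4 ∗ f 3 ^∗ 2)
      ≈⟨ solve 3 (λ n a b → n :* (a :^∗ 4 :* b :^∗ 2) := n :* (a :* (a :* a :* a)) :* (b :* b)) R.refl n̂ (f 2) (f 3) ⟩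
    n̂ ∗ (f 2 ∗ (f 2 ∗ f 2 ∗ f 2)) ∗ (f 3 ∗ f 3)
      ≈⟨ R.*-congʳ (R.*-congˡ norm-f₂) ⟨
    n̂ ∗ (norm (f 2) ∗ f 6) ∗ (f 3 ∗ f 3)
      ≈⟨ solve 4 (λ n m x y → n :* (m :* x) :* (y :* y) := n :* m :* (y :* y) :* x) R.refl n̂ (norm (f 2)) (f 6) (f 3) ⟩
    n̂ ∗ norm (f 2) ∗ (f 3 ∗ f 3) ∗ f 6
      ≈⟨ R.*-congʳ (R.*-congʳ (R.trans (R.sym (norm-∗ φ₁ (f 2))) (R.trans (norm-cong φ₁-f) (norm-∗ (f 1) (f 1))))) ⟩
    norm (f 1) ∗ norm (f 1) ∗ (f 3 ∗ f 3) ∗ f 6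
      ≈⟨ solve 3 (λ m y x → m :* m :* (y :* y) :* x := m :* y :* (m :* y) :* x) R.refl (norm (f 1)) (f 3) (f 6) ⟩
    norm (f 1) ∗ f 3 ∗ (norm (f 1) ∗ f 3) ∗ f 6
      ≈⟨ R.*-congʳ (R.*-cong norm-f₁ norm-f₁) ⟩
    f 1 ∗ (f 1 ∗ f 1 ∗ f 1) ∗ (f 1 ∗ (f 1 ∗ f 1 ∗ f 1)) ∗ f 6
      ≈⟨ solve 2 (λ a x → a :* (a :* a :* a) :* (a :* (a :* a :* a)) :* x := a :^∗ 8 :* x) R.refl (f 1) (f 6) ⟩
    f 1 ^∗ 8 ∗ f 6 ∎
    where open ≈-Reasoning

  n̂-unit : Unit n̂
  n̂-unit = trans (sym (trans (∗-zero n̂ (f 2 ^∗ 4 ∗ f 3 ^∗ 2)) (trans (cong (λ x → n̂ 0 ℤ.* x)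
      (Unit-∗ {f 2 ^∗ 4} {f 3 ^∗ 2} (Unit-^∗ {f 2} 4 (Unit-f 2)) (Unit-^∗ {f 3} 2 (Unit-f 3)))) (ℤP.*-identityʳ _))))
    (trans (at n̂-product 0) (Unit-∗ {f 1 ^∗ 8} {f 6} (Unit-^∗ {f 1} 8 (Unit-f 1)) (Unit-f 6)))

  K : Series
  K = constant (+ 2) ∗ (f 2 ∗ f 2) ∗ inv φ₃ ∗ inv n̂

  H₀ H₁ H₂ : Series
  H₀ = K ∗ (φ₃ ∗ φ₃)
  H₁ = K ∗ (constant (+ 2) ∗ (φ₃ ∗ ω))
  H₂ = K ∗ (constant (+ 4) ∗ (ω ∗ ω))

  -- 1 / φ₁ = (φ₉² + 2 q φ₉ W + 4 q² W²) / (φ₉³ - 8 q³ W³) with W = ω(q³).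
  H-trisect : H ≈ trisect H₀ H₁ H₂
  H-trisect = begin
    constant (+ 2) ∗ (f 6 ∗ f 6) ∗ V
      ≈⟨ R.*-cong two-f V-expand ⟩
    D (constant (+ 2) ∗ (f 2 ∗ f 2)) ∗ (D (inv φ₃) ∗ D (inv n̂) ∗ Y)
      ≈⟨ solve 4 (λ a b c y → a :* (b :* c :* y) := a :* b :* c :* y) R.refl (D (constant (+ 2) ∗ (f 2 ∗ f 2))) (D (inv φ₃)) (D (inv n̂)) Y ⟩
    D (constant (+ 2) ∗ (f 2 ∗ f 2)) ∗ D (inv φ₃) ∗ D (inv n̂) ∗ Y
      ≈⟨ R.*-congʳ (∗D (∗D R.refl R.refl) R.refl) ⟩
    D K ∗ Y
      ≈⟨ solve 6 (λ k a w q c d → k :* (a :* a :+ c :* q :* (a :* w) :+ d :* (q :* q) :* (w :* w))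
            := k :* (a :* a) :+ q :* (k :* (c :* (a :* w))) :+ q :* q :* (k :* (d :* (w :* w)))) R.refl (D K) A W q (constant (+ 2)) (constant (+ 4)) ⟩
    D K ∗ (A ∗ A) ⊕ q ∗ (D K ∗ (constant (+ 2) ∗ (A ∗ W))) ⊕ q ∗ q ∗ (D K ∗ (constant (+ 4) ∗ (W ∗ W)))
      ≈⟨ R.+-cong (R.+-cong (∗D R.refl (∗D R.refl R.refl)) (R.*-congˡ (∗D R.refl (∗D (constant-D (+ 2)) (∗D R.refl R.refl)))))
           (R.*-cong (R.sym (mono-+ 1 1)) (∗D R.refl (∗D (constant-D (+ 4)) (∗D R.refl R.refl)))) ⟩
    trisect H₀ H₁ H₂ ∎
    where
    open ≈-Reasoning
    D : Series → Series
    D = dilate 3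
    ∗D : ∀ {x y a b} → x ≈ D a → y ≈ D b → x ∗ y ≈ D (a ∗ b)
    ∗D {a = a} {b} p r = R.trans (R.*-cong p r) (R.sym (dilate-∗ 3 a b))
    constant-D : ∀ c → constant c ≈ D (constant c)
    constant-D c = R.sym (dilate-constant 3 c)
    A W Y : Series
    A = D φ₃
    W = D ω
    -- The cofactor a² + ab + b² of a - b in a³ - b³, for a = A and b = 2qW.
    Y = A ∗ A ⊕ constant (+ 2) ∗ q ∗ (A ∗ W) ⊕ constant (+ 4) ∗ (q ∗ q) ∗ (W ∗ W)
    two-f : constant (+ 2) ∗ (f 6 ∗ f 6) ≈ D (constant (+ 2) ∗ (f 2 ∗ f 2))
    two-f = ∗D (constant-D (+ 2)) (∗D (R.sym (dilate-f 3 2)) (R.sym (dilate-f 3 2)))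
    φ₁-D : φ₁ ≈ A ⊕ ⊝ (constant (+ 2) ∗ q ∗ W)
    φ₁-D = R.trans φ₁-trisect (R.trans (R.+-cong (R.+-congˡ (R.*-congˡ (R.trans (dilate-⊝ 3 (ω ⊕ ω)) (R.-‿cong (dilate-⊕ 3 ω ω))))) (R.*-congˡ (dilate-null 3)))
      (solve 4 (λ a q w m → a :+ q :* :- (w :+ w) :+ m :* con 0ℤ := a :+ :- (con (+ 2) :* q :* w)) R.refl A q W (mono 2)))
    q³ : q ∗ q ∗ q ≈ D q
    q³ = R.trans (R.*-congʳ (R.sym (mono-+ 1 1))) (R.trans (R.sym (mono-+ 2 1)) (R.sym (dilate-mono 3 1)))
    φ₁∗Y : φ₁ ∗ Y ≈ D n̂
    φ₁∗Y = begin
      φ₁ ∗ Y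
        ≈⟨ R.*-congʳ φ₁-D ⟩
      (A ⊕ ⊝ (constant (+ 2) ∗ q ∗ W)) ∗ Y
        ≈⟨ solve 3 (λ a q w → (a :+ :- (con (+ 2) :* q :* w)) :* (a :* a :+ con (+ 2) :* q :* (a :* w) :+ con (+ 4) :* (q :* q) :* (w :* w))
             := a :* a :* a :+ :- (con (+ 8) :* (q :* q :* q) :* (w :* w :* w))) R.refl A q W ⟩
      A ∗ A ∗ A ⊕ ⊝ (constant (+ 8) ∗ (q ∗ q ∗ q) ∗ (W ∗ W ∗ W))
        ≈⟨ R.+-cong (∗D (∗D R.refl R.refl) R.refl) (R.trans (R.-‿cong (∗D (∗D (constant-D (+ 8)) q³) (∗D (∗D R.refl R.refl) R.refl))) (R.sym (dilate-⊝ 3 _))) ⟩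
      D (φ₃ ∗ φ₃ ∗ φ₃) ⊕ D (⊝ (constant (+ 8) ∗ q ∗ (ω ∗ ω ∗ ω)))
        ≈⟨ R.trans (R.sym (dilate-⊕ 3 _ _)) (dilate-cong 3 (R.sym n̂-cubic)) ⟩
      D n̂ ∎
    D-inverse : ∀ {a} → Unit a → D a ∗ D (inv a) ≈ one
    D-inverse {a} a₀ = R.trans (R.sym (dilate-∗ 3 a (inv a))) (R.trans (dilate-cong 3 (inv-inverseʳ {a} a₀)) (dilate-constant 3 1ℤ))
    V-expand : V ≈ D (inv φ₃) ∗ D (inv n̂) ∗ Y
    V-expand = begin
      V
        ≈⟨ solve 1 (λ v → v := v :* con 1ℤ :* con 1ℤ) R.refl V ⟩
      V ∗ one ∗ one
        ≈⟨ R.*-cong (R.*-congˡ (D-inverse {φ₃} (Unit-φ₋ 3))) (R.trans (R.*-congʳ φ₁∗Y) (D-inverse {n̂} n̂-unit)) ⟨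
      -- Each inserted one is a product with an inverse. Regrouped, they offer φ₁ A to cancel `V`,
      -- because A is φ(-q⁹).
      V ∗ (A ∗ D (inv φ₃)) ∗ (φ₁ ∗ Y ∗ D (inv n̂))
        ≈⟨ solve 6 (λ v a b x y c → v :* (a :* b) :* (x :* y :* c) := v :* (x :* a) :* (b :* c :* y)) R.refl V A (D (inv φ₃)) φ₁ Y (D (inv n̂)) ⟩
      V ∗ (φ₁ ∗ A) ∗ (D (inv φ₃) ∗ D (inv n̂) ∗ Y)
        ≈⟨ R.*-congʳ (R.trans (R.*-congˡ (R.*-congˡ (dilate-θ 3 3 3))) V-inverse) ⟩
      one ∗ (D (inv φ₃) ∗ D (inv n̂) ∗ Y)
        ≈⟨ R.*-identityˡ _ ⟩
      D (inv φ₃) ∗ D (inv n̂) ∗ Y ∎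

  -- The three eta quotients

  φ₃-inverse : φ₃ ∗ inv φ₃ ≈ one
  φ₃-inverse = inv-inverseʳ {φ₃} (Unit-φ₋ 3)

  n̂-inverse : n̂ ∗ inv n̂ ≈ one
  n̂-inverse = inv-inverseʳ {n̂} n̂-unit

  -- Exchanges 1 / n̂ for f₂⁴f₃² / (f₁⁸f₆) in multiplied-out form; all three residues use it.
  f₁⁸f₆ : ∀ x → inv n̂ ∗ x ∗ (f 1 ^∗ 8 ∗ f 6) ≈ x ∗ (f 2 ^∗ 4 ∗ f 3 ^∗ 2)
  f₁⁸f₆ x = begin
    inv n̂ ∗ x ∗ (f 1 ^∗ 8 ∗ f 6)            ≈⟨ R.*-congˡ n̂-product ⟨
    inv n̂ ∗ x ∗ (n̂ ∗ F)                     ≈⟨ solve 4 (λ i x n y → i :* x :* (n :* y) := n :* i :* (x :* y)) R.refl (inv n̂) x n̂ F ⟩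
    n̂ ∗ inv n̂ ∗ (x ∗ F)                     ≈⟨ R.*-congʳ n̂-inverse ⟩
    one ∗ (x ∗ F)                           ≈⟨ R.*-identityˡ (x ∗ F) ⟩
    x ∗ F                                   ∎
    where
    open ≈-Reasoning
    F : Series
    F = f 2 ^∗ 4 ∗ f 3 ^∗ 2

  residue₁ : inv n̂ ∗ (f 2 ∗ f 2 ∗ φ₃) ≈ (f 2 ^ 6 ⊛ f 3 ^ 4) ⊘ (f 1 ^ 8 ⊛ f 6 ^ 2)
  residue₁ = ⊘-unique (^⊛^≈ (f 2) 6 (f 3) 4) (^⊛^≈ (f 1) 8 (f 6) 2)
    (Unit-∗ {f 1 ^∗ 8} {f 6 ^∗ 2} (Unit-^∗ {f 1} 8 (Unit-f 1)) (Unit-^∗ {f 6} 2 (Unit-f 6))) (begin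
    inv n̂ ∗ (f 2 ∗ f 2 ∗ φ₃) ∗ (f 1 ^∗ 8 ∗ f 6 ^∗ 2)
      ≈⟨ solve 4 (λ i x a b → i :* x :* (a :* b :^∗ 2) := i :* x :* (a :* b) :* b) R.refl (inv n̂) (f 2 ∗ f 2 ∗ φ₃) (f 1 ^∗ 8) (f 6) ⟩
    inv n̂ ∗ (f 2 ∗ f 2 ∗ φ₃) ∗ (f 1 ^∗ 8 ∗ f 6) ∗ f 6
      ≈⟨ R.*-congʳ (f₁⁸f₆ (f 2 ∗ f 2 ∗ φ₃)) ⟩
    f 2 ∗ f 2 ∗ φ₃ ∗ (f 2 ^∗ 4 ∗ f 3 ^∗ 2) ∗ f 6
      ≈⟨ solve 4 (λ a p b c → a :* a :* p :* (a :^∗ 4 :* b :^∗ 2) :* c := a :^∗ 6 :* b :^∗ 2 :* (p :* c)) R.refl (f 2) φ₃ (f 3) (f 6) ⟩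
    f 2 ^∗ 6 ∗ f 3 ^∗ 2 ∗ (φ₃ ∗ f 6)
      ≈⟨ R.*-congˡ φ₃-f ⟩
    f 2 ^∗ 6 ∗ f 3 ^∗ 2 ∗ (f 3 ∗ f 3)
      ≈⟨ solve 2 (λ a b → a :* b :^∗ 2 :* (b :* b) := a :* b :^∗ 4) R.refl (f 2 ^∗ 6) (f 3) ⟩
    f 2 ^∗ 6 ∗ f 3 ^∗ 4 ∎)
    where open ≈-Reasoning

  residue₃ : inv n̂ ∗ (f 2 ∗ f 2 ∗ ω) ≈ (f 2 ^ 5 ⊛ f 3 ⊛ f 6) ⊘ (f 1 ^ 7)
  residue₃ = ⊘-unique (⊛-≈∗ (⊛-≈∗ (^≈^∗ (f 2) 5) R.refl) R.refl) (^≈^∗ (f 1) 7) (Unit-^∗ {f 1} 7 (Unit-f 1))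
    -- The unit f₁f₆ raises the denominator f₁⁷ of the claim to f₁⁸f₆, the one that comes with 1 /
    -- n̂.
    (∗-cancelˡ {f 1 ∗ f 6} (inv n̂ ∗ (f 2 ∗ f 2 ∗ ω) ∗ f 1 ^∗ 7) (f 2 ^∗ 5 ∗ f 3 ∗ f 6) (Unit-∗ {f 1} {f 6} (Unit-f 1) (Unit-f 6)) (begin
    f 1 ∗ f 6 ∗ (inv n̂ ∗ (f 2 ∗ f 2 ∗ ω) ∗ f 1 ^∗ 7)
      ≈⟨ solve 3 (λ a c y → a :* c :* (y :* a :^∗ 7) := y :* (a :^∗ 8 :* c)) R.refl (f 1) (f 6) (inv n̂ ∗ (f 2 ∗ f 2 ∗ ω)) ⟩
    inv n̂ ∗ (f 2 ∗ f 2 ∗ ω) ∗ (f 1 ^∗ 8 ∗ f 6)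
      ≈⟨ f₁⁸f₆ (f 2 ∗ f 2 ∗ ω) ⟩
    f 2 ∗ f 2 ∗ ω ∗ (f 2 ^∗ 4 ∗ f 3 ^∗ 2)
      ≈⟨ solve 3 (λ b w c → b :* b :* w :* (b :^∗ 4 :* c :^∗ 2) := b :^∗ 5 :* c :* (w :* b :* c)) R.refl (f 2) ω (f 3) ⟩
    f 2 ^∗ 5 ∗ f 3 ∗ (ω ∗ f 2 ∗ f 3)
      ≈⟨ R.*-congˡ θ-1-5 ⟩
    f 2 ^∗ 5 ∗ f 3 ∗ (f 1 ∗ f 6 ∗ f 6)
      ≈⟨ solve 4 (λ b c a d → b :* c :* (a :* d :* d) := a :* d :* (b :* c :* d)) R.refl (f 2 ^∗ 5) (f 3) (f 1) (f 6) ⟩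
    f 1 ∗ f 6 ∗ (f 2 ^∗ 5 ∗ f 3 ∗ f 6) ∎))
    where open ≈-Reasoning

  residue₅ : inv n̂ ∗ (f 2 ∗ f 2 ∗ inv φ₃ ∗ (ω ∗ ω)) ≈ (f 2 ^ 4 ⊛ f 6 ^ 4) ⊘ (f 1 ^ 6 ⊛ f 3 ^ 2)
  residue₅ = ⊘-unique (^⊛^≈ (f 2) 4 (f 6) 4) (^⊛^≈ (f 1) 6 (f 3) 2)
    (Unit-∗ {f 1 ^∗ 6} {f 3 ^∗ 2} (Unit-^∗ {f 1} 6 (Unit-f 1)) (Unit-^∗ {f 3} 2 (Unit-f 3)))
    -- Again f₁⁶ is raised to f₁⁸f₆. The remaining f₃² becomes φ₃ f₆, whose φ₃ cancels the inverse
    -- in `X`.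
    (∗-cancelˡ {f 1 ∗ f 1 ∗ f 6} (inv n̂ ∗ X ∗ (f 1 ^∗ 6 ∗ f 3 ^∗ 2)) (f 2 ^∗ 4 ∗ f 6 ^∗ 4)
      (Unit-∗ {f 1 ∗ f 1} {f 6} (Unit-∗ {f 1} {f 1} (Unit-f 1) (Unit-f 1)) (Unit-f 6)) (begin
    f 1 ∗ f 1 ∗ f 6 ∗ (inv n̂ ∗ X ∗ (f 1 ^∗ 6 ∗ f 3 ^∗ 2))
      ≈⟨ solve 4 (λ a d y c → a :* a :* d :* (y :* (a :^∗ 6 :* c :^∗ 2)) := y :* (a :^∗ 8 :* d) :* (c :* c)) R.refl (f 1) (f 6) (inv n̂ ∗ X) (f 3) ⟩
    inv n̂ ∗ X ∗ (f 1 ^∗ 8 ∗ f 6) ∗ (f 3 ∗ f 3)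
      ≈⟨ R.*-cong (f₁⁸f₆ X) (R.sym φ₃-f) ⟩
    X ∗ (f 2 ^∗ 4 ∗ f 3 ^∗ 2) ∗ (φ₃ ∗ f 6)
      ≈⟨ solve 6 (λ b i w c p d → b :* b :* i :* (w :* w) :* (b :^∗ 4 :* c :^∗ 2) :* (p :* d) := p :* i :* (b :^∗ 4 :* (w :* b :* c) :* (w :* b :* c) :* d)) R.refl
           (f 2) (inv φ₃) ω (f 3) φ₃ (f 6) ⟩
    φ₃ ∗ inv φ₃ ∗ (f 2 ^∗ 4 ∗ (ω ∗ f 2 ∗ f 3) ∗ (ω ∗ f 2 ∗ f 3) ∗ f 6)
      ≈⟨ R.*-cong φ₃-inverse (R.*-congʳ (R.*-cong (R.*-congˡ θ-1-5) θ-1-5)) ⟩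
    one ∗ (f 2 ^∗ 4 ∗ (f 1 ∗ f 6 ∗ f 6) ∗ (f 1 ∗ f 6 ∗ f 6) ∗ f 6)
      ≈⟨ solve 3 (λ b a d → con 1ℤ :* (b :* (a :* d :* d) :* (a :* d :* d) :* d) := a :* a :* d :* (b :* d :^∗ 4)) R.refl (f 2 ^∗ 4) (f 1) (f 6) ⟩
    f 1 ∗ f 1 ∗ f 6 ∗ (f 2 ^∗ 4 ∗ f 6 ^∗ 4) ∎))
    where
    open ≈-Reasoning
    X : Series
    X = f 2 ∗ f 2 ∗ inv φ₃ ∗ (ω ∗ ω)

  scaled : ∀ c {x y} → x ≈ y → constant c ∗ x ≈ c · y
  scaled c {x} {y} p = R.trans (R.*-congˡ p) (constant-∗ c y)

  section₀ : section 3 0 H ≈ (+ 2) · ((f 2 ^ 6 ⊛ f 3 ^ 4) ⊘ (f 1 ^ 8 ⊛ f 6 ^ 2))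
  section₀ = R.trans (R.trans (section-cong 3 0 H-trisect) (section-trisect₀ H₀ H₁ H₂)) (R.trans (begin
    c ∗ (f 2 ∗ f 2) ∗ inv φ₃ ∗ inv n̂ ∗ (φ₃ ∗ φ₃)
      ≈⟨ solve 5 (λ c b p i n → c :* (b :* b) :* i :* n :* (p :* p) := p :* i :* (c :* (n :* (b :* b :* p)))) R.refl c (f 2) φ₃ (inv φ₃) (inv n̂) ⟩
    φ₃ ∗ inv φ₃ ∗ (c ∗ (inv n̂ ∗ (f 2 ∗ f 2 ∗ φ₃)))
      ≈⟨ R.trans (R.*-congʳ φ₃-inverse) (R.*-identityˡ _) ⟩
    c ∗ (inv n̂ ∗ (f 2 ∗ f 2 ∗ φ₃)) ∎) (scaled (+ 2) residue₁))
    where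
    open ≈-Reasoning
    c : Series
    c = constant (+ 2)

  section₁ : section 3 1 H ≈ (+ 4) · ((f 2 ^ 5 ⊛ f 3 ⊛ f 6) ⊘ (f 1 ^ 7))
  section₁ = R.trans (R.trans (section-cong 3 1 H-trisect) (section-trisect₁ H₀ H₁ H₂)) (R.trans (begin
    constant (+ 2) ∗ (f 2 ∗ f 2) ∗ inv φ₃ ∗ inv n̂ ∗ (constant (+ 2) ∗ (φ₃ ∗ ω))
      ≈⟨ solve 5 (λ b p i n w → con (+ 2) :* (b :* b) :* i :* n :* (con (+ 2) :* (p :* w)) := p :* i :* (con (+ 4) :* (n :* (b :* b :* w)))) R.refl (f 2) φ₃ (inv φ₃) (inv n̂) ω ⟩
    φ₃ ∗ inv φ₃ ∗ (constant (+ 4) ∗ (inv n̂ ∗ (f 2 ∗ f 2 ∗ ω)))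
      ≈⟨ R.trans (R.*-congʳ φ₃-inverse) (R.*-identityˡ _) ⟩
    constant (+ 4) ∗ (inv n̂ ∗ (f 2 ∗ f 2 ∗ ω)) ∎) (scaled (+ 4) residue₃))
    where open ≈-Reasoning

  section₂ : section 3 2 H ≈ (+ 8) · ((f 2 ^ 4 ⊛ f 6 ^ 4) ⊘ (f 1 ^ 6 ⊛ f 3 ^ 2))
  section₂ = R.trans (R.trans (section-cong 3 2 H-trisect) (section-trisect₂ H₀ H₁ H₂)) (R.trans
    (solve 4 (λ b i n w → con (+ 2) :* (b :* b) :* i :* n :* (con (+ 4) :* (w :* w)) := con (+ 8) :* (n :* (b :* b :* i :* (w :* w)))) R.refl (f 2) (inv φ₃) (inv n̂) ω)
    (scaled (+ 8) residue₅))

  -- The index 6n + 2r + 1 is reached in two steps: the odd part, then residue r modulo 3.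
  S9bar-progression : ∀ r {a} → section 3 r H ≈ a → ∀ n → S9bar (1 + (r + n * 3) * 2) ≡ a n
  S9bar-progression r h n = trans (at S9-odd (r + n * 3)) (at h n)

theorem3p2 : ((n : ℕ) → S9bar (6 * n + 1) ≡ ((+ 2) · ((f 2 ^ 6 ⊛ f 3 ^ 4) ⊘ (f 1 ^ 8 ⊛ f 6 ^ 2))) n)
    × ((n : ℕ) → S9bar (6 * n + 3) ≡ ((+ 4) · ((f 2 ^ 5 ⊛ f 3 ⊛ f 6) ⊘ (f 1 ^ 7))) n)
    × ((n : ℕ) → S9bar (6 * n + 5) ≡ ((+ 8) · ((f 2 ^ 4 ⊛ f 6 ^ 4) ⊘ (f 1 ^ 6 ⊛ f 3 ^ 2))) n)
theorem3p2 = (λ n → trans (cong S9bar (e₀ n)) (S9bar-progression 0 section₀ n))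
  , (λ n → trans (cong S9bar (e₁ n)) (S9bar-progression 1 section₁ n))
  , (λ n → trans (cong S9bar (e₂ n)) (S9bar-progression 2 section₂ n))
  where
  e₀ : ∀ n → 6 * n + 1 ≡ 1 + (0 + n * 3) * 2
  e₀ = ℕSolver.solve-∀
  e₁ : ∀ n → 6 * n + 3 ≡ 1 + (1 + n * 3) * 2
  e₁ = ℕSolver.solve-∀
  e₂ : ∀ n → 6 * n + 5 ≡ 1 + (2 + n * 3) * 2
  e₂ = ℕSolver.solve-∀
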